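{- Let $m,n\ge 3$ and let $e$ be any hyperedge of $\mathcal{C}^3_{m,n}$. Then $\mathcal{E_S}(\mathcal{C}^3_{m,n})>\mathcal{E_S}(\mathcal{C}^3_{m,n}-e)$.
   Context: For a hypergraph $\mathcal{H}$ and distinct vertices $i,j$, the co-degree $c_{ij}$ is the number of hyperedges containing both $i$ and $j$. The Seidel matrix $\mathcal{S}(\mathcal{H})$ has zero diagonal and $(i,j)$-entry $1-2c_{ij}$ for $i\neq j$. The Seidel energy $\mathcal{E_S}(\mathcal{H})$ is the sum of the absolute values of the eigenvalues of $\mathcal{S}(\mathcal{H})$. The complete $3$-uniform bipartite hypergraph $\mathcal{C}^3_{m,n}=(V_1,V_2,E)$ has vertex set $V_1\sqcup V_2$, $|V_1|=m$, $|V_2|=n$, and $E$ = all $3$-subsets meeting both $V_1$ and $V_2$. For a hyperedge $e$, $\mathcal{H}-e$ denotes the hypergraph with the same vertex set and hyperedge set $E\setminus\{e\}$. -}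

module Defs where

open import Algebra.Bundles using (CommutativeMonoid)
open import Algebra.Bundles.Raw using (RawMonoid)
import Algebra.Definitions.RawMonoid as RawMonoidDefs
import Algebra.Properties.CommutativeSemigroup as CommutativeSemigroupProperties
import Algebra.Properties.Group as GroupProperties
import Data.Bool.Properties as Boolₚ
open import Data.Fin using (Fin; zero; suc; toℕ; punchIn; _↑ˡ_; _↑ʳ_; _≟_)
open import Data.Fin.Properties using (any?)
open import Data.Fin.Subset as Subset using (Subset; inside; outside; _∈_)
open import Data.Fin.Subset.Properties using (_∈?_)
open import Data.Integer as ℤ using (ℤ; +_)
open import Data.List using (List; []; _∷_; _++_; map; filter; length)
open import Data.Nat as ℕ using (ℕ; zero; suc)
import Data.Nat.Properties as ℕₚ
open import Data.Product using (∃-syntax; _×_; _,_)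
open import Data.Rational as ℚ using (ℚ; 0ℚ; 1ℚ; ½)
import Data.Rational.Properties as ℚₚ
open import Data.Sum using (inj₁; inj₂)
open import Data.Vec using ([]; _∷_)
open import Data.Vec.Functional using (Vector)
import Data.Vec.Properties as Vecₚ
open import Level using (0ℓ)
open import Relation.Binary.PropositionalEquality
  using (_≡_; _≢_; refl; sym; trans; cong; cong₂; subst; subst₂)
open import Relation.Nullary using (yes; no; ¬?)
open import Relation.Nullary.Decidable using (_×-dec_)
open import Relation.Unary using (Pred; Decidable)

-- Real numbers as Cauchy sequences of rationals; equality of reals is _≃_.

Cauchy : (ℕ → ℚ) → Set
Cauchy a = ∀ ε → 0ℚ ℚ.< ε →
  ∃[ N ] (∀ k l → N ℕ.≤ k → N ℕ.≤ l → ℚ.∣ a k ℚ.- a l ∣ ℚ.< ε)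

record ℝ : Set where
  constructor mkℝ
  field
    seq    : ℕ → ℚ
    cauchy : Cauchy seq

open ℝ public

infix 4 _≃_ _<_

_≃_ : ℝ → ℝ → Set
x ≃ y = ∀ ε → 0ℚ ℚ.< ε →
  ∃[ N ] (∀ k → N ℕ.≤ k → ℚ.∣ seq x k ℚ.- seq y k ∣ ℚ.< ε)

-- A uniform positive gap is required: seq x k < seq y k for all large k
-- would only give x ≤ y in the limit.
_<_ : ℝ → ℝ → Set
x < y = ∃[ ε ] (0ℚ ℚ.< ε ×
  (∃[ N ] (∀ k → N ℕ.≤ k → seq x k ℚ.+ ε ℚ.≤ seq y k)))

private
  module ℚ-+ = GroupProperties ℚₚ.+-0-group

  ℚ-+-commutativeSemigroup =
    CommutativeMonoid.commutativeSemigroup ℚₚ.+-0-commutativeMonoid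

  abstract
    half-pos : ∀ {ε} → 0ℚ ℚ.< ε → 0ℚ ℚ.< ½ ℚ.* ε
    half-pos {ε} 0<ε =
      subst (ℚ._< ½ ℚ.* ε) (ℚₚ.*-zeroʳ ½) (ℚₚ.*-monoʳ-<-pos ½ 0<ε)

    halves : ∀ ε → ½ ℚ.* ε ℚ.+ ½ ℚ.* ε ≡ ε
    halves ε = trans (sym (ℚₚ.*-distribʳ-+ ε ½ ½)) (ℚₚ.*-identityˡ ε)

    +-cauchy : ∀ a b → Cauchy a → Cauchy b → Cauchy (λ k → a k ℚ.+ b k)
    +-cauchy a b ca cb ε 0<ε
      with ca (½ ℚ.* ε) (half-pos 0<ε) | cb (½ ℚ.* ε) (half-pos 0<ε)
    ... | M , p | N , q = M ℕ.⊔ N , λ k l k≥ l≥ → begin-strict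
        ℚ.∣ (a k ℚ.+ b k) ℚ.- (a l ℚ.+ b l) ∣
          ≡⟨ cong ℚ.∣_∣ (rearrange (a k) (b k) (a l) (b l)) ⟩
        ℚ.∣ (a k ℚ.- a l) ℚ.+ (b k ℚ.- b l) ∣
          ≤⟨ ℚₚ.∣p+q∣≤∣p∣+∣q∣ (a k ℚ.- a l) (b k ℚ.- b l) ⟩
        ℚ.∣ a k ℚ.- a l ∣ ℚ.+ ℚ.∣ b k ℚ.- b l ∣
          <⟨ ℚₚ.+-mono-< (p k l (ℕₚ.m⊔n≤o⇒m≤o M N k≥) (ℕₚ.m⊔n≤o⇒m≤o M N l≥))
                         (q k l (ℕₚ.m⊔n≤o⇒n≤o M N k≥) (ℕₚ.m⊔n≤o⇒n≤o M N l≥)) ⟩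
        ½ ℚ.* ε ℚ.+ ½ ℚ.* ε
          ≡⟨ halves ε ⟩
        ε ∎
      where
      open ℚₚ.≤-Reasoning
      rearrange : ∀ w x y z → (w ℚ.+ x) ℚ.- (y ℚ.+ z) ≡ (w ℚ.- y) ℚ.+ (x ℚ.- z)
      rearrange w x y z = trans
        (cong ((w ℚ.+ x) ℚ.+_) (ℚₚ.neg-distrib-+ y z))
        (CommutativeSemigroupProperties.interchange ℚ-+-commutativeSemigroup
          w x (ℚ.- y) (ℚ.- z))

    neg-cauchy : ∀ a → Cauchy a → Cauchy (λ k → ℚ.- a k)
    neg-cauchy a ca ε 0<ε with ca ε 0<ε
    ... | N , p = N , λ k l k≥ l≥ → subst (ℚ._< ε)
        (trans (sym (ℚₚ.∣-p∣≡∣p∣ (a k ℚ.- a l)))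
               (cong ℚ.∣_∣ (ℚₚ.neg-distrib-+ (a k) (ℚ.- a l))))
        (p k l k≥ l≥)

    ∣∣-shift : ∀ p q → ℚ.∣ p ∣ ℚ.≤ ℚ.∣ p ℚ.- q ∣ ℚ.+ ℚ.∣ q ∣
    ∣∣-shift p q = subst (λ r → ℚ.∣ r ∣ ℚ.≤ ℚ.∣ p ℚ.- q ∣ ℚ.+ ℚ.∣ q ∣)
      (ℚ-+.//-rightDividesˡ q p) (ℚₚ.∣p+q∣≤∣p∣+∣q∣ (p ℚ.- q) q)

    ∣-∣-swap : ∀ p q → ℚ.∣ p ℚ.- q ∣ ≡ ℚ.∣ q ℚ.- p ∣
    ∣-∣-swap p q = trans (sym (ℚₚ.∣-p∣≡∣p∣ (p ℚ.- q))) (cong ℚ.∣_∣ (ℚ-+.⁻¹-anti-homo-// p q))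

    ∣∣-diff : ∀ p q → ℚ.∣ p ∣ ℚ.- ℚ.∣ q ∣ ℚ.≤ ℚ.∣ p ℚ.- q ∣
    ∣∣-diff p q = subst (ℚ.∣ p ∣ ℚ.- ℚ.∣ q ∣ ℚ.≤_)
      (ℚ-+.//-rightDividesʳ ℚ.∣ q ∣ ℚ.∣ p ℚ.- q ∣)
      (ℚₚ.+-monoˡ-≤ (ℚ.- ℚ.∣ q ∣) (∣∣-shift p q))

    abs-cauchy : ∀ a → Cauchy a → Cauchy (λ k → ℚ.∣ a k ∣)
    abs-cauchy a ca ε 0<ε with ca ε 0<ε
    ... | N , p = N , λ k l k≥ l≥ →
        ℚₚ.≤-<-trans (reverse (a k) (a l)) (p k l k≥ l≥)
      where
      reverse : ∀ p q → ℚ.∣ ℚ.∣ p ∣ ℚ.- ℚ.∣ q ∣ ∣ ℚ.≤ ℚ.∣ p ℚ.- q ∣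
      reverse p q with ℚₚ.∣p∣≡p∨∣p∣≡-p (ℚ.∣ p ∣ ℚ.- ℚ.∣ q ∣)
      ... | inj₁ eq = subst (ℚ._≤ ℚ.∣ p ℚ.- q ∣) (sym eq) (∣∣-diff p q)
      ... | inj₂ eq = subst₂ ℚ._≤_ (sym (trans eq (ℚ-+.⁻¹-anti-homo-// ℚ.∣ p ∣ ℚ.∣ q ∣)))
                        (∣-∣-swap q p) (∣∣-diff q p)

    bounded : ∀ a → Cauchy a →
      ∃[ B ] (0ℚ ℚ.< B × (∃[ N ] (∀ k → N ℕ.≤ k → ℚ.∣ a k ∣ ℚ.≤ B)))
    bounded a ca with ca 1ℚ (ℚₚ.positive⁻¹ 1ℚ)
    ... | N , p =
        1ℚ ℚ.+ ℚ.∣ a N ∣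
      , ℚₚ.<-≤-trans (ℚₚ.positive⁻¹ 1ℚ)
          (subst (ℚ._≤ 1ℚ ℚ.+ ℚ.∣ a N ∣) (ℚₚ.+-identityʳ 1ℚ)
            (ℚₚ.+-monoʳ-≤ 1ℚ (ℚₚ.0≤∣p∣ (a N))))
      , N
      , λ k k≥ → ℚₚ.≤-trans (∣∣-shift (a k) (a N))
          (ℚₚ.+-monoˡ-≤ ℚ.∣ a N ∣ (ℚₚ.<⇒≤ (p k N k≥ ℕₚ.≤-refl)))

    *-cauchy : ∀ a b → Cauchy a → Cauchy b → Cauchy (λ k → a k ℚ.* b k)
    *-cauchy a b ca cb ε 0<ε with bounded a ca | bounded b cb
    ... | B , 0<B , K , bndB | C , 0<C , L , bndC = go
      where
      0<B+C : 0ℚ ℚ.< B ℚ.+ C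
      0<B+C = ℚₚ.+-mono-< 0<B 0<C
      instance
        posB : ℚ.Positive B
        posB = ℚ.positive 0<B
        nnC : ℚ.NonNegative C
        nnC = ℚ.nonNegative (ℚₚ.<⇒≤ 0<C)
        posBC : ℚ.Positive (B ℚ.+ C)
        posBC = ℚ.positive 0<B+C
        nzBC : ℚ.NonZero (B ℚ.+ C)
        nzBC = ℚₚ.pos⇒nonZero (B ℚ.+ C)
        posInv : ℚ.Positive (ℚ.1/ (B ℚ.+ C))
        posInv = ℚₚ.1/pos⇒pos (B ℚ.+ C)
      δ : ℚ
      δ = ℚ.1/ (B ℚ.+ C) ℚ.* ε
      0<δ : 0ℚ ℚ.< δ
      0<δ = subst (ℚ._< δ) (ℚₚ.*-zeroʳ (ℚ.1/ (B ℚ.+ C)))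
              (ℚₚ.*-monoʳ-<-pos (ℚ.1/ (B ℚ.+ C)) 0<ε)
      total : B ℚ.* δ ℚ.+ δ ℚ.* C ≡ ε
      total =
        trans (cong (B ℚ.* δ ℚ.+_) (ℚₚ.*-comm δ C))
        (trans (sym (ℚₚ.*-distribʳ-+ δ B C))
        (trans (sym (ℚₚ.*-assoc (B ℚ.+ C) (ℚ.1/ (B ℚ.+ C)) ε))
        (trans (cong (ℚ._* ε) (ℚₚ.*-inverseʳ (B ℚ.+ C)))
               (ℚₚ.*-identityˡ ε))))
      rearrange : ∀ w x y z →
        w ℚ.* x ℚ.- y ℚ.* z ≡ w ℚ.* (x ℚ.- z) ℚ.+ (w ℚ.- y) ℚ.* z
      rearrange w x y z = sym (trans
        (cong₂ ℚ._+_
          (trans (ℚₚ.*-distribˡ-+ w x (ℚ.- z))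
                 (cong (w ℚ.* x ℚ.+_) (sym (ℚₚ.neg-distribʳ-* w z))))
          (trans (ℚₚ.*-distribʳ-+ z w (ℚ.- y))
                 (cong (w ℚ.* z ℚ.+_) (sym (ℚₚ.neg-distribˡ-* y z)))))
        (trans (sym (ℚₚ.+-assoc (w ℚ.* x ℚ.- w ℚ.* z) (w ℚ.* z) (ℚ.- (y ℚ.* z))))
               (cong (ℚ._- y ℚ.* z)
                 (ℚ-+.//-rightDividesˡ (w ℚ.* z) (w ℚ.* x)))))
      open ℚₚ.≤-Reasoning
      go : ∃[ N ] (∀ k l → N ℕ.≤ k → N ℕ.≤ l →
             ℚ.∣ a k ℚ.* b k ℚ.- a l ℚ.* b l ∣ ℚ.< ε)
      go with ca δ 0<δ | cb δ 0<δ
      ... | P , p | Q , q = (K ℕ.⊔ L) ℕ.⊔ (P ℕ.⊔ Q) , λ k l k≥ l≥ →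
        let k≥KL = ℕₚ.m⊔n≤o⇒m≤o (K ℕ.⊔ L) (P ℕ.⊔ Q) k≥
            l≥KL = ℕₚ.m⊔n≤o⇒m≤o (K ℕ.⊔ L) (P ℕ.⊔ Q) l≥
            k≥PQ = ℕₚ.m⊔n≤o⇒n≤o (K ℕ.⊔ L) (P ℕ.⊔ Q) k≥
            l≥PQ = ℕₚ.m⊔n≤o⇒n≤o (K ℕ.⊔ L) (P ℕ.⊔ Q) l≥
            da = a k ℚ.- a l
            db = b k ℚ.- b l
            da< = p k l (ℕₚ.m⊔n≤o⇒m≤o P Q k≥PQ) (ℕₚ.m⊔n≤o⇒m≤o P Q l≥PQ)
            db< = q k l (ℕₚ.m⊔n≤o⇒n≤o P Q k≥PQ) (ℕₚ.m⊔n≤o⇒n≤o P Q l≥PQ)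
            ∣a∣≤B = bndB k (ℕₚ.m⊔n≤o⇒m≤o K L k≥KL)
            ∣b∣≤C = bndC l (ℕₚ.m⊔n≤o⇒n≤o K L l≥KL)
            instance
              nndb : ℚ.NonNegative ℚ.∣ db ∣
              nndb = ℚₚ.∣-∣-nonNeg db
              nnda : ℚ.NonNegative ℚ.∣ da ∣
              nnda = ℚₚ.∣-∣-nonNeg da
        in begin-strict
          ℚ.∣ a k ℚ.* b k ℚ.- a l ℚ.* b l ∣
            ≡⟨ cong ℚ.∣_∣ (rearrange (a k) (b k) (a l) (b l)) ⟩
          ℚ.∣ a k ℚ.* db ℚ.+ da ℚ.* b l ∣
            ≤⟨ ℚₚ.∣p+q∣≤∣p∣+∣q∣ (a k ℚ.* db) (da ℚ.* b l) ⟩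
          ℚ.∣ a k ℚ.* db ∣ ℚ.+ ℚ.∣ da ℚ.* b l ∣
            ≡⟨ cong₂ ℚ._+_ (ℚₚ.∣p*q∣≡∣p∣*∣q∣ (a k) db) (ℚₚ.∣p*q∣≡∣p∣*∣q∣ da (b l)) ⟩
          ℚ.∣ a k ∣ ℚ.* ℚ.∣ db ∣ ℚ.+ ℚ.∣ da ∣ ℚ.* ℚ.∣ b l ∣
            ≤⟨ ℚₚ.+-mono-≤ (ℚₚ.*-monoʳ-≤-nonNeg ℚ.∣ db ∣ ∣a∣≤B)
                           (ℚₚ.*-monoˡ-≤-nonNeg ℚ.∣ da ∣ ∣b∣≤C) ⟩
          B ℚ.* ℚ.∣ db ∣ ℚ.+ ℚ.∣ da ∣ ℚ.* C
            <⟨ ℚₚ.+-mono-<-≤ (ℚₚ.*-monoʳ-<-pos B db<)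
                             (ℚₚ.*-monoʳ-≤-nonNeg C (ℚₚ.<⇒≤ da<)) ⟩
          B ℚ.* δ ℚ.+ δ ℚ.* C
            ≡⟨ total ⟩
          ε ∎

    const-cauchy : ∀ q → Cauchy (λ _ → q)
    const-cauchy q ε 0<ε = 0 , λ _ _ _ _ →
      subst (ℚ._< ε) (sym (cong ℚ.∣_∣ (ℚₚ.+-inverseʳ q))) 0<ε

infixl 6 _+_ _-_
infixl 7 _*_
infix  8 -_

fromℚ : ℚ → ℝ
fromℚ q = mkℝ (λ _ → q) (const-cauchy q)

fromℤ : ℤ → ℝ
fromℤ i = fromℚ (i ℚ./ 1)

0ℝ 1ℝ : ℝ
0ℝ = fromℚ 0ℚ
1ℝ = fromℚ 1ℚ

_+_ : ℝ → ℝ → ℝ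
x + y = mkℝ (λ k → seq x k ℚ.+ seq y k) (+-cauchy (seq x) (seq y) (cauchy x) (cauchy y))

_*_ : ℝ → ℝ → ℝ
x * y = mkℝ (λ k → seq x k ℚ.* seq y k) (*-cauchy (seq x) (seq y) (cauchy x) (cauchy y))

-_ : ℝ → ℝ
- x = mkℝ (λ k → ℚ.- seq x k) (neg-cauchy (seq x) (cauchy x))

_-_ : ℝ → ℝ → ℝ
x - y = x + (- y)

∣_∣ : ℝ → ℝ
∣ x ∣ = mkℝ (λ k → ℚ.∣ seq x k ∣) (abs-cauchy (seq x) (cauchy x))

+-rawMonoid *-rawMonoid : RawMonoid 0ℓ 0ℓ
+-rawMonoid = record { Carrier = ℝ ; _≈_ = _≃_ ; _∙_ = _+_ ; ε = 0ℝ }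
*-rawMonoid = record { Carrier = ℝ ; _≈_ = _≃_ ; _∙_ = _*_ ; ε = 1ℝ }

∑ ∏ : ∀ {n} → Vector ℝ n → ℝ
∑ = RawMonoidDefs.sum +-rawMonoid
∏ = RawMonoidDefs.sum *-rawMonoid

Matrix : ℕ → Set
Matrix n = Fin n → Fin n → ℝ

sign : ℕ → ℝ
sign zero    = 1ℝ
sign (suc k) = - sign k

-- Laplace expansion along the first row.
det : ∀ {n} → Matrix n → ℝ
det {zero}  A = 1ℝ
det {suc n} A = ∑ λ j →
  sign (toℕ j) * (A zero j * det (λ i k → A (suc i) (punchIn j k)))

scalar : ∀ {n} → ℝ → Matrix n
scalar x i j with i ≟ j
... | yes _ = x
... | no  _ = 0ℝ

charPoly : ∀ {n} → Matrix n → ℝ → ℝ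
charPoly A x = det (λ i j → scalar x i j - A i j)

-- ev lists the eigenvalues of A, repeated according to algebraic
-- multiplicity.  Agreement at every real x is equality of polynomials.
Eigenvalues : ∀ {n} → Matrix n → Vector ℝ n → Set
Eigenvalues A ev = ∀ x → charPoly A x ≃ ∏ (λ i → x - ev i)

record Hypergraph (N : ℕ) : Set₁ where
  field
    Edge  : Pred (Subset N) 0ℓ
    edge? : Decidable Edge

open Hypergraph public

allSubsets : ∀ N → List (Subset N)
allSubsets zero    = [] ∷ []
allSubsets (suc N) =
  map (inside ∷_) (allSubsets N) ++ map (outside ∷_) (allSubsets N)

codegree : ∀ {N} → Hypergraph N → Fin N → Fin N → ℕ
codegree {N} H i j = length
  (filter (λ s → edge? H s ×-dec (i ∈? s) ×-dec (j ∈? s)) (allSubsets N))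

seidelEntry : ∀ {N} → Hypergraph N → Fin N → Fin N → ℤ
seidelEntry H i j with i ≟ j
... | yes _ = + 0
... | no  _ = + 1 ℤ.- + 2 ℤ.* + codegree H i j

seidel : ∀ {N} → Hypergraph N → Matrix N
seidel H i j = fromℤ (seidelEntry H i j)

-- "E is the Seidel energy of H": a relation, single-valued up to _≃_, because
-- no function returning the real roots of a polynomial is available.
IsSeidelEnergy : ∀ {N} → Hypergraph N → ℝ → Set
IsSeidelEnergy {N} H E =
  ∃[ ev ] (Eigenvalues {N} (seidel H) ev × E ≃ ∑ (λ i → ∣ ev i ∣))

-- V₁ consists of the vertices i ↑ˡ n and V₂ of the vertices m ↑ʳ j.
completeBipartite³ : ∀ m n → Hypergraph (m ℕ.+ n)
completeBipartite³ m n = record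
  { Edge  = λ s → Subset.∣ s ∣ ≡ 3
                × (∃[ i ] (i ↑ˡ n) ∈ s)
                × (∃[ j ] (m ↑ʳ j) ∈ s)
  ; edge? = λ s → (Subset.∣ s ∣ ℕ.≟ 3)
                ×-dec any? (λ i → (i ↑ˡ n) ∈? s)
                ×-dec any? (λ j → (m ↑ʳ j) ∈? s)
  }

deleteEdge : ∀ {N} → Hypergraph N → Subset N → Hypergraph N
deleteEdge H e = record
  { Edge  = λ s → Edge H s × s ≢ e
  ; edge? = λ s → edge? H s ×-dec ¬? (Vecₚ.≡-dec Boolₚ._≟_ s e)
  }

{-# OPTIONS --safe #-}

-- Both Seidel matrices are a diagonal matrix plus one of rank at most three, so
-- with y = -x their characteristic polynomials are, up to sign, explicit products
-- of linear factors y + c, c > 0, and of a quadratic q(y) for the complete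
-- hypergraph, a quartic h(y) after the deletion.  Each of q and h has exactly one
-- positive root, ρ and ρ′.  The traces vanish, so the energies are 2ρ and 2ρ′ as
-- soon as -ρ′ is a simple eigenvalue and the only negative one; this follows from
-- the trace of the square, which is less than 2ρ′².  Dividing h by q leaves
-- quotient and remainder with positive coefficients, hence h > 0 on [ρ, ∞) and
-- ρ′ < ρ.
--
-- The argument runs on the rational approximations of the eigenvalues: their
-- power sums converge because a polynomial is determined by its values at the
-- natural numbers, each of them nearly annihilates the characteristic polynomial,
-- and a rational R < ρ with h > 1/2 on [R - δ, ∞) separates the two energies.

module Submission where

open import Data.Bool as Bool using (Bool; true; false; if_then_else_; _∧_)
open import Data.Fin using (Fin; zero; suc; toℕ; fromℕ; fromℕ<; inject₁; punchIn; splitAt; _↑ˡ_; _↑ʳ_; _≟_)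
open import Data.Fin.Properties
  using (any?; toℕ-inject₁; toℕ-fromℕ<; toℕ-injective; suc-injective; toℕ<n; fromℕ≢inject₁;
         splitAt⁻¹-↑ˡ; splitAt⁻¹-↑ʳ; splitAt-↑ˡ; splitAt-↑ʳ)
open import Data.Nat as ℕ using (ℕ; zero; suc; s≤s; z≤n)
import Data.Nat.Properties as ℕₚ
open import Data.Product using (∃-syntax; _×_; _,_; proj₂; map₂)
open import Data.Sum as Sum using (_⊎_; inj₁; inj₂; [_,_]′)
open import Data.Vec as Vec using (Vec; []; _∷_; lookup)
open import Data.Vec.Properties using (lookup⇒[]=; []=⇒lookup; lookup-replicate)
open import Function using (_∘_; const; flip)
open import Relation.Binary.PropositionalEquality hiding (J)
open import Relation.Nullary using (yes; no; ¬_; ¬?; contradiction)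

-- Off the diagonal both Seidel matrices are negative, so the eigenvalue of largest modulus is the
-- negative one. Passing to `y` = -x turns it into a positive root and makes every explicit linear
-- factor positive for `y` ≥ 0; determinants are therefore evaluated at rational `y` ≥ 0 only, where
-- the diagonal part is invertible. The quartic is the characteristic polynomial of the quotient of
-- the negated Seidel matrix by the four cells into which the edge cuts the two classes.
--
-- The obstacle is that an eigenvalue is seen only through rational approximations, and the index
-- carrying the negative one may change with the stage. The two energies are therefore bounded from
-- one side each. For the complete hypergraph the sign of the characteristic polynomial at a
-- rational R < ρ forces, at every late stage, some approximation below -R; this bounds the energy
-- from below. After the deletion all nonpositive approximations are located and two of them at once
-- are excluded; this bounds the energy from above. The vanishing traces turn both into bounds by
-- twice a rational number.

module Codegrees where

  open import Defs using (Hypergraph; Edge; edge?; allSubsets; codegree; completeBipartite³; deleteEdge)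
  import Data.Bool.Properties as Boolₚ
  open import Data.Fin.Subset using (Subset; inside; outside; _∈_; _∉_; _⊆_; ∣_∣; ⊤; ⊥; ⁅_⁆; _∪_)
  open import Data.Fin.Subset.Properties
    using (_∈?_; drop-∷-⊆; out⊆; in⊆in; ⊆⊤; ∈⊤; ∉⊥; ∪-identityˡ; ∪-identityʳ; ∣⁅x⁆∣≡1; ∣⊤∣≡n; ∣⊥∣≡0;
           x∈⁅x⁆; x∈⁅y⁆⇒x≡y; x∈p∪q⁺; x∈p∪q⁻; _⊆?_; p⊆q⇒∣p∣≤∣q∣; drop-there)
  open import Data.List using ([]; _∷_; map; filter; length)
  open import Data.List.Properties using (filter-++; filter-≐; filter-none; length-++; filter-accept)
  open import Data.List.Relation.Unary.All using (universal)
  open import Data.Nat using (_+_; _*_; _≤_; _<_) renaming (_≟_ to _≟ℕ_)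
  open import Data.Nat.Properties using (+-suc; +-identityʳ; +-comm; +-cancelˡ-≡; <⇒≱; 1+n≢0; n<1+n)
  open import Data.Vec using (here; there)
  import Data.Vec.Properties as Vecₚ
  open import Level using (0ℓ)
  open import Relation.Nullary.Decidable using (_×-dec_)
  open import Relation.Unary using (Pred; Decidable)

  -- Counting subsets: the co-degrees before and after the deletion.

  # : ∀ {N} {P : Pred (Subset N) 0ℓ} → Decidable P → ℕ
  # {N} P? = length (filter P? (allSubsets N))

  filter-map-length : ∀ {A B : Set} {P : Pred B 0ℓ} (P? : Decidable P) (f : A → B) xs →
    length (filter P? (map f xs)) ≡ length (filter (P? ∘ f) xs)
  filter-map-length P? f []       = refl
  filter-map-length P? f (x ∷ xs) with P? (f x)
  ... | yes _ = cong suc (filter-map-length P? f xs)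
  ... | no  _ = filter-map-length P? f xs

  filter-split-length : ∀ {A : Set} {P Q : Pred A 0ℓ} (P? : Decidable P) (Q? : Decidable Q) xs →
    length (filter P? xs) ≡
    length (filter (λ x → P? x ×-dec Q? x) xs) + length (filter (λ x → P? x ×-dec ¬? (Q? x)) xs)
  filter-split-length P? Q? []       = refl
  filter-split-length P? Q? (x ∷ xs) with P? x | Q? x
  ... | yes _ | yes _ = cong suc (filter-split-length P? Q? xs)
  ... | yes _ | no  _ = trans (cong suc (filter-split-length P? Q? xs)) (sym (+-suc _ _))
  ... | no  _ | yes _ = filter-split-length P? Q? xs
  ... | no  _ | no  _ = filter-split-length P? Q? xs

  module _ {N : ℕ} {P : Pred (Subset (suc N)) 0ℓ} (P? : Decidable P) where
    #-suc : # P? ≡ # (P? ∘ (inside ∷_)) + # (P? ∘ (outside ∷_))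
    #-suc = trans (cong length (filter-++ P? (map (inside ∷_) (allSubsets N)) (map (outside ∷_) (allSubsets N))))
      (trans (length-++ (filter P? (map (inside ∷_) (allSubsets N))))
        (cong₂ _+_ (filter-map-length P? (inside ∷_) (allSubsets N))
                   (filter-map-length P? (outside ∷_) (allSubsets N))))

  module _ {N : ℕ} {P Q : Pred (Subset N) 0ℓ} (P? : Decidable P) (Q? : Decidable Q) where
    #-cong : (∀ {s} → P s → Q s) → (∀ {s} → Q s → P s) → # P? ≡ # Q?
    #-cong P⇒Q Q⇒P = cong length (filter-≐ P? Q? (P⇒Q , Q⇒P) (allSubsets N))

    #-split : # P? ≡ # (λ s → P? s ×-dec Q? s) + # (λ s → P? s ×-dec ¬? (Q? s))
    #-split = filter-split-length P? Q? (allSubsets N)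

  #-none : ∀ {N} {P : Pred (Subset N) 0ℓ} (P? : Decidable P) → (∀ s → ¬ P s) → # P? ≡ 0
  #-none {N} P? ¬P = cong length (filter-none P? (universal ¬P (allSubsets N)))

  #-unique : ∀ {N} {P : Pred (Subset N) 0ℓ} (P? : Decidable P) (e : Subset N) →
    (∀ s → P s → s ≡ e) → P e → # P? ≡ 1
  #-unique P? [] P⇒≡ Pe = cong length (filter-accept P? {xs = []} Pe)
  #-unique P? (inside ∷ e) P⇒≡ Pe = trans (#-suc P?) (cong₂ _+_
    (#-unique (P? ∘ (inside ∷_)) e (λ s Ps → cong Vec.tail (P⇒≡ (inside ∷ s) Ps)) Pe)
    (#-none (P? ∘ (outside ∷_)) λ s Ps → contradiction (cong Vec.head (P⇒≡ (outside ∷ s) Ps)) λ ()))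
  #-unique P? (outside ∷ e) P⇒≡ Pe = trans (#-suc P?) (cong₂ _+_
    (#-none (P? ∘ (inside ∷_)) λ s Ps → contradiction (cong Vec.head (P⇒≡ (inside ∷ s) Ps)) λ ())
    (#-unique (P? ∘ (outside ∷_)) e (λ s Ps → cong Vec.tail (P⇒≡ (outside ∷ s) Ps)) Pe))

  -- Every co-degree count reduces to this predicate, with `r` a pair of vertices and `a` the vertex
  -- set or one class. A set of size ∣ r ∣ + 1 in between adds one element of `a` outside `r`, so
  -- the number of such sets plus ∣ r ∣ is ∣ a ∣; the additive form avoids truncated subtraction.
  Between : ∀ {N} → Subset N → Subset N → ℕ → Pred (Subset N) 0ℓ
  Between r a k s = ∣ s ∣ ≡ k × r ⊆ s × s ⊆ a

  between? : ∀ {N} (r a : Subset N) k → Decidable (Between r a k)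
  between? r a k s = (∣ s ∣ ≟ℕ k) ×-dec (r ⊆? s) ×-dec (s ⊆? a)

  inside∷⊈outside∷ : ∀ {N} {s t : Subset N} → ¬ (inside ∷ s ⊆ outside ∷ t)
  inside∷⊈outside∷ s⊆t = contradiction (s⊆t here) λ ()

  module _ {N : ℕ} (r a : Subset N) where
    #-between-required : ∀ k → # (between? (inside ∷ r) (inside ∷ a) (suc k)) ≡ # (between? r a k)
    #-between-required k = trans (#-suc (between? (inside ∷ r) (inside ∷ a) (suc k))) (trans (cong₂ _+_
      (#-cong (between? (inside ∷ r) (inside ∷ a) (suc k) ∘ (inside ∷_)) (between? r a k)
        (λ (c , r⊆s , s⊆a) → ℕₚ.suc-injective c , drop-∷-⊆ r⊆s , drop-∷-⊆ s⊆a)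
        (λ (c , r⊆s , s⊆a) → cong suc c , in⊆in r⊆s , in⊆in s⊆a))
      (#-none (between? (inside ∷ r) (inside ∷ a) (suc k) ∘ (outside ∷_))
        λ s (_ , r⊆s , _) → inside∷⊈outside∷ r⊆s))
      (+-identityʳ _))

    #-between-forbidden : ∀ k → # (between? (outside ∷ r) (outside ∷ a) k) ≡ # (between? r a k)
    #-between-forbidden k = trans (#-suc (between? (outside ∷ r) (outside ∷ a) k)) (cong₂ _+_
      (#-none (between? (outside ∷ r) (outside ∷ a) k ∘ (inside ∷_))
        λ s (_ , _ , s⊆a) → inside∷⊈outside∷ s⊆a)
      (#-cong (between? (outside ∷ r) (outside ∷ a) k ∘ (outside ∷_)) (between? r a k)
        (λ (c , r⊆s , s⊆a) → c , drop-∷-⊆ r⊆s , drop-∷-⊆ s⊆a)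
        (λ (c , r⊆s , s⊆a) → c , out⊆ r⊆s , out⊆ s⊆a)))

    private
      #-without : ∀ k → # (between? (outside ∷ r) (inside ∷ a) k ∘ (outside ∷_)) ≡ # (between? r a k)
      #-without k = #-cong (between? (outside ∷ r) (inside ∷ a) k ∘ (outside ∷_)) (between? r a k)
        (λ (c , r⊆s , s⊆a) → c , drop-∷-⊆ r⊆s , drop-∷-⊆ s⊆a)
        (λ (c , r⊆s , s⊆a) → c , out⊆ r⊆s , out⊆ s⊆a)

    #-between-free-zero : # (between? (outside ∷ r) (inside ∷ a) 0) ≡ # (between? r a 0)
    #-between-free-zero = trans (#-suc (between? (outside ∷ r) (inside ∷ a) 0)) (cong₂ _+_
      (#-none (between? (outside ∷ r) (inside ∷ a) 0 ∘ (inside ∷_)) λ s (c , _) → 1+n≢0 c)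
      (#-without 0))

    #-between-free : ∀ k → # (between? (outside ∷ r) (inside ∷ a) (suc k)) ≡
      # (between? r a k) + # (between? r a (suc k))
    #-between-free k = trans (#-suc (between? (outside ∷ r) (inside ∷ a) (suc k))) (cong₂ _+_
      (#-cong (between? (outside ∷ r) (inside ∷ a) (suc k) ∘ (inside ∷_)) (between? r a k)
        (λ (c , r⊆s , s⊆a) → ℕₚ.suc-injective c , drop-∷-⊆ r⊆s , drop-∷-⊆ s⊆a)
        (λ (c , r⊆s , s⊆a) → cong suc c , out⊆ r⊆s , in⊆in s⊆a))
      (#-without (suc k)))

  #-between-small : ∀ {N} (r a : Subset N) k → k < ∣ r ∣ → # (between? r a k) ≡ 0
  #-between-small r a k k<r = #-none (between? r a k) λ s (c , r⊆s , _) →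
    <⇒≱ k<r (subst (∣ r ∣ ≤_) c (p⊆q⇒∣p∣≤∣q∣ r⊆s))

  #-between-tight : ∀ {N} (r a : Subset N) → r ⊆ a → # (between? r a ∣ r ∣) ≡ 1
  #-between-tight [] [] r⊆a = refl
  #-between-tight (inside ∷ r) (inside ∷ a) r⊆a =
    trans (#-between-required r a ∣ r ∣) (#-between-tight r a (drop-∷-⊆ r⊆a))
  #-between-tight (inside ∷ r) (outside ∷ a) r⊆a = contradiction (r⊆a here) λ ()
  #-between-tight (outside ∷ r) (outside ∷ a) r⊆a =
    trans (#-between-forbidden r a ∣ r ∣) (#-between-tight r a (drop-∷-⊆ r⊆a))
  #-between-tight (outside ∷ r) (inside ∷ a) r⊆a = go ∣ r ∣ refl
    where
    -- The size is generalised so that it can be split: for 0 the free element cannot be taken, and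
    -- for a successor taking it leaves too few places for `r`.
    go : ∀ k → k ≡ ∣ r ∣ → # (between? (outside ∷ r) (inside ∷ a) k) ≡ 1
    go zero    k≡ = trans (#-between-free-zero r a)
      (trans (cong (λ j → # (between? r a j)) k≡) (#-between-tight r a (drop-∷-⊆ r⊆a)))
    go (suc k) k≡ = trans (#-between-free r a k) (cong₂ _+_
      (#-between-small r a k (subst (k <_) k≡ (n<1+n k)))
      (trans (cong (λ j → # (between? r a j)) k≡) (#-between-tight r a (drop-∷-⊆ r⊆a))))

  #-between-next : ∀ {N} (r a : Subset N) → r ⊆ a → ∣ r ∣ + # (between? r a (suc ∣ r ∣)) ≡ ∣ a ∣
  #-between-next [] [] r⊆a = refl
  #-between-next (inside ∷ r) (inside ∷ a) r⊆a =
    cong suc (trans (cong (∣ r ∣ +_) (#-between-required r a (suc ∣ r ∣))) (#-between-next r a (drop-∷-⊆ r⊆a)))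
  #-between-next (inside ∷ r) (outside ∷ a) r⊆a = contradiction (r⊆a here) λ ()
  #-between-next (outside ∷ r) (outside ∷ a) r⊆a =
    trans (cong (∣ r ∣ +_) (#-between-forbidden r a (suc ∣ r ∣))) (#-between-next r a (drop-∷-⊆ r⊆a))
  #-between-next (outside ∷ r) (inside ∷ a) r⊆a = trans
    (cong (∣ r ∣ +_) (trans (#-between-free r a ∣ r ∣)
      (cong (_+ # (between? r a (suc ∣ r ∣))) (#-between-tight r a (drop-∷-⊆ r⊆a)))))
    (trans (+-suc ∣ r ∣ _) (cong suc (#-between-next r a (drop-∷-⊆ r⊆a))))

  pair-size : ∀ {N} {i j : Fin N} → i ≢ j → ∣ ⁅ i ⁆ ∪ ⁅ j ⁆ ∣ ≡ 2
  pair-size {i = zero}  {zero}  i≢j = contradiction refl i≢j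
  pair-size {i = zero}  {suc j} i≢j = cong suc (trans (cong ∣_∣ (∪-identityˡ ⁅ j ⁆)) (∣⁅x⁆∣≡1 j))
  pair-size {i = suc i} {zero}  i≢j = cong suc (trans (cong ∣_∣ (∪-identityʳ ⁅ i ⁆)) (∣⁅x⁆∣≡1 i))
  pair-size {i = suc i} {suc j} i≢j = pair-size {i = i} {j} (i≢j ∘ cong suc)

  #-triples : ∀ {N} {i j : Fin N} {P : Pred (Subset N) 0ℓ} (P? : Decidable P) (a : Subset N) →
    i ≢ j → i ∈ a → j ∈ a →
    (∀ {s} → P s → ∣ s ∣ ≡ 3 × i ∈ s × j ∈ s × s ⊆ a) →
    (∀ {s} → ∣ s ∣ ≡ 3 → i ∈ s → j ∈ s → s ⊆ a → P s) → 2 + # P? ≡ ∣ a ∣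
  #-triples {i = i} {j} P? a i≢j i∈a j∈a elim intro = begin
    2 + # P?
      ≡⟨ cong₂ _+_ (sym size) (#-cong P? (between? r a (suc ∣ r ∣)) to from) ⟩
    ∣ r ∣ + # (between? r a (suc ∣ r ∣))
      ≡⟨ #-between-next r a (pair⊆ i∈a j∈a) ⟩
    ∣ a ∣ ∎
    where
    open ≡-Reasoning
    r = ⁅ i ⁆ ∪ ⁅ j ⁆
    size : ∣ r ∣ ≡ 2
    size = pair-size i≢j
    pair⊆ : ∀ {t} → i ∈ t → j ∈ t → r ⊆ t
    pair⊆ {t} i∈t j∈t x∈r = [ (λ x∈i → subst (_∈ t) (sym (x∈⁅y⁆⇒x≡y i x∈i)) i∈t)
                            , (λ x∈j → subst (_∈ t) (sym (x∈⁅y⁆⇒x≡y j x∈j)) j∈t) ]′ (x∈p∪q⁻ ⁅ i ⁆ ⁅ j ⁆ x∈r)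
    to : ∀ {s} → _ → Between r a (suc ∣ r ∣) s
    to Ps with elim Ps
    ... | c , i∈s , j∈s , s⊆a = trans c (cong suc (sym size)) , pair⊆ i∈s j∈s , s⊆a
    from : ∀ {s} → Between r a (suc ∣ r ∣) s → _
    from (c , r⊆s , s⊆a) = intro (trans c (cong suc size))
      (r⊆s (x∈p∪q⁺ (inj₁ (x∈⁅x⁆ i)))) (r⊆s (x∈p∪q⁺ (inj₂ (x∈⁅x⁆ j)))) s⊆a

  V₁ V₂ : ∀ m n → Subset (m + n)
  V₁ zero    n = ⊥
  V₁ (suc m) n = inside ∷ V₁ m n
  V₂ zero    n = ⊤
  V₂ (suc m) n = outside ∷ V₂ m n

  ∣V₁∣ : ∀ m n → ∣ V₁ m n ∣ ≡ m
  ∣V₁∣ zero    n = ∣⊥∣≡0 n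
  ∣V₁∣ (suc m) n = cong suc (∣V₁∣ m n)

  ∣V₂∣ : ∀ m n → ∣ V₂ m n ∣ ≡ n
  ∣V₂∣ zero    n = ∣⊤∣≡n n
  ∣V₂∣ (suc m) n = ∣V₂∣ m n

  ↑ˡ∈V₁ : ∀ m n (i : Fin m) → i ↑ˡ n ∈ V₁ m n
  ↑ˡ∈V₁ (suc m) n zero    = here
  ↑ˡ∈V₁ (suc m) n (suc i) = there (↑ˡ∈V₁ m n i)

  ↑ʳ∈V₂ : ∀ m n (j : Fin n) → m ↑ʳ j ∈ V₂ m n
  ↑ʳ∈V₂ zero    n j = ∈⊤
  ↑ʳ∈V₂ (suc m) n j = there (↑ʳ∈V₂ m n j)

  ↑ʳ∉V₁ : ∀ m n (j : Fin n) → m ↑ʳ j ∉ V₁ m n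
  ↑ʳ∉V₁ zero    n j = ∉⊥
  ↑ʳ∉V₁ (suc m) n j = ↑ʳ∉V₁ m n j ∘ drop-there

  ↑ˡ∉V₂ : ∀ m n (i : Fin m) → i ↑ˡ n ∉ V₂ m n
  ↑ˡ∉V₂ (suc m) n zero    = λ ()
  ↑ˡ∉V₂ (suc m) n (suc i) = ↑ˡ∉V₂ m n i ∘ drop-there

  data Side (m n : ℕ) : Fin (m + n) → Set where
    left  : (i : Fin m) → Side m n (i ↑ˡ n)
    right : (j : Fin n) → Side m n (m ↑ʳ j)

  side : ∀ m n x → Side m n x
  side m n x with splitAt m x in eq
  ... | inj₁ i = subst (Side m n) (splitAt⁻¹-↑ˡ eq) (left i)
  ... | inj₂ j = subst (Side m n) (splitAt⁻¹-↑ʳ eq) (right j)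

  Meets₁ Meets₂ : ∀ m n → Pred (Subset (m + n)) 0ℓ
  Meets₁ m n s = ∃[ i ] (i ↑ˡ n) ∈ s
  Meets₂ m n s = ∃[ j ] (m ↑ʳ j) ∈ s

  meets₁? : ∀ m n → Decidable (Meets₁ m n)
  meets₁? m n s = any? (λ i → (i ↑ˡ n) ∈? s)

  meets₂? : ∀ m n → Decidable (Meets₂ m n)
  meets₂? m n s = any? (λ j → (m ↑ʳ j) ∈? s)

  ¬Meets₂⇒⊆V₁ : ∀ m n {s} → ¬ Meets₂ m n s → s ⊆ V₁ m n
  ¬Meets₂⇒⊆V₁ m n ¬meets {x} x∈s with side m n x
  ... | left i  = ↑ˡ∈V₁ m n i
  ... | right j = contradiction (j , x∈s) ¬meets

  ¬Meets₁⇒⊆V₂ : ∀ m n {s} → ¬ Meets₁ m n s → s ⊆ V₂ m n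
  ¬Meets₁⇒⊆V₂ m n ¬meets {x} x∈s with side m n x
  ... | left i  = contradiction (i , x∈s) ¬meets
  ... | right j = ↑ʳ∈V₂ m n j

  Triple : ∀ {N} → Fin N → Fin N → Pred (Subset N) 0ℓ
  Triple i j s = ∣ s ∣ ≡ 3 × i ∈ s × j ∈ s

  triple? : ∀ {N} (i j : Fin N) → Decidable (Triple i j)
  triple? i j s = (∣ s ∣ ≟ℕ 3) ×-dec (i ∈? s) ×-dec (j ∈? s)

  #-all-triples : ∀ {N} {i j : Fin N} → i ≢ j → 2 + # (triple? i j) ≡ N
  #-all-triples {N} {i} {j} i≢j = trans
    (#-triples (triple? i j) ⊤ i≢j ∈⊤ ∈⊤ (λ (c , i∈s , j∈s) → c , i∈s , j∈s , ⊆⊤) (λ c i∈s j∈s _ → c , i∈s , j∈s))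
    (∣⊤∣≡n N)

  codegree? : ∀ {N} (H : Hypergraph N) (i j : Fin N) → Decidable (λ s → Edge H s × i ∈ s × j ∈ s)
  codegree? H i j s = edge? H s ×-dec (i ∈? s) ×-dec (j ∈? s)

  module _ (m n : ℕ) where
    private C = completeBipartite³ m n

    -- When every triple through the pair meets both classes, all these triples are hyperedges, and
    -- any of the other m + n - 2 vertices completes one.
    codegree-cross : ∀ {x y} → x ≢ y → (∀ {s} → Triple x y s → Meets₁ m n s × Meets₂ m n s) →
      2 + codegree C x y ≡ m + n
    codegree-cross {x} {y} x≢y meets = trans
      (cong (2 +_) (#-cong (codegree? C x y) (triple? x y)
        (λ ((c , _) , i∈s , j∈s) → c , i∈s , j∈s)
        (λ t@(c , i∈s , j∈s) → (c , meets t) , i∈s , j∈s)))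
      (#-all-triples x≢y)

    private
      remainder : ∀ {k t c x} q → t ≡ c + x → 2 + t ≡ k + q → 2 + x ≡ k → c ≡ q
      remainder {k} {t} {c} {x} q t≡ 2+t≡ 2+x≡ = +-cancelˡ-≡ (2 + x) c q (begin
        2 + x + c     ≡⟨ cong (2 +_) (trans (+-comm x c) (sym t≡)) ⟩
        2 + t         ≡⟨ 2+t≡ ⟩
        k + q         ≡⟨ cong (_+ q) (sym 2+x≡) ⟩
        2 + x + q     ∎)
        where open ≡-Reasoning

    -- Of the m + n - 2 triples through two vertices of V₁, exactly the m - 2 that stay inside V₁
    -- are not hyperedges.
    codegree-left : ∀ {i j} → i ↑ˡ n ≢ j ↑ˡ n → codegree C (i ↑ˡ n) (j ↑ˡ n) ≡ n
    codegree-left {i} {j} i≢j = trans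
      (#-cong (codegree? C (i ↑ˡ n) (j ↑ˡ n)) (λ s → t? s ×-dec meets₂? m n s)
        (λ ((c , _ , meets) , i∈s , j∈s) → (c , i∈s , j∈s) , meets)
        (λ ((c , i∈s , j∈s) , meets) → (c , (i , i∈s) , meets) , i∈s , j∈s))
      (remainder n (#-split t? (meets₂? m n)) (#-all-triples i≢j)
        (trans (#-triples (λ s → t? s ×-dec ¬? (meets₂? m n s)) (V₁ m n) i≢j (↑ˡ∈V₁ m n i) (↑ˡ∈V₁ m n j)
          (λ ((c , i∈s , j∈s) , ¬meets) → c , i∈s , j∈s , ¬Meets₂⇒⊆V₁ m n ¬meets)
          (λ c i∈s j∈s s⊆V₁ → (c , i∈s , j∈s) , λ (k , k∈s) → ↑ʳ∉V₁ m n k (s⊆V₁ k∈s)))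
          (∣V₁∣ m n)))
      where t? = triple? (i ↑ˡ n) (j ↑ˡ n)

    codegree-right : ∀ {i j} → m ↑ʳ i ≢ m ↑ʳ j → codegree C (m ↑ʳ i) (m ↑ʳ j) ≡ m
    codegree-right {i} {j} i≢j = trans
      (#-cong (codegree? C (m ↑ʳ i) (m ↑ʳ j)) (λ s → t? s ×-dec meets₁? m n s)
        (λ ((c , meets , _) , i∈s , j∈s) → (c , i∈s , j∈s) , meets)
        (λ ((c , i∈s , j∈s) , meets) → (c , meets , (i , i∈s)) , i∈s , j∈s))
      (remainder m (#-split t? (meets₁? m n)) (trans (#-all-triples i≢j) (+-comm m n))
        (trans (#-triples (λ s → t? s ×-dec ¬? (meets₁? m n s)) (V₂ m n) i≢j (↑ʳ∈V₂ m n i) (↑ʳ∈V₂ m n j)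
          (λ ((c , i∈s , j∈s) , ¬meets) → c , i∈s , j∈s , ¬Meets₁⇒⊆V₂ m n ¬meets)
          (λ c i∈s j∈s s⊆V₂ → (c , i∈s , j∈s) , λ (k , k∈s) → ↑ˡ∉V₂ m n k (s⊆V₂ k∈s)))
          (∣V₂∣ m n)))
      where t? = triple? (m ↑ʳ i) (m ↑ʳ j)

    codegree-leftRight : ∀ {i j} → i ↑ˡ n ≢ m ↑ʳ j → 2 + codegree C (i ↑ˡ n) (m ↑ʳ j) ≡ m + n
    codegree-leftRight {i} {j} i≢j = codegree-cross i≢j λ (_ , i∈s , j∈s) → (i , i∈s) , (j , j∈s)

    codegree-rightLeft : ∀ {i j} → m ↑ʳ j ≢ i ↑ˡ n → 2 + codegree C (m ↑ʳ j) (i ↑ˡ n) ≡ m + n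
    codegree-rightLeft {i} {j} j≢i = codegree-cross j≢i λ (_ , j∈s , i∈s) → (i , i∈s) , (j , j∈s)

  memberBit : ∀ {N} → Subset N → Fin N → ℕ
  memberBit s i = if Vec.lookup s i then 1 else 0

  -- The loss is a product of two membership indicators; off the diagonal the deletion is therefore
  -- a rank-one change of the Seidel matrix.
  codegree-deleteEdge : ∀ {N} (H : Hypergraph N) e → Edge H e → ∀ i j →
    codegree H i j ≡ memberBit e i * memberBit e j + codegree (deleteEdge H e) i j
  codegree-deleteEdge H e He i j = trans (#-split (codegree? H i j) (λ s → Vecₚ.≡-dec Boolₚ._≟_ s e))
    (cong₂ _+_ through
      (#-cong (λ s → codegree? H i j s ×-dec ¬? (Vecₚ.≡-dec Boolₚ._≟_ s e)) (codegree? (deleteEdge H e) i j)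
        (λ ((Hs , i∈s , j∈s) , s≢e) → (Hs , s≢e) , i∈s , j∈s)
        (λ ((Hs , s≢e) , i∈s , j∈s) → (Hs , i∈s , j∈s) , s≢e)))
    where
    P? = λ s → codegree? H i j s ×-dec Vecₚ.≡-dec Boolₚ._≟_ s e
    through : # P? ≡ memberBit e i * memberBit e j
    through with Vec.lookup e i in i-eq | Vec.lookup e j in j-eq
    ... | true  | true  = #-unique P? e (λ s → proj₂)
      ((He , lookup⇒[]= i e i-eq , lookup⇒[]= j e j-eq) , refl)
    ... | true  | false = #-none P? λ { s ((_ , _ , j∈s) , refl) →
      contradiction (trans (sym ([]=⇒lookup j∈s)) j-eq) λ () }
    ... | false | _     = #-none P? λ { s ((_ , i∈s , _) , refl) →
      contradiction (trans (sym ([]=⇒lookup i∈s)) i-eq) λ () }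

module Spectra where

  open import Defs using (ℝ; seq; fromℚ; sign; det; Matrix; scalar; charPoly; Eigenvalues; seidel; seidelEntry;
    Hypergraph; Edge; codegree; completeBipartite³; deleteEdge; IsSeidelEnergy; ∑; ∏)
  import Defs
  open import Algebra.Bundles using (CommutativeRing)
  open import Data.Bool.Properties using (T-∧)
  open import Data.Fin using (#_)
  open import Data.Fin.Patterns using (0F; 1F; 2F; 3F; 4F; 5F; 6F; 7F; 8F; 9F)
  open import Data.Fin.Subset as Subset using (Subset; ⊥)
  open import Data.Integer as ℤ using (ℤ)
  import Data.Integer.Properties as ℤₚ
  import Data.Nat.Solver as ℕSolver
  open import Data.Rational hiding (_≟_)
  import Data.Rational.Properties as ℚₚ
  import Data.Rational.Unnormalised as ℚᵘ
  import Data.Rational.Unnormalised.Properties as ℚᵘₚ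
  open import Data.Rational.Solver using (module +-*-Solver)
  open import Data.Unit using (tt)
  open import Data.Vec.Functional using (Vector)
  open import Data.Vec.Relation.Unary.All using (All; []; _∷_)
  open import Data.Vec.Relation.Unary.All.Properties using (lookup⁺)
  open import Function using (Equivalence)
  open import Relation.Binary.Definitions using (tri<; tri≈; tri>)
  open import Relation.Nullary.Decidable using (isYes; toWitness)
  open import Algebra.Properties.CommutativeMonoid.Sum ℚₚ.+-0-commutativeMonoid
    using (sum; sum-cong-≗; ∑-distrib-+; ∑-comm; sum-init-last; sum-replicate-zero)
  open import Algebra.Properties.CommutativeMonoid.Sum ℚₚ.*-1-commutativeMonoid
    using () renaming (sum to product; sum-cong-≗ to product-cong; sum-init-last to product-init-last;
      ∑-distrib-+ to product-distrib-*)
  open import Algebra.Properties.Semiring.Sum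
    (CommutativeRing.semiring ℚₚ.+-*-commutativeRing) using (*-distribˡ-sum)
  open ℕSolver.+-*-Solver using () renaming (solve to ℕ-solve; con to conℕ; _:=_ to _:=ℕ_; _:+_ to _:+ℕ_)
  open +-*-Solver using (Polynomial; op; [+]; [*]; con; var; _:^_; :-_; ⟦_⟧; solve; _:=_; _:+_; _:*_; _:-_)
  open ≡-Reasoning
  open Codegrees hiding (#)

  -- Determinants of rational matrices

  Matrixℚ : ℕ → Set
  Matrixℚ n = Fin n → Fin n → ℚ

  signℚ : ℕ → ℚ
  signℚ zero    = 1ℚ
  signℚ (suc k) = - signℚ k

  minor : ∀ {n} → Matrixℚ (suc n) → Fin (suc n) → Matrixℚ n
  minor A j i k = A (suc i) (punchIn j k)

  detℚ : ∀ {n} → Matrixℚ n → ℚ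
  detℚ {zero}  A = 1ℚ
  detℚ {suc n} A = sum λ j → signℚ (toℕ j) * (A zero j * detℚ (minor A j))

  detℚ-cong : ∀ {n} {A B : Matrixℚ n} → (∀ i j → A i j ≡ B i j) → detℚ A ≡ detℚ B
  detℚ-cong {zero}  A≗B = refl
  detℚ-cong {suc n} A≗B = sum-cong-≗ λ j → cong (signℚ (toℕ j) *_)
    (cong₂ _*_ (A≗B zero j) (detℚ-cong λ i k → A≗B (suc i) (punchIn j k)))

  sum-zero : ∀ {n} {f : Fin n → ℚ} → (∀ i → f i ≡ 0ℚ) → sum f ≡ 0ℚ
  sum-zero {n} f≗0 = trans (sum-cong-≗ f≗0) (sum-replicate-zero n)

  vanishing-minor : ∀ s a {d} → d ≡ 0ℚ → s * (a * d) ≡ 0ℚ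
  vanishing-minor s a refl = trans (cong (s *_) (ℚₚ.*-zeroʳ a)) (ℚₚ.*-zeroʳ s)

  vanishing-entry : ∀ s {a} d → a ≡ 0ℚ → s * (a * d) ≡ 0ℚ
  vanishing-entry s d refl = trans (cong (s *_) (ℚₚ.*-zeroˡ d)) (ℚₚ.*-zeroʳ s)

  -- Both expansions share the corner term. Expanding the remaining minors once more, along the
  -- column by induction on one side and along the row by definition on the other, gives the same
  -- double sum. Invariance under transposition follows.
  detℚ-firstColumn : ∀ {n} (A : Matrixℚ (suc n)) →
    detℚ A ≡ sum λ i → signℚ (toℕ i) * (A i zero * detℚ λ r s → A (punchIn i r) (suc s))
  detℚ-firstColumn {zero}  A = refl
  detℚ-firstColumn {suc n} A = cong (corner +_) (begin
    (sum λ j → signℚ (suc (toℕ j)) * (A zero (suc j) * detℚ (minor A (suc j))))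
      ≡⟨ sum-cong-≗ (λ j → trans
           (cong (λ d → - sg j * (A zero (suc j) * d)) (detℚ-firstColumn (minor A (suc j))))
           (spread (- sg j) (A zero (suc j)) (λ i → sg i * (A (suc i) zero * D i j)))) ⟩
    (sum λ j → sum λ i → - sg j * (A zero (suc j) * (sg i * (A (suc i) zero * D i j))))
      ≡⟨ ∑-comm (λ j i → - sg j * (A zero (suc j) * (sg i * (A (suc i) zero * D i j)))) ⟩
    (sum λ i → sum λ j → - sg j * (A zero (suc j) * (sg i * (A (suc i) zero * D i j))))
      ≡⟨ sum-cong-≗ (λ i → trans
           (sum-cong-≗ λ j → swap (sg j) (A zero (suc j)) (sg i) (A (suc i) zero) (D i j))
           (sym (spread (- sg i) (A (suc i) zero) (λ j → sg j * (A zero (suc j) * D i j))))) ⟩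
    (sum λ i → signℚ (suc (toℕ i)) *
      (A (suc i) zero * detℚ λ r s → A (punchIn (suc i) r) (suc s))) ∎)
    where
    corner : ℚ
    corner = 1ℚ * (A zero zero * detℚ (minor A zero))
    sg : ∀ {k} → Fin k → ℚ
    sg = signℚ ∘ toℕ
    D : Fin (suc n) → Fin (suc n) → ℚ
    D i j = detℚ λ r s → A (suc (punchIn i r)) (suc (punchIn j s))
    spread : ∀ {k} s a (f : Fin k → ℚ) → s * (a * sum f) ≡ sum λ i → s * (a * f i)
    spread s a f = trans (cong (s *_) (*-distribˡ-sum a f)) (*-distribˡ-sum s (λ i → a * f i))
    swap : ∀ s a t b d → - s * (a * (t * (b * d))) ≡ - t * (b * (s * (a * d)))
    swap = solve 5 (λ s a t b d → :- s :* (a :* (t :* (b :* d))) :=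
                                  :- t :* (b :* (s :* (a :* d)))) refl

  detℚ-transpose : ∀ {n} (A : Matrixℚ n) → detℚ (flip A) ≡ detℚ A
  detℚ-transpose {zero}  A = refl
  detℚ-transpose {suc n} A = trans
    (sum-cong-≗ λ j → cong (λ d → signℚ (toℕ j) * (A j zero * d))
      (detℚ-transpose λ r s → A (punchIn j r) (suc s)))
    (sym (detℚ-firstColumn A))

  detℚ-linear : ∀ {n} (i : Fin n) {A B C : Matrixℚ n} (c : ℚ) →
    (∀ k → k ≢ i → ∀ j → C k j ≡ A k j) → (∀ k → k ≢ i → ∀ j → C k j ≡ B k j) →
    (∀ j → C i j ≡ A i j + c * B i j) → detℚ C ≡ detℚ A + c * detℚ B
  detℚ-linear {suc n} i {A} {B} {C} c C≗A C≗B Cᵢ = begin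
    detℚ C
      ≡⟨ sum-cong-≗ (termwise i C≗A C≗B Cᵢ) ⟩
    (sum λ j → term A j + c * term B j)
      ≡⟨ ∑-distrib-+ (term A) (λ j → c * term B j) ⟩
    detℚ A + (sum λ j → c * term B j)
      ≡⟨ cong (detℚ A +_) (sym (*-distribˡ-sum c (term B))) ⟩
    detℚ A + c * detℚ B ∎
    where
    term : Matrixℚ (suc n) → Fin (suc n) → ℚ
    term X j = signℚ (toℕ j) * (X zero j * detℚ (minor X j))
    first : ∀ s a b c d → s * ((a + c * b) * d) ≡ s * (a * d) + c * (s * (b * d))
    first = solve 5 (λ s a b c d → s :* ((a :+ c :* b) :* d) :=
                                   s :* (a :* d) :+ c :* (s :* (b :* d))) refl
    later : ∀ s a d c e → s * (a * (d + c * e)) ≡ s * (a * d) + c * (s * (a * e))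
    later = solve 5 (λ s a d c e → s :* (a :* (d :+ c :* e)) :=
                                   s :* (a :* d) :+ c :* (s :* (a :* e))) refl
    termwise : ∀ i → (∀ k → k ≢ i → ∀ j → C k j ≡ A k j) →
      (∀ k → k ≢ i → ∀ j → C k j ≡ B k j) → (∀ j → C i j ≡ A i j + c * B i j) →
      ∀ j → term C j ≡ term A j + c * term B j
    termwise zero C≗A C≗B Cᵢ j = begin
      signℚ (toℕ j) * (C zero j * detℚ (minor C j))
        ≡⟨ cong (λ x → signℚ (toℕ j) * (x * detℚ (minor C j))) (Cᵢ j) ⟩
      signℚ (toℕ j) * ((A zero j + c * B zero j) * detℚ (minor C j))
        ≡⟨ first (signℚ (toℕ j)) (A zero j) (B zero j) c (detℚ (minor C j)) ⟩
      signℚ (toℕ j) * (A zero j * detℚ (minor C j)) + c * (signℚ (toℕ j) * (B zero j * detℚ (minor C j)))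
        ≡⟨ cong₂ (λ x y → signℚ (toℕ j) * (A zero j * x) + c * (signℚ (toℕ j) * (B zero j * y)))
             (detℚ-cong λ r s → C≗A (suc r) (λ ()) (punchIn j s))
             (detℚ-cong λ r s → C≗B (suc r) (λ ()) (punchIn j s)) ⟩
      term A j + c * term B j ∎
    termwise (suc i) C≗A C≗B Cᵢ j = begin
      signℚ (toℕ j) * (C zero j * detℚ (minor C j))
        ≡⟨ cong (λ x → signℚ (toℕ j) * (C zero j * x))
             (detℚ-linear i c (λ k k≢i s → C≗A (suc k) (k≢i ∘ suc-injective) (punchIn j s))
                              (λ k k≢i s → C≗B (suc k) (k≢i ∘ suc-injective) (punchIn j s))
                              (λ s → Cᵢ (punchIn j s))) ⟩
      signℚ (toℕ j) * (C zero j * (detℚ (minor A j) + c * detℚ (minor B j)))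
        ≡⟨ later (signℚ (toℕ j)) (C zero j) (detℚ (minor A j)) c (detℚ (minor B j)) ⟩
      signℚ (toℕ j) * (C zero j * detℚ (minor A j)) + c * (signℚ (toℕ j) * (C zero j * detℚ (minor B j)))
        ≡⟨ cong₂ (λ x y → signℚ (toℕ j) * (x * detℚ (minor A j)) + c * (signℚ (toℕ j) * (y * detℚ (minor B j))))
             (C≗A zero (λ ()) j) (C≗B zero (λ ()) j) ⟩
      term A j + c * term B j ∎

  setRow : ∀ {n} → Fin n → (Fin n → ℚ) → Matrixℚ n → Matrixℚ n
  setRow i v A k with k ≟ i
  ... | yes _ = v
  ... | no  _ = A k

  setRow-at : ∀ {n} (i : Fin n) v A j → setRow i v A i j ≡ v j
  setRow-at i v A j with i ≟ i
  ... | yes _   = refl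
  ... | no  i≢i = contradiction refl i≢i

  setRow-off : ∀ {n} (i : Fin n) v A k → k ≢ i → ∀ j → setRow i v A k j ≡ A k j
  setRow-off i v A k k≢i j with k ≟ i
  ... | yes k≡i = contradiction k≡i k≢i
  ... | no  _   = refl

  detℚ-addRow : ∀ {n} (i : Fin n) (A : Matrixℚ n) (c : ℚ) (v : Fin n → ℚ) →
    detℚ (setRow i (λ j → A i j + c * v j) A) ≡ detℚ A + c * detℚ (setRow i v A)
  detℚ-addRow i A c v = detℚ-linear i c
    (setRow-off i _ A)
    (λ k k≢i j → trans (setRow-off i _ A k k≢i j) (sym (setRow-off i v A k k≢i j)))
    (λ j → trans (setRow-at i _ A j) (cong (λ x → A i j + c * x) (sym (setRow-at i v A j))))

  -- In the expansion along the first row the terms of the two equal columns cancel, and every later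
  -- minor again begins with two equal columns.
  firstColumns-alternating : ∀ {n} (A : Matrixℚ (suc (suc n))) →
    (∀ i → A i zero ≡ A i (suc zero)) → detℚ A ≡ 0ℚ
  firstColumns-alternating {n} A A₀≗A₁ = begin
    1ℚ * (A zero zero * detℚ (minor A zero)) +
    (- 1ℚ * (A zero (suc zero) * detℚ (minor A (suc zero))) + sum rest)
      ≡⟨ cong₂ (λ x y → 1ℚ * x + (- 1ℚ * (A zero (suc zero) * detℚ (minor A (suc zero))) + y))
           (cong₂ _*_ (A₀≗A₁ zero) (detℚ-cong minors)) (sum-zero (rest≗0 A A₀≗A₁)) ⟩
    1ℚ * x + (- 1ℚ * x + 0ℚ)
      ≡⟨ cancel x ⟩
    0ℚ ∎
    where
    x : ℚ
    x = A zero (suc zero) * detℚ (minor A (suc zero))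
    rest : Fin n → ℚ
    rest j = signℚ (toℕ (suc (suc j))) * (A zero (suc (suc j)) * detℚ (minor A (suc (suc j))))
    minors : ∀ i k → minor A zero i k ≡ minor A (suc zero) i k
    minors i zero    = sym (A₀≗A₁ (suc i))
    minors i (suc k) = refl
    rest≗0 : ∀ {n} (A : Matrixℚ (suc (suc n))) → (∀ i → A i zero ≡ A i (suc zero)) → ∀ j →
      signℚ (toℕ (suc (suc j))) * (A zero (suc (suc j)) * detℚ (minor A (suc (suc j)))) ≡ 0ℚ
    rest≗0 {suc n} A A₀≗A₁ j = vanishing-minor (signℚ (toℕ (suc (suc j)))) (A zero (suc (suc j)))
      (firstColumns-alternating (minor A (suc (suc j))) λ i → A₀≗A₁ (suc i))
    cancel : ∀ x → 1ℚ * x + (- 1ℚ * x + 0ℚ) ≡ 0ℚ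
    cancel = solve 1 (λ x → con 1ℚ :* x :+ (con (- 1ℚ) :* x :+ con 0ℚ) := con 0ℚ) refl

  firstRows-alternating : ∀ {n} (A : Matrixℚ (suc (suc n))) →
    (∀ j → A zero j ≡ A (suc zero) j) → detℚ A ≡ 0ℚ
  firstRows-alternating A A₀≗A₁ =
    trans (sym (detℚ-transpose A)) (firstColumns-alternating (flip A) A₀≗A₁)

  Alternating : ℕ → Set
  Alternating n = ∀ (A : Matrixℚ n) {i j : Fin n} → i ≢ j → (∀ k → A i k ≡ A j k) → detℚ A ≡ 0ℚ

  laterRows-alternating : ∀ {n} → Alternating n → (A : Matrixℚ (suc n)) {i j : Fin n} → i ≢ j →
    (∀ k → A (suc i) k ≡ A (suc j) k) → detℚ A ≡ 0ℚ
  laterRows-alternating alt A i≢j Aᵢ≗Aⱼ = sum-zero λ k →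
    vanishing-minor (signℚ (toℕ k)) (A zero k)
      (alt (minor A k) i≢j λ s → Aᵢ≗Aⱼ (punchIn k s))

  -- Write z, x, z for the rows 0, 1, J of A.  The matrices with rows z, x, x and
  -- z, z, x are singular, hence so is A₃ with rows z, x + z, x; the one with rows
  -- z, x + z, x + z is singular too, and it differs from A by A₃ and another
  -- singular matrix.
  farRows-alternating : ∀ {n} → Alternating (suc n) → (A : Matrixℚ (suc (suc n))) (j : Fin n) →
    (∀ k → A zero k ≡ A (suc (suc j)) k) → detℚ A ≡ 0ℚ
  farRows-alternating {n} alt A j A₀≗Aⱼ = begin
    detℚ A                                              ≡⟨ sym (drop (detℚ A) singular₁) ⟩
    detℚ A + 1ℚ * detℚ (setRow one (A zero) A)          ≡⟨ sym (detℚ-addRow one A 1ℚ (A zero)) ⟩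
    detℚ A₁                                             ≡⟨ sym (drop (detℚ A₁) singular₃) ⟩
    detℚ A₁ + 1ℚ * detℚ A₃                              ≡⟨ sym (detℚ-addRow J A₁ 1ℚ (A one)) ⟩
    detℚ A₂                                             ≡⟨ laterRows-alternating alt A₂ {zero} {suc j} (λ ()) rows₂ ⟩
    0ℚ                                                  ∎
    where
    one J : Fin (suc (suc n))
    one = suc zero
    J   = suc (suc j)
    A₁ A₂ A₃ B : Matrixℚ (suc (suc n))
    v₁ v₂ : Fin (suc (suc n)) → ℚ
    v₁ k = A one k + 1ℚ * A zero k
    v₂ k = A₁ J k + 1ℚ * A one k
    A₁ = setRow one v₁ A
    A₂ = setRow J v₂ A₁
    A₃ = setRow J (A one) A₁
    B  = setRow J (A one) A
    drop : ∀ x {y} → y ≡ 0ℚ → x + 1ℚ * y ≡ x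
    drop x refl = ℚₚ.+-identityʳ x
    comm : ∀ x y → x + 1ℚ * y ≡ y + 1ℚ * x
    comm = solve 2 (λ x y → x :+ con 1ℚ :* y := y :+ con 1ℚ :* x) refl
    singular₁ : detℚ (setRow one (A zero) A) ≡ 0ℚ
    singular₁ = firstRows-alternating (setRow one (A zero) A) λ k →
      trans (setRow-off one (A zero) A zero (λ ()) k) (sym (setRow-at one (A zero) A k))
    rows₂ : ∀ k → A₂ one k ≡ A₂ J k
    rows₂ k = begin
      A₂ one k                    ≡⟨ setRow-off J v₂ A₁ one (λ ()) k ⟩
      A₁ one k                    ≡⟨ setRow-at one v₁ A k ⟩
      A one k + 1ℚ * A zero k     ≡⟨ comm (A one k) (A zero k) ⟩
      A zero k + 1ℚ * A one k     ≡⟨ cong (_+ 1ℚ * A one k) (A₀≗Aⱼ k) ⟩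
      A J k + 1ℚ * A one k        ≡⟨ cong (_+ 1ℚ * A one k) (sym (setRow-off one v₁ A J (λ ()) k)) ⟩
      A₁ J k + 1ℚ * A one k       ≡⟨ sym (setRow-at J v₂ A₁ k) ⟩
      A₂ J k                      ∎
    singularB : detℚ B ≡ 0ℚ
    singularB = laterRows-alternating alt B {zero} {suc j} (λ ()) λ k →
      trans (setRow-off J (A one) A one (λ ()) k) (sym (setRow-at J (A one) A k))
    singularB₁ : detℚ (setRow one (A zero) B) ≡ 0ℚ
    singularB₁ = firstRows-alternating (setRow one (A zero) B) λ k → trans
      (trans (setRow-off one (A zero) B zero (λ ()) k) (setRow-off J (A one) A zero (λ ()) k))
      (sym (setRow-at one (A zero) B k))
    off-one : ∀ k → k ≢ one → ∀ s → A₃ k s ≡ B k s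
    off-one k k≢1 s with k ≟ J
    ... | yes _ = refl
    ... | no  _ = setRow-off one v₁ A k k≢1 s
    singular₃ : detℚ A₃ ≡ 0ℚ
    singular₃ = begin
      detℚ A₃
        ≡⟨ detℚ-linear one {B} {setRow one (A zero) B} {A₃} 1ℚ off-one
             (λ k k≢1 s → trans (off-one k k≢1 s) (sym (setRow-off one (A zero) B k k≢1 s)))
             (λ s → trans (trans (setRow-off J (A one) A₁ one (λ ()) s) (setRow-at one v₁ A s))
               (cong₂ (λ x y → x + 1ℚ * y) (sym (setRow-off J (A one) A one (λ ()) s))
                 (sym (setRow-at one (A zero) B s)))) ⟩
      detℚ B + 1ℚ * detℚ (setRow one (A zero) B)
        ≡⟨ drop (detℚ B) singularB₁ ⟩
      detℚ B
        ≡⟨ singularB ⟩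
      0ℚ ∎

  firstRow-alternating : ∀ {n} → Alternating n → (A : Matrixℚ (suc n)) (j : Fin n) →
    (∀ k → A zero k ≡ A (suc j) k) → detℚ A ≡ 0ℚ
  firstRow-alternating alt A zero    = firstRows-alternating A
  firstRow-alternating alt A (suc j) = farRows-alternating alt A j

  detℚ-alternating : ∀ {n} → Alternating n
  detℚ-alternating {suc n} A {zero}  {zero}  i≢j Aᵢ≗Aⱼ = contradiction refl i≢j
  detℚ-alternating {suc n} A {zero}  {suc j} i≢j Aᵢ≗Aⱼ =
    firstRow-alternating detℚ-alternating A j Aᵢ≗Aⱼ
  detℚ-alternating {suc n} A {suc i} {zero}  i≢j Aᵢ≗Aⱼ =
    firstRow-alternating detℚ-alternating A i (sym ∘ Aᵢ≗Aⱼ)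
  detℚ-alternating {suc n} A {suc i} {suc j} i≢j Aᵢ≗Aⱼ =
    laterRows-alternating detℚ-alternating A (i≢j ∘ cong suc) Aᵢ≗Aⱼ

  -- Truncated multipliers interpolate between the matrix before and after a simultaneous row
  -- operation, one row at a time.
  cut : ∀ {n} → ℕ → (Fin n → ℚ) → Fin n → ℚ
  cut t c k with toℕ k ℕ.<? t
  ... | yes _ = c k
  ... | no  _ = 0ℚ

  cut-below : ∀ {n} t (c : Fin n → ℚ) k → toℕ k ℕ.< t → cut t c k ≡ c k
  cut-below t c k k<t with toℕ k ℕ.<? t
  ... | yes _   = refl
  ... | no  k≮t = contradiction k<t k≮t

  cut-above : ∀ {n} t (c : Fin n → ℚ) k → t ℕ.≤ toℕ k → cut t c k ≡ 0ℚ
  cut-above t c k t≤k with toℕ k ℕ.<? t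
  ... | yes k<t = contradiction t≤k (ℕₚ.<⇒≱ k<t)
  ... | no  _   = refl

  cut-vanishing : ∀ {n} t (c : Fin n → ℚ) k → c k ≡ 0ℚ → cut t c k ≡ 0ℚ
  cut-vanishing t c k cₖ≡0 with toℕ k ℕ.<? t
  ... | yes _ = cₖ≡0
  ... | no  _ = refl

  cut-suc : ∀ {n} (i : Fin n) (c : Fin n → ℚ) k → k ≢ i → cut (suc (toℕ i)) c k ≡ cut (toℕ i) c k
  cut-suc i c k k≢i with ℕₚ.<-cmp (toℕ k) (toℕ i)
  ... | tri< k<i _ _ = trans (cut-below (suc (toℕ i)) c k (ℕₚ.m<n⇒m<1+n k<i)) (sym (cut-below (toℕ i) c k k<i))
  ... | tri≈ _ k≡i _ = contradiction (toℕ-injective k≡i) k≢i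
  ... | tri> _ _ i<k = trans (cut-above (suc (toℕ i)) c k i<k) (sym (cut-above (toℕ i) c k (ℕₚ.<⇒≤ i<k)))

  -- Since `c l` vanishes, row `l` is unchanged at every intermediate stage, so passing to the next
  -- stage adds a multiple of a determinant with two equal rows.
  detℚ-addMultiples : ∀ {n} (l : Fin n) (c : Fin n → ℚ) (A : Matrixℚ n) → c l ≡ 0ℚ →
    detℚ (λ k j → A k j + c k * A l j) ≡ detℚ A
  detℚ-addMultiples {n} l c A cₗ≡0 = begin
    detℚ (λ k j → A k j + c k * A l j)
      ≡⟨ detℚ-cong (λ k j → cong (λ x → A k j + x * A l j) (sym (cut-below n c k (toℕ<n k)))) ⟩
    detℚ (partial n)
      ≡⟨ partial-det n ℕₚ.≤-refl ⟩
    detℚ A ∎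
    where
    partial : ℕ → Matrixℚ n
    partial t k j = A k j + cut t c k * A l j
    absorb : ∀ x y {z} → z ≡ 0ℚ → x + z * y ≡ x
    absorb x y refl = trans (cong (x +_) (ℚₚ.*-zeroˡ y)) (ℚₚ.+-identityʳ x)
    step : ∀ i → detℚ (partial (suc (toℕ i))) ≡ detℚ (partial (toℕ i))
    replaced : Fin n → Matrixℚ n
    replaced i = setRow i (A l) (partial (suc (toℕ i)))
    step i with i ≟ l
    ... | yes refl = detℚ-cong λ k j → cong (λ x → A k j + x * A i j) (cuts k)
      where
      cuts : ∀ k → cut (suc (toℕ i)) c k ≡ cut (toℕ i) c k
      cuts k with k ≟ i
      ... | yes refl = trans (cut-vanishing (suc (toℕ i)) c i cₗ≡0) (sym (cut-vanishing (toℕ i) c i cₗ≡0))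
      ... | no  k≢i  = cut-suc i c k k≢i
    ... | no  i≢l  = begin
      detℚ (partial (suc (toℕ i)))
        ≡⟨ detℚ-linear i {partial (toℕ i)} {replaced i} {partial (suc (toℕ i))} (c i)
             (λ k k≢i j → cong (λ x → A k j + x * A l j) (cut-suc i c k k≢i))
             (λ k k≢i j → sym (setRow-off i (A l) (partial (suc (toℕ i))) k k≢i j))
             (λ j → cong₂ _+_ (sym (absorb (A i j) (A l j) (cut-above (toℕ i) c i ℕₚ.≤-refl)))
                     (cong₂ _*_ (cut-below (suc (toℕ i)) c i ℕₚ.≤-refl)
                       (sym (setRow-at i (A l) (partial (suc (toℕ i))) j)))) ⟩
      detℚ (partial (toℕ i)) + c i * detℚ (replaced i)
        ≡⟨ cong (λ x → detℚ (partial (toℕ i)) + c i * x)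
             (detℚ-alternating (replaced i) i≢l λ j → trans
               (setRow-at i (A l) (partial (suc (toℕ i))) j)
               (sym (trans (setRow-off i (A l) (partial (suc (toℕ i))) l (i≢l ∘ sym) j)
                           (absorb (A l j) (A l j) (cut-vanishing (suc (toℕ i)) c l cₗ≡0))))) ⟩
      detℚ (partial (toℕ i)) + c i * 0ℚ
        ≡⟨ trans (cong (detℚ (partial (toℕ i)) +_) (ℚₚ.*-zeroʳ (c i))) (ℚₚ.+-identityʳ (detℚ (partial (toℕ i)))) ⟩
      detℚ (partial (toℕ i)) ∎
    partial-det : ∀ t → t ℕ.≤ n → detℚ (partial t) ≡ detℚ A
    partial-det zero    _   = detℚ-cong λ k j → absorb (A k j) (A l j) (cut-above 0 c k ℕ.z≤n)
    partial-det (suc t) t<n = trans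
      (subst (λ s → detℚ (partial (suc s)) ≡ detℚ (partial s)) (toℕ-fromℕ< t<n) (step (fromℕ< t<n)))
      (partial-det t (ℕₚ.<⇒≤ t<n))

  -- Gaussian elimination below a corner entry 1; what remains is the Schur complement.
  pivot-first : ∀ {n} (A : Matrixℚ (suc n)) → A zero zero ≡ 1ℚ →
    detℚ A ≡ detℚ λ i j → A (suc i) (suc j) - A (suc i) zero * A zero (suc j)
  pivot-first {n} A A₀₀≡1 = begin
    detℚ A
      ≡⟨ sym (detℚ-addMultiples zero c A refl) ⟩
    detℚ B
      ≡⟨ detℚ-firstColumn B ⟩
    1ℚ * (B zero zero * detℚ (λ r s → B (suc r) (suc s))) + sum rest
      ≡⟨ cong₂ _+_ (cong (λ x → 1ℚ * (x * detℚ (λ r s → B (suc r) (suc s)))) B₀₀≡1)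
           (sum-zero λ i → vanishing-entry (signℚ (suc (toℕ i))) (detℚ λ r s → B (punchIn (suc i) r) (suc s))
             (cleared i)) ⟩
    1ℚ * (1ℚ * detℚ (λ r s → B (suc r) (suc s))) + 0ℚ
      ≡⟨ solve 1 (λ x → con 1ℚ :* (con 1ℚ :* x) :+ con 0ℚ := x) refl (detℚ λ r s → B (suc r) (suc s)) ⟩
    detℚ (λ r s → B (suc r) (suc s))
      ≡⟨ detℚ-cong (λ i j → cong (A (suc i) (suc j) +_) (sym (ℚₚ.neg-distribˡ-* (A (suc i) zero) (A zero (suc j))))) ⟩
    detℚ (λ i j → A (suc i) (suc j) - A (suc i) zero * A zero (suc j)) ∎
    where
    c : Fin (suc n) → ℚ
    c zero    = 0ℚ
    c (suc i) = - A (suc i) zero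
    B : Matrixℚ (suc n)
    B k j = A k j + c k * A zero j
    rest : Fin n → ℚ
    rest i = signℚ (suc (toℕ i)) * (B (suc i) zero * detℚ (λ r s → B (punchIn (suc i) r) (suc s)))
    B₀₀≡1 : B zero zero ≡ 1ℚ
    B₀₀≡1 = trans (cong (A zero zero +_) (ℚₚ.*-zeroˡ (A zero zero))) (trans (ℚₚ.+-identityʳ (A zero zero)) A₀₀≡1)
    cleared : ∀ i → B (suc i) zero ≡ 0ℚ
    cleared i = trans (cong (λ x → A (suc i) zero + - A (suc i) zero * x) A₀₀≡1)
      (solve 1 (λ x → x :+ :- x :* con 1ℚ := con 0ℚ) refl (A (suc i) zero))

  punchIn-fromℕ : ∀ {n} (j : Fin (suc n)) → punchIn (inject₁ j) (fromℕ n) ≡ fromℕ (suc n)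
  punchIn-fromℕ {n}     zero    = refl
  punchIn-fromℕ {suc n} (suc j) = cong suc (punchIn-fromℕ j)

  punchIn-inject₁ : ∀ {n} (j : Fin (suc n)) (k : Fin n) →
    punchIn (inject₁ j) (inject₁ k) ≡ inject₁ (punchIn j k)
  punchIn-inject₁ zero    k       = refl
  punchIn-inject₁ (suc j) zero    = refl
  punchIn-inject₁ (suc j) (suc k) = cong suc (punchIn-inject₁ j k)

  -- Expansion along the first row suffices: the term of the last column vanishes, and every other
  -- minor again has a cleared last column with the same corner entry. No sign of the corner has to
  -- be tracked.
  clearedLastColumn : ∀ {n} (B : Matrixℚ (suc n)) → (∀ i → B (inject₁ i) (fromℕ n) ≡ 0ℚ) →
    detℚ B ≡ B (fromℕ n) (fromℕ n) * detℚ λ i j → B (inject₁ i) (inject₁ j)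
  clearedLastColumn {zero}  B clear =
    solve 1 (λ x → con 1ℚ :* (x :* con 1ℚ) :+ con 0ℚ := x :* con 1ℚ) refl (B zero zero)
  clearedLastColumn {suc n} B clear = begin
    sum term
      ≡⟨ sum-init-last term ⟩
    sum (λ j → term (inject₁ j)) + term l
      ≡⟨ cong₂ _+_ (sum-cong-≗ termwise) (vanishing-entry (signℚ (toℕ l)) (detℚ (minor B l)) (clear zero)) ⟩
    sum (λ j → B l l * front j) + 0ℚ
      ≡⟨ trans (ℚₚ.+-identityʳ (sum λ j → B l l * front j)) (sym (*-distribˡ-sum (B l l) front)) ⟩
    B l l * sum front ∎
    where
    l : Fin (suc (suc n))
    l = fromℕ (suc n)
    term : Fin (suc (suc n)) → ℚ
    term j = signℚ (toℕ j) * (B zero j * detℚ (minor B j))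
    A : Matrixℚ (suc n)
    A i j = B (inject₁ i) (inject₁ j)
    front : Fin (suc n) → ℚ
    front j = signℚ (toℕ j) * (A zero j * detℚ (minor A j))
    regroup : ∀ s b x d → s * (b * (x * d)) ≡ x * (s * (b * d))
    regroup = solve 4 (λ s b x d → s :* (b :* (x :* d)) := x :* (s :* (b :* d))) refl
    minor-det : ∀ j → detℚ (minor B (inject₁ j)) ≡ B l l * detℚ (minor A j)
    minor-det j = trans
      (clearedLastColumn (minor B (inject₁ j)) λ i →
        trans (cong (B (suc (inject₁ i))) (punchIn-fromℕ j)) (clear (suc i)))
      (cong₂ _*_ (cong (B l) (punchIn-fromℕ j))
        (detℚ-cong λ i k → cong (B (suc (inject₁ i))) (punchIn-inject₁ j k)))
    termwise : ∀ j → term (inject₁ j) ≡ B l l * front j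
    termwise j = trans
      (cong₂ (λ t d → signℚ t * (B zero (inject₁ j) * d)) (toℕ-inject₁ j) (minor-det j))
      (regroup (signℚ (toℕ j)) (B zero (inject₁ j)) (B l l) (detℚ (minor A j)))

  -- The Schur complement at the opposite corner, for a diagonal block that stands behind a 3 × 3
  -- block and is consumed from its end. The pivot comes with a number `π` certified as its inverse.
  pivot-last : ∀ {n} (A : Matrixℚ (suc n)) π → A (fromℕ n) (fromℕ n) * π ≡ 1ℚ →
    detℚ A ≡ A (fromℕ n) (fromℕ n) * detℚ λ i j →
      A (inject₁ i) (inject₁ j) - A (inject₁ i) (fromℕ n) * π * A (fromℕ n) (inject₁ j)
  pivot-last {n} A π Aₗₗπ≡1 = begin
    detℚ A
      ≡⟨ sym (detℚ-addMultiples l c A cₗ≡0) ⟩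
    detℚ B
      ≡⟨ clearedLastColumn B cleared ⟩
    B l l * detℚ (λ i j → B (inject₁ i) (inject₁ j))
      ≡⟨ cong₂ _*_ Bₗₗ (detℚ-cong λ i j → trans
           (cong (λ x → A (inject₁ i) (inject₁ j) + x * A l (inject₁ j)) (c-inject₁ i))
           (cong (A (inject₁ i) (inject₁ j) +_) (sym (ℚₚ.neg-distribˡ-* (A (inject₁ i) l * π) (A l (inject₁ j)))))) ⟩
    A l l * detℚ (λ i j → A (inject₁ i) (inject₁ j) - A (inject₁ i) l * π * A l (inject₁ j)) ∎
    where
    l : Fin (suc n)
    l = fromℕ n
    c : Fin (suc n) → ℚ
    c k with k ≟ l
    ... | yes _ = 0ℚ
    ... | no  _ = - (A k l * π)
    cₗ≡0 : c l ≡ 0ℚ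
    cₗ≡0 with l ≟ l
    ... | yes _   = refl
    ... | no  l≢l = contradiction refl l≢l
    c-inject₁ : ∀ i → c (inject₁ i) ≡ - (A (inject₁ i) l * π)
    c-inject₁ i with inject₁ i ≟ l
    ... | yes i≡l = contradiction (sym i≡l) fromℕ≢inject₁
    ... | no  _   = refl
    B : Matrixℚ (suc n)
    B k j = A k j + c k * A l j
    Bₗₗ : B l l ≡ A l l
    Bₗₗ = trans (cong (λ x → A l l + x * A l l) cₗ≡0)
      (trans (cong (A l l +_) (ℚₚ.*-zeroˡ (A l l))) (ℚₚ.+-identityʳ (A l l)))
    cleared : ∀ i → B (inject₁ i) l ≡ 0ℚ
    cleared i = begin
      A (inject₁ i) l + c (inject₁ i) * A l l
        ≡⟨ cong (λ x → A (inject₁ i) l + x * A l l) (c-inject₁ i) ⟩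
      A (inject₁ i) l + - (A (inject₁ i) l * π) * A l l
        ≡⟨ solve 3 (λ x π a → x :+ :- (x :* π) :* a := x :- x :* (a :* π)) refl (A (inject₁ i) l) π (A l l) ⟩
      A (inject₁ i) l - A (inject₁ i) l * (A l l * π)
        ≡⟨ cong (λ y → A (inject₁ i) l - A (inject₁ i) l * y) Aₗₗπ≡1 ⟩
      A (inject₁ i) l - A (inject₁ i) l * 1ℚ
        ≡⟨ solve 1 (λ x → x :- x :* con 1ℚ := con 0ℚ) refl (A (inject₁ i) l) ⟩
      0ℚ ∎

  -- Diagonal and bordered matrices, low-rank updates.

  diagonal : ∀ {n} → (Fin n → ℚ) → Matrixℚ n
  diagonal d zero    zero    = d zero
  diagonal d zero    (suc j) = 0ℚ
  diagonal d (suc i) zero    = 0ℚ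
  diagonal d (suc i) (suc j) = diagonal (d ∘ suc) i j

  diagonal-at : ∀ {n} (d : Fin n → ℚ) i → diagonal d i i ≡ d i
  diagonal-at d zero    = refl
  diagonal-at d (suc i) = diagonal-at (d ∘ suc) i

  diagonal-off : ∀ {n} (d : Fin n → ℚ) i j → i ≢ j → diagonal d i j ≡ 0ℚ
  diagonal-off d zero    zero    i≢j = contradiction refl i≢j
  diagonal-off d zero    (suc j) i≢j = refl
  diagonal-off d (suc i) zero    i≢j = refl
  diagonal-off d (suc i) (suc j) i≢j = diagonal-off (d ∘ suc) i j (i≢j ∘ cong suc)

  diagonal-inject₁ : ∀ {n} (d : Fin (suc n) → ℚ) i j →
    diagonal d (inject₁ i) (inject₁ j) ≡ diagonal (d ∘ inject₁) i j
  diagonal-inject₁ d zero    zero    = refl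
  diagonal-inject₁ d zero    (suc j) = refl
  diagonal-inject₁ d (suc i) zero    = refl
  diagonal-inject₁ d (suc i) (suc j) = diagonal-inject₁ (d ∘ suc) i j

  diagonal-last-column : ∀ {n} (d : Fin (suc n) → ℚ) i → diagonal d (inject₁ i) (fromℕ n) ≡ 0ℚ
  diagonal-last-column d zero    = refl
  diagonal-last-column d (suc i) = diagonal-last-column (d ∘ suc) i

  diagonal-last-row : ∀ {n} (d : Fin (suc n) → ℚ) j → diagonal d (fromℕ n) (inject₁ j) ≡ 0ℚ
  diagonal-last-row d zero    = refl
  diagonal-last-row d (suc j) = diagonal-last-row (d ∘ suc) j

  identity : ∀ {n} → Matrixℚ n
  identity = diagonal λ _ → 1ℚ

  -- The bordered matrix [[H, -V], [U, E]]. The sign of `V` turns both of its Schur complements into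
  -- sums.
  module Block {q n : ℕ} (H : Matrixℚ q) (V : Fin q → Fin n → ℚ) (U : Fin n → Fin q → ℚ)
               (E : Matrixℚ n) where
    entry : Fin q ⊎ Fin n → Fin q ⊎ Fin n → ℚ
    entry (inj₁ s) (inj₁ t) = H s t
    entry (inj₁ s) (inj₂ j) = - V s j
    entry (inj₂ i) (inj₁ t) = U i t
    entry (inj₂ i) (inj₂ j) = E i j

    block : Matrixℚ (q ℕ.+ n)
    block i j = entry (splitAt q i) (splitAt q j)

  open Block using (entry; block)

  -- Removing one leading 1 moves one rank-one piece of U V into `E`.
  eliminate-identity-block : ∀ q {n} (V : Fin q → Fin n → ℚ) (U : Fin n → Fin q → ℚ) (E : Matrixℚ n) →
    detℚ (block identity V U E) ≡ detℚ λ i j → E i j + sum λ s → U i s * V s j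
  eliminate-identity-block zero V U E = detℚ-cong λ i j → sym (ℚₚ.+-identityʳ (E i j))
  eliminate-identity-block (suc q) {n} V U E = begin
    detℚ A
      ≡⟨ pivot-first A refl ⟩
    detℚ (λ i j → A (suc i) (suc j) - A (suc i) zero * A zero (suc j))
      ≡⟨ detℚ-cong (λ i j → entries (splitAt q i) (splitAt q j)) ⟩
    detℚ (block identity V′ U′ E′)
      ≡⟨ eliminate-identity-block q V′ U′ E′ ⟩
    detℚ (λ i j → E′ i j + sum λ s → U′ i s * V′ s j)
      ≡⟨ detℚ-cong (λ i j → ℚₚ.+-assoc (E i j) (U i zero * V zero j) (sum λ s → U′ i s * V′ s j)) ⟩
    detℚ (λ i j → E i j + sum λ s → U i s * V s j) ∎
    where
    A : Matrixℚ (suc q ℕ.+ n)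
    A = block identity V U E
    V′ : Fin q → Fin n → ℚ
    V′ s j = V (suc s) j
    U′ : Fin n → Fin q → ℚ
    U′ i s = U i (suc s)
    E′ : Matrixℚ n
    E′ i j = E i j + U i zero * V zero j
    entry⁺ : Fin (suc q) ⊎ Fin n → Fin (suc q) ⊎ Fin n → ℚ
    entry⁺ = entry identity V U E
    shift : Fin q ⊎ Fin n → Fin (suc q) ⊎ Fin n
    shift = Sum.map₁ suc
    entries : ∀ x y →
      entry⁺ (shift x) (shift y) - entry⁺ (shift x) (inj₁ zero) * entry⁺ (inj₁ zero) (shift y) ≡
      entry identity V′ U′ E′ x y
    entries (inj₁ s) (inj₁ t) =
      solve 1 (λ x → x :- con 0ℚ :* con 0ℚ := x) refl (identity s t)
    entries (inj₁ s) (inj₂ j) =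
      solve 2 (λ x y → :- x :- con 0ℚ :* y := :- x) refl (V (suc s) j) (- V zero j)
    entries (inj₂ i) (inj₁ t) =
      solve 2 (λ x y → x :- y :* con 0ℚ := x) refl (U i (suc t)) (U i zero)
    entries (inj₂ i) (inj₂ j) =
      solve 3 (λ e u v → e :- u :* (:- v) := e :+ u :* v) refl (E i j) (U i zero) (V zero j)

  -- Removing the last diagonal entry splits off one factor of the product and moves one rank-one
  -- piece of V D⁻¹ U into `H`.
  eliminate-diagonal-block : ∀ {n} (H : Matrixℚ 3) (V : Fin 3 → Fin n → ℚ) (U : Fin n → Fin 3 → ℚ)
    (d π : Fin n → ℚ) → (∀ i → d i * π i ≡ 1ℚ) →
    detℚ (block H V U (diagonal d)) ≡
    product d * detℚ λ s t → H s t + sum λ i → V s i * π i * U i t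
  eliminate-diagonal-block {zero} H V U d π dπ≡1 =
    trans (detℚ-cong entries) (sym (ℚₚ.*-identityˡ (detℚ λ s t → H s t + 0ℚ)))
    where
    entries : ∀ i j → block H V U (diagonal d) i j ≡ H i j + 0ℚ
    entries i j = trans (cong₂ (entry H V U (diagonal d)) (front i) (front j)) (sym (ℚₚ.+-identityʳ (H i j)))
      where
      front : (i : Fin 3) → splitAt 3 {0} i ≡ inj₁ i
      front zero             = refl
      front (suc zero)       = refl
      front (suc (suc zero)) = refl
  eliminate-diagonal-block {suc n} H V U d π dπ≡1 = begin
    detℚ A
      ≡⟨ pivot-last A (π l) (trans (cong (_* π l) (diagonal-at d l)) (dπ≡1 l)) ⟩
    diagonal d l l * detℚ (λ i j →
      A (inject₁ i) (inject₁ j) - A (inject₁ i) l′ * π l * A l′ (inject₁ j))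
      ≡⟨ cong₂ _*_ (diagonal-at d l) (detℚ-cong λ i j → trans
           (cong₂ reduced (splitAt-inject₁ i) (splitAt-inject₁ j))
           (entries (splitAt 3 i) (splitAt 3 j))) ⟩
    d l * detℚ (block H′ V′ U′ (diagonal d′))
      ≡⟨ cong (d l *_) (eliminate-diagonal-block H′ V′ U′ d′ (π ∘ inject₁) (dπ≡1 ∘ inject₁)) ⟩
    d l * (product d′ * detℚ λ s t → H′ s t + sum λ i → summand s t (inject₁ i))
      ≡⟨ sym (ℚₚ.*-assoc (d l) (product d′) _) ⟩
    d l * product d′ * detℚ (λ s t → H′ s t + sum λ i → summand s t (inject₁ i))
      ≡⟨ cong₂ _*_ (trans (ℚₚ.*-comm (d l) (product d′)) (sym (product-init-last d)))
           (detℚ-cong λ s t → collect (H s t) (summand s t)) ⟩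
    product d * detℚ (λ s t → H s t + sum (summand s t)) ∎
    where
    l : Fin (suc n)
    l = fromℕ n
    l′ : Fin (suc (3 ℕ.+ n))
    l′ = fromℕ (3 ℕ.+ n)
    A : Matrixℚ (suc (3 ℕ.+ n))
    A = block H V U (diagonal d)
    summand : Fin 3 → Fin 3 → Fin (suc n) → ℚ
    summand s t i = V s i * π i * U i t
    H′ : Matrixℚ 3
    H′ s t = H s t + summand s t l
    V′ : Fin 3 → Fin n → ℚ
    V′ s j = V s (inject₁ j)
    U′ : Fin n → Fin 3 → ℚ
    U′ i s = U (inject₁ i) s
    d′ : Fin n → ℚ
    d′ = d ∘ inject₁
    splitAt-inject₁ : ∀ {n} (i : Fin (3 ℕ.+ n)) → splitAt 3 (inject₁ i) ≡ Sum.map₂ inject₁ (splitAt 3 i)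
    splitAt-inject₁ zero                = refl
    splitAt-inject₁ (suc zero)          = refl
    splitAt-inject₁ (suc (suc zero))    = refl
    splitAt-inject₁ (suc (suc (suc i))) = refl
    entry⁺ : Fin 3 ⊎ Fin (suc n) → Fin 3 ⊎ Fin (suc n) → ℚ
    entry⁺ = entry H V U (diagonal d)
    reduced : Fin 3 ⊎ Fin (suc n) → Fin 3 ⊎ Fin (suc n) → ℚ
    reduced x y = entry⁺ x y - entry⁺ x (inj₂ l) * π l * entry⁺ (inj₂ l) y
    collect : ∀ h (f : Fin (suc n) → ℚ) → h + f l + sum (f ∘ inject₁) ≡ h + sum f
    collect h f = trans (ℚₚ.+-assoc h (f l) (sum (f ∘ inject₁)))
      (cong (h +_) (trans (ℚₚ.+-comm (f l) (sum (f ∘ inject₁))) (sym (sum-init-last f))))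
    vanishˡ : ∀ x y z {w} → w ≡ 0ℚ → x - w * y * z ≡ x
    vanishˡ x y z refl = solve 3 (λ x y z → x :- con 0ℚ :* y :* z := x) refl x y z
    vanishʳ : ∀ x y z {w} → w ≡ 0ℚ → x - y * z * w ≡ x
    vanishʳ x y z refl = solve 3 (λ x y z → x :- y :* z :* con 0ℚ := x) refl x y z
    entries : ∀ x y → reduced (Sum.map₂ inject₁ x) (Sum.map₂ inject₁ y) ≡ entry H′ V′ U′ (diagonal d′) x y
    entries (inj₁ s) (inj₁ t) =
      solve 4 (λ h v p u → h :- (:- v) :* p :* u := h :+ v :* p :* u) refl (H s t) (V s l) (π l) (U l t)
    entries (inj₁ s) (inj₂ j) = vanishʳ (- V s (inject₁ j)) (- V s l) (π l) (diagonal-last-row d j)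
    entries (inj₂ i) (inj₁ t) = vanishˡ (U (inject₁ i) t) (π l) (U l t) (diagonal-last-column d i)
    entries (inj₂ i) (inj₂ j) = trans
      (vanishˡ (diagonal d (inject₁ i) (inject₁ j)) (π l) (diagonal d l (inject₁ j)) (diagonal-last-column d i))
      (diagonal-inject₁ d i j)

  -- Both sides are the determinant of the bordered matrix [[I, -V], [U, D]]: the
  -- left one eliminates the identity block, the right one the diagonal block.
  detℚ-lowRankUpdate : ∀ {n} (V : Fin 3 → Fin n → ℚ) (U : Fin n → Fin 3 → ℚ) (d π : Fin n → ℚ) →
    (∀ i → d i * π i ≡ 1ℚ) →
    detℚ (λ i j → diagonal d i j + sum λ s → U i s * V s j) ≡
    product d * detℚ λ s t → identity s t + sum λ i → V s i * π i * U i t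
  detℚ-lowRankUpdate V U d π dπ≡1 = trans
    (sym (eliminate-identity-block 3 V U (diagonal d)))
    (eliminate-diagonal-block identity V U d π dπ≡1)

  -- Matrices with two vertex classes and a distinguished set

  ι : ℕ → ℚ
  ι n = ℤ.+ n / 1

  /1-+ : ∀ i j → (i ℤ.+ j) / 1 ≡ i / 1 + j / 1
  /1-+ i j = ℚₚ.toℚᵘ-injective (ℚᵘₚ.≃-trans (ℚₚ.toℚᵘ-fromℚᵘ (ℚᵘ.mkℚᵘ (i ℤ.+ j) 0))
    (ℚᵘₚ.≃-trans (ℚᵘ.*≡* (cong (ℤ._* ℤ.1ℤ) (cong₂ ℤ._+_ (sym (ℤₚ.*-identityʳ i)) (sym (ℤₚ.*-identityʳ j)))))
    (ℚᵘₚ.≃-trans (ℚᵘₚ.+-cong (ℚᵘₚ.≃-sym (ℚₚ.toℚᵘ-fromℚᵘ (ℚᵘ.mkℚᵘ i 0))) (ℚᵘₚ.≃-sym (ℚₚ.toℚᵘ-fromℚᵘ (ℚᵘ.mkℚᵘ j 0))))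
      (ℚᵘₚ.≃-sym (ℚₚ.toℚᵘ-homo-+ (i / 1) (j / 1))))))

  /1-* : ∀ i j → (i ℤ.* j) / 1 ≡ i / 1 * (j / 1)
  /1-* i j = ℚₚ.toℚᵘ-injective (ℚᵘₚ.≃-trans (ℚₚ.toℚᵘ-fromℚᵘ (ℚᵘ.mkℚᵘ (i ℤ.* j) 0))
    (ℚᵘₚ.≃-trans (ℚᵘₚ.*-cong (ℚᵘₚ.≃-sym (ℚₚ.toℚᵘ-fromℚᵘ (ℚᵘ.mkℚᵘ i 0))) (ℚᵘₚ.≃-sym (ℚₚ.toℚᵘ-fromℚᵘ (ℚᵘ.mkℚᵘ j 0))))
      (ℚᵘₚ.≃-sym (ℚₚ.toℚᵘ-homo-* (i / 1) (j / 1)))))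

  ι-+ : ∀ m n → ι (m ℕ.+ n) ≡ ι m + ι n
  ι-+ m n = /1-+ (ℤ.+ m) (ℤ.+ n)

  ι-* : ∀ m n → ι (m ℕ.* n) ≡ ι m * ι n
  ι-* m n = trans (cong (_/ 1) (ℤₚ.pos-* m n)) (/1-* (ℤ.+ m) (ℤ.+ n))

  ι-suc : ∀ n → ι (suc n) ≡ 1ℚ + ι n
  ι-suc n = ι-+ 1 n

  infixr 8 _^_
  _^_ : ℚ → ℕ → ℚ
  x ^ zero  = 1ℚ
  x ^ suc n = x * x ^ n

  ones zeros : ∀ {n} → (Fin n → Bool) → ℕ
  ones {zero}  b = 0
  ones {suc n} b = (if b zero then 1 else 0) ℕ.+ ones (b ∘ suc)
  zeros {zero}  b = 0
  zeros {suc n} b = (if b zero then 0 else 1) ℕ.+ zeros (b ∘ suc)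

  zeros+ones : ∀ {n} (b : Fin n → Bool) → zeros b ℕ.+ ones b ≡ n
  zeros+ones {zero}  b = refl
  zeros+ones {suc n} b with b zero
  ... | true  = trans (ℕₚ.+-suc _ _) (cong suc (zeros+ones (b ∘ suc)))
  ... | false = cong suc (zeros+ones (b ∘ suc))

  sum-two-valued : ∀ {n} (b : Fin n → Bool) (g : Bool → ℚ) →
    sum (g ∘ b) ≡ ι (zeros b) * g false + ι (ones b) * g true
  sum-two-valued {zero} b g = solve 2 (λ x y → con 0ℚ := con 0ℚ :* x :+ con 0ℚ :* y) refl (g false) (g true)
  sum-two-valued {suc n} b g with b zero
  ... | true  = trans (cong (g true +_) (sum-two-valued (b ∘ suc) g))
    (trans (solve 4 (λ x y k l → y :+ (k :* x :+ l :* y) := k :* x :+ (con 1ℚ :+ l) :* y) refl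
              (g false) (g true) (ι (zeros (b ∘ suc))) (ι (ones (b ∘ suc))))
           (cong (λ z → ι (zeros (b ∘ suc)) * g false + z * g true) (sym (ι-suc (ones (b ∘ suc))))))
  ... | false = trans (cong (g false +_) (sum-two-valued (b ∘ suc) g))
    (trans (solve 4 (λ x y k l → x :+ (k :* x :+ l :* y) := (con 1ℚ :+ k) :* x :+ l :* y) refl
              (g false) (g true) (ι (zeros (b ∘ suc))) (ι (ones (b ∘ suc))))
           (cong (λ z → z * g false + ι (ones (b ∘ suc)) * g true) (sym (ι-suc (zeros (b ∘ suc))))))

  product-two-valued : ∀ {n} (b : Fin n → Bool) (g : Bool → ℚ) →
    product (g ∘ b) ≡ g false ^ zeros b * g true ^ ones b
  product-two-valued {zero}  b g = refl
  product-two-valued {suc n} b g with b zero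
  ... | true  = trans (cong (g true *_) (product-two-valued (b ∘ suc) g))
    (solve 3 (λ y k l → y :* (k :* l) := k :* (y :* l)) refl (g true) (g false ^ zeros (b ∘ suc)) (g true ^ ones (b ∘ suc)))
  ... | false = trans (cong (g false *_) (product-two-valued (b ∘ suc) g))
    (sym (ℚₚ.*-assoc (g false) (g false ^ zeros (b ∘ suc)) (g true ^ ones (b ∘ suc))))

  sum-↑ : ∀ m {n} (f : Fin (m ℕ.+ n) → ℚ) → sum f ≡ sum (λ i → f (i ↑ˡ n)) + sum (λ j → f (m ↑ʳ j))
  sum-↑ zero    f = sym (ℚₚ.+-identityˡ (sum f))
  sum-↑ (suc m) {n} f = trans (cong (f zero +_) (sum-↑ m (f ∘ suc)))
    (sym (ℚₚ.+-assoc (f zero) (sum λ i → f (suc i ↑ˡ n)) (sum λ j → f (suc m ↑ʳ j))))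

  product-↑ : ∀ m {n} (f : Fin (m ℕ.+ n) → ℚ) →
    product f ≡ product (λ i → f (i ↑ˡ n)) * product (λ j → f (m ↑ʳ j))
  product-↑ zero    f = sym (ℚₚ.*-identityˡ (product f))
  product-↑ (suc m) {n} f = trans (cong (f zero *_) (product-↑ m (f ∘ suc)))
    (sym (ℚₚ.*-assoc (f zero) (product λ i → f (suc i ↑ˡ n)) (product λ j → f (suc m ↑ʳ j))))

  bit : Bool → ℚ
  bit true  = 1ℚ
  bit false = 0ℚ

  2ℚ : ℚ
  2ℚ = 1ℚ + 1ℚ

  detℚ₃ : (A : Matrixℚ 3) → detℚ A ≡
    A 0F 0F * (A 1F 1F * A 2F 2F - A 1F 2F * A 2F 1F)
    - A 0F 1F * (A 1F 0F * A 2F 2F - A 1F 2F * A 2F 0F)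
    + A 0F 2F * (A 1F 0F * A 2F 1F - A 1F 1F * A 2F 0F)
  detℚ₃ A = solve 9 (λ a b c d e f g h i →
      let minor₁ = λ x → con 1ℚ :* (x :* con 1ℚ) :+ con 0ℚ
          minor₂ = λ x y z t → con 1ℚ :* (x :* minor₁ t) :+ (con (- 1ℚ) :* (y :* minor₁ z) :+ con 0ℚ)
      in con 1ℚ :* (a :* minor₂ e f h i) :+ (con (- 1ℚ) :* (b :* minor₂ d f g i) :+
           (con 1ℚ :* (c :* minor₂ d e g h) :+ con 0ℚ))
         := a :* (e :* i :- f :* h) :- b :* (d :* i :- f :* g) :+ c :* (d :* h :- e :* g))
    refl (A 0F 0F) (A 0F 1F) (A 0F 2F) (A 1F 0F) (A 1F 1F) (A 1F 2F) (A 2F 0F) (A 2F 1F) (A 2F 2F)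

  -- Solver expressions for the entries of the reduced matrix: `z₁`, `o₁` count the vertices of V₁
  -- outside and inside the distinguished set, `z₂`, `o₂` those of V₂, and `u`, `u′`, `v`, `v′` are
  -- the inverses of the four diagonal values up to sign.
  module _ {k : ℕ} (p r w z₁ o₁ z₂ o₂ u u′ v v′ : Polynomial k) where
    private
      columnₚ rowₚ : (x₁ x₂ x₃ : Polynomial k) → Fin 3 → Polynomial k
      columnₚ x₁ x₂ x₃ 0F = p :* x₁ :+ w :* x₂
      columnₚ x₁ x₂ x₃ 1F = w :* x₁ :+ r :* x₂
      columnₚ x₁ x₂ x₃ 2F = :- (con 2ℚ :* x₃)
      rowₚ x₁ x₂ x₃ 0F = x₁
      rowₚ x₁ x₂ x₃ 1F = x₂
      rowₚ x₁ x₂ x₃ 2F = x₃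
      termₚ : (x₁ x₂ x₃ u : Polynomial k) (s t : Fin 3) → Polynomial k
      termₚ x₁ x₂ x₃ u s t = columnₚ x₁ x₂ x₃ s :* (:- u) :* rowₚ x₁ x₂ x₃ t

    entryₚ : Polynomial k → Fin 3 → Fin 3 → Polynomial k
    entryₚ δ s t = δ :+ (z₁ :* termₚ (con 1ℚ) (con 0ℚ) (con 0ℚ) u s t :+ o₁ :* termₚ (con 1ℚ) (con 0ℚ) (con 1ℚ) u′ s t :+
      (z₂ :* termₚ (con 0ℚ) (con 1ℚ) (con 0ℚ) v s t :+ o₂ :* termₚ (con 0ℚ) (con 1ℚ) (con 1ℚ) v′ s t))

  -- The 3 × 3 determinant left after eliminating the diagonal.  Here k₁, k₂ are the
  -- sums of 1 / (y + p), 1 / (y + r) over the vertices of V₁, V₂ outside the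
  -- distinguished set, g₁, g₂ those of 1 / (y + p - 2), 1 / (y + r - 2) inside it.
  reducedDet : (p r w k₁ g₁ k₂ g₂ : ℚ) → ℚ
  reducedDet p r w k₁ g₁ k₂ g₂ =
    a₁₁ * (a₂₂ * a₃₃ - a₂₃ * a₃₂) - a₁₂ * (a₂₁ * a₃₃ - a₂₃ * a₃₁) + a₁₃ * (a₂₁ * a₃₂ - a₂₂ * a₃₁)
    where
    a₁₁ = 1ℚ - p * (k₁ + g₁)
    a₁₂ = - (w * (k₂ + g₂))
    a₁₃ = - (p * g₁ + w * g₂)
    a₂₁ = - (w * (k₁ + g₁))
    a₂₂ = 1ℚ - r * (k₂ + g₂)
    a₂₃ = - (w * g₁ + r * g₂)
    a₃₁ = g₁ + g₁
    a₃₂ = g₂ + g₂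
    a₃₃ = 1ℚ + (a₃₁ + a₃₂)

  -- Up to sign and the diagonal, lowRank is the Seidel matrix of the hypergraph with
  -- the edge e deleted, and of the complete hypergraph when e is empty; its rank-one
  -- pieces belong to V₁, V₂ and e.
  module TypedMatrix (m n : ℕ) (e : Subset (m ℕ.+ n)) (p r w : ℚ) where

    l₁ l₂ ε : Fin (m ℕ.+ n) → ℚ
    l₁ i = [ const 1ℚ , const 0ℚ ]′ (splitAt m i)
    l₂ i = [ const 0ℚ , const 1ℚ ]′ (splitAt m i)
    ε i = bit (lookup e i)

    rows : Fin (m ℕ.+ n) → Fin 3 → ℚ
    rows i 0F = l₁ i
    rows i 1F = l₂ i
    rows i 2F = ε i

    -- The coefficients p, w, r between the class indicators and the -2 of the deleted edge are
    -- absorbed here, so that the row factors are plain indicators.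
    columns : Fin 3 → Fin (m ℕ.+ n) → ℚ
    columns 0F j = p * l₁ j + w * l₂ j
    columns 1F j = w * l₁ j + r * l₂ j
    columns 2F j = - (2ℚ * ε j)

    lowRank : Matrixℚ (m ℕ.+ n)
    lowRank i j = sum λ s → rows i s * columns s j

    e₁ : Fin m → Bool
    e₁ i = lookup e (i ↑ˡ n)

    e₂ : Fin n → Bool
    e₂ j = lookup e (m ↑ʳ j)

    module _ (y : ℚ) where
      -- On the diagonal `lowRank` equals `p` on V₁ and `r` on V₂, lowered by 2 inside `e`. To leave
      -- -y there, the diagonal part has to be minus one of these four values.
      P P′ R R′ : ℚ
      P  = y + p
      P′ = y + p - 2ℚ
      R  = y + r
      R′ = y + r - 2ℚ

      pick : ∀ {A : Set} → A → A → A → A → Fin (m ℕ.+ n) → A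
      pick a a′ b b′ i = [ const (if lookup e i then a′ else a) , const (if lookup e i then b′ else b) ]′ (splitAt m i)

      shifted : Fin (m ℕ.+ n) → ℚ
      shifted = pick P P′ R R′

      product-shifted : product shifted ≡
        P ^ zeros e₁ * P′ ^ ones e₁ * (R ^ zeros e₂ * R′ ^ ones e₂)
      product-shifted = trans (product-↑ m shifted) (cong₂ _*_
        (trans (product-cong λ i → cong [ const (if e₁ i then P′ else P) , const (if e₁ i then R′ else R) ]′ (splitAt-↑ˡ m i n))
          (product-two-valued e₁ λ b → if b then P′ else P))
        (trans (product-cong λ j → cong [ const (if e₂ j then P′ else P) , const (if e₂ j then R′ else R) ]′ (splitAt-↑ʳ m n j))
          (product-two-valued e₂ λ b → if b then R′ else R)))

      diagonal-entry : ∀ i → - y ≡ - shifted i + lowRank i i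
      diagonal-entry i with splitAt m i | lookup e i
      ... | inj₁ _ | true  = solve 4 (λ y p r w → :- y := :- (y :+ p :- con 2ℚ) :+ (con 1ℚ :* (p :* con 1ℚ :+ w :* con 0ℚ) :+
              (con 0ℚ :* (w :* con 1ℚ :+ r :* con 0ℚ) :+ (con 1ℚ :* (:- (con 2ℚ :* con 1ℚ)) :+ con 0ℚ)))) refl y p r w
      ... | inj₁ _ | false = solve 4 (λ y p r w → :- y := :- (y :+ p) :+ (con 1ℚ :* (p :* con 1ℚ :+ w :* con 0ℚ) :+
              (con 0ℚ :* (w :* con 1ℚ :+ r :* con 0ℚ) :+ (con 0ℚ :* (:- (con 2ℚ :* con 0ℚ)) :+ con 0ℚ)))) refl y p r w
      ... | inj₂ _ | true  = solve 4 (λ y p r w → :- y := :- (y :+ r :- con 2ℚ) :+ (con 0ℚ :* (p :* con 0ℚ :+ w :* con 1ℚ) :+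
              (con 1ℚ :* (w :* con 0ℚ :+ r :* con 1ℚ) :+ (con 1ℚ :* (:- (con 2ℚ :* con 1ℚ)) :+ con 0ℚ)))) refl y p r w
      ... | inj₂ _ | false = solve 4 (λ y p r w → :- y := :- (y :+ r) :+ (con 0ℚ :* (p :* con 0ℚ :+ w :* con 1ℚ) :+
              (con 1ℚ :* (w :* con 0ℚ :+ r :* con 1ℚ) :+ (con 0ℚ :* (:- (con 2ℚ :* con 0ℚ)) :+ con 0ℚ)))) refl y p r w

      module _ (u u′ v v′ : ℚ) (Pu : P * u ≡ 1ℚ) (P′u′ : P′ * u′ ≡ 1ℚ) (Rv : R * v ≡ 1ℚ) (R′v′ : R′ * v′ ≡ 1ℚ) where

        inverses : Fin (m ℕ.+ n) → ℚ
        inverses = pick u u′ v v′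

        shifted-inverse : ∀ i → (- shifted i) * (- inverses i) ≡ 1ℚ
        shifted-inverse i = trans (solve 2 (λ x y → (:- x) :* (:- y) := x :* y) refl (shifted i) (inverses i)) (go i)
          where
          go : ∀ i → shifted i * inverses i ≡ 1ℚ
          go i with splitAt m i | lookup e i
          ... | inj₁ _ | true  = P′u′
          ... | inj₁ _ | false = Pu
          ... | inj₂ _ | true  = R′v′
          ... | inj₂ _ | false = Rv

        k₁ g₁ k₂ g₂ : ℚ
        k₁ = ι (zeros e₁) * u
        g₁ = ι (ones e₁) * u′
        k₂ = ι (zeros e₂) * v
        g₂ = ι (ones e₂) * v′

        summand : Fin 3 → Fin 3 → Fin (m ℕ.+ n) → ℚ
        summand s t i = columns s i * (- inverses i) * rows i t

        columnAt : (x₁ x₂ x₃ : ℚ) → Fin 3 → ℚ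
        columnAt x₁ x₂ x₃ 0F = p * x₁ + w * x₂
        columnAt x₁ x₂ x₃ 1F = w * x₁ + r * x₂
        columnAt x₁ x₂ x₃ 2F = - (2ℚ * x₃)

        rowAt : (x₁ x₂ x₃ : ℚ) → Fin 3 → ℚ
        rowAt x₁ x₂ x₃ 0F = x₁
        rowAt x₁ x₂ x₃ 1F = x₂
        rowAt x₁ x₂ x₃ 2F = x₃

        leftValue rightValue : Fin 3 → Fin 3 → Bool → ℚ
        leftValue  s t b = columnAt 1ℚ 0ℚ (bit b) s * (- (if b then u′ else u)) * rowAt 1ℚ 0ℚ (bit b) t
        rightValue s t b = columnAt 0ℚ 1ℚ (bit b) s * (- (if b then v′ else v)) * rowAt 0ℚ 1ℚ (bit b) t

        columns-at : ∀ s i → columns s i ≡ columnAt (l₁ i) (l₂ i) (ε i) s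
        columns-at 0F i = refl
        columns-at 1F i = refl
        columns-at 2F i = refl

        rows-at : ∀ i t → rows i t ≡ rowAt (l₁ i) (l₂ i) (ε i) t
        rows-at i 0F = refl
        rows-at i 1F = refl
        rows-at i 2F = refl

        summand-at : ∀ s t i → summand s t i ≡ [ const (leftValue s t (lookup e i)) , const (rightValue s t (lookup e i)) ]′ (splitAt m i)
        summand-at s t i rewrite columns-at s i | rows-at i t with splitAt m i
        ... | inj₁ _ = refl
        ... | inj₂ _ = refl

        -- A summand depends only on the class of the vertex and on its membership in `e`, so it
        -- takes at most four values.
        sum-summand : ∀ s t → sum (summand s t) ≡
          ι (zeros e₁) * leftValue s t false + ι (ones e₁) * leftValue s t true +
          (ι (zeros e₂) * rightValue s t false + ι (ones e₂) * rightValue s t true)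
        sum-summand s t = trans (sum-↑ m (summand s t)) (cong₂ _+_
          (trans (sum-cong-≗ λ i → trans (summand-at s t (i ↑ˡ n))
              (cong [ const (leftValue s t (e₁ i)) , const (rightValue s t (e₁ i)) ]′ (splitAt-↑ˡ m i n)))
            (sum-two-valued e₁ (leftValue s t)))
          (trans (sum-cong-≗ λ j → trans (summand-at s t (m ↑ʳ j))
              (cong [ const (leftValue s t (e₂ j)) , const (rightValue s t (e₂ j)) ]′ (splitAt-↑ʳ m n j)))
            (sum-two-valued e₂ (rightValue s t))))

        reducedMatrix : Matrixℚ 3
        reducedMatrix 0F 0F = 1ℚ - p * (k₁ + g₁)
        reducedMatrix 0F 1F = - (w * (k₂ + g₂))
        reducedMatrix 0F 2F = - (p * g₁ + w * g₂)
        reducedMatrix 1F 0F = - (w * (k₁ + g₁))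
        reducedMatrix 1F 1F = 1ℚ - r * (k₂ + g₂)
        reducedMatrix 1F 2F = - (w * g₁ + r * g₂)
        reducedMatrix 2F 0F = g₁ + g₁
        reducedMatrix 2F 1F = g₂ + g₂
        reducedMatrix 2F 2F = 1ℚ + ((g₁ + g₁) + (g₂ + g₂))

        reduced-entry : ∀ s t → identity s t + sum (summand s t) ≡ reducedMatrix s t
        reduced-entry 0F 0F = trans (cong (1ℚ +_) (sum-summand 0F 0F)) (solve 11 (λ p r w z₁ o₁ z₂ o₂ u u′ v v′ →
          entryₚ p r w z₁ o₁ z₂ o₂ u u′ v v′ (con 1ℚ) 0F 0F := con 1ℚ :- p :* (z₁ :* u :+ o₁ :* u′))
          refl p r w (ι (zeros e₁)) (ι (ones e₁)) (ι (zeros e₂)) (ι (ones e₂)) u u′ v v′)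
        reduced-entry 0F 1F = trans (cong (0ℚ +_) (sum-summand 0F 1F)) (solve 11 (λ p r w z₁ o₁ z₂ o₂ u u′ v v′ →
          entryₚ p r w z₁ o₁ z₂ o₂ u u′ v v′ (con 0ℚ) 0F 1F := :- (w :* (z₂ :* v :+ o₂ :* v′)))
          refl p r w (ι (zeros e₁)) (ι (ones e₁)) (ι (zeros e₂)) (ι (ones e₂)) u u′ v v′)
        reduced-entry 0F 2F = trans (cong (0ℚ +_) (sum-summand 0F 2F)) (solve 11 (λ p r w z₁ o₁ z₂ o₂ u u′ v v′ →
          entryₚ p r w z₁ o₁ z₂ o₂ u u′ v v′ (con 0ℚ) 0F 2F := :- (p :* (o₁ :* u′) :+ w :* (o₂ :* v′)))
          refl p r w (ι (zeros e₁)) (ι (ones e₁)) (ι (zeros e₂)) (ι (ones e₂)) u u′ v v′)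
        reduced-entry 1F 0F = trans (cong (0ℚ +_) (sum-summand 1F 0F)) (solve 11 (λ p r w z₁ o₁ z₂ o₂ u u′ v v′ →
          entryₚ p r w z₁ o₁ z₂ o₂ u u′ v v′ (con 0ℚ) 1F 0F := :- (w :* (z₁ :* u :+ o₁ :* u′)))
          refl p r w (ι (zeros e₁)) (ι (ones e₁)) (ι (zeros e₂)) (ι (ones e₂)) u u′ v v′)
        reduced-entry 1F 1F = trans (cong (1ℚ +_) (sum-summand 1F 1F)) (solve 11 (λ p r w z₁ o₁ z₂ o₂ u u′ v v′ →
          entryₚ p r w z₁ o₁ z₂ o₂ u u′ v v′ (con 1ℚ) 1F 1F := con 1ℚ :- r :* (z₂ :* v :+ o₂ :* v′))
          refl p r w (ι (zeros e₁)) (ι (ones e₁)) (ι (zeros e₂)) (ι (ones e₂)) u u′ v v′)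
        reduced-entry 1F 2F = trans (cong (0ℚ +_) (sum-summand 1F 2F)) (solve 11 (λ p r w z₁ o₁ z₂ o₂ u u′ v v′ →
          entryₚ p r w z₁ o₁ z₂ o₂ u u′ v v′ (con 0ℚ) 1F 2F := :- (w :* (o₁ :* u′) :+ r :* (o₂ :* v′)))
          refl p r w (ι (zeros e₁)) (ι (ones e₁)) (ι (zeros e₂)) (ι (ones e₂)) u u′ v v′)
        reduced-entry 2F 0F = trans (cong (0ℚ +_) (sum-summand 2F 0F)) (solve 11 (λ p r w z₁ o₁ z₂ o₂ u u′ v v′ →
          entryₚ p r w z₁ o₁ z₂ o₂ u u′ v v′ (con 0ℚ) 2F 0F := o₁ :* u′ :+ o₁ :* u′)
          refl p r w (ι (zeros e₁)) (ι (ones e₁)) (ι (zeros e₂)) (ι (ones e₂)) u u′ v v′)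
        reduced-entry 2F 1F = trans (cong (0ℚ +_) (sum-summand 2F 1F)) (solve 11 (λ p r w z₁ o₁ z₂ o₂ u u′ v v′ →
          entryₚ p r w z₁ o₁ z₂ o₂ u u′ v v′ (con 0ℚ) 2F 1F := o₂ :* v′ :+ o₂ :* v′)
          refl p r w (ι (zeros e₁)) (ι (ones e₁)) (ι (zeros e₂)) (ι (ones e₂)) u u′ v v′)
        reduced-entry 2F 2F = trans (cong (1ℚ +_) (sum-summand 2F 2F)) (solve 11 (λ p r w z₁ o₁ z₂ o₂ u u′ v v′ →
          entryₚ p r w z₁ o₁ z₂ o₂ u u′ v v′ (con 1ℚ) 2F 2F := con 1ℚ :+ ((o₁ :* u′ :+ o₁ :* u′) :+ (o₂ :* v′ :+ o₂ :* v′)))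
          refl p r w (ι (zeros e₁)) (ι (ones e₁)) (ι (zeros e₂)) (ι (ones e₂)) u u′ v v′)

        detℚ-shifted : (A : Matrixℚ (m ℕ.+ n)) → (∀ i → A i i ≡ - y) →
          (∀ i j → i ≢ j → A i j ≡ lowRank i j) →
          detℚ A ≡ product {m ℕ.+ n} (λ _ → - 1ℚ) *
            (P ^ zeros e₁ * P′ ^ ones e₁ * (R ^ zeros e₂ * R′ ^ ones e₂) * reducedDet p r w k₁ g₁ k₂ g₂)
        detℚ-shifted A Aᵢᵢ Aᵢⱼ = begin
          detℚ A
            ≡⟨ detℚ-cong entries ⟩
          detℚ (λ i j → diagonal (λ k → - shifted k) i j + lowRank i j)
            ≡⟨ detℚ-lowRankUpdate columns rows (λ k → - shifted k) (λ k → - inverses k) shifted-inverse ⟩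
          product (λ k → - shifted k) * detℚ (λ s t → identity s t + sum (summand s t))
            ≡⟨ cong₂ _*_ signs (trans (detℚ-cong reduced-entry) (detℚ₃ reducedMatrix)) ⟩
          product {m ℕ.+ n} (λ _ → - 1ℚ) * product shifted * reducedDet p r w k₁ g₁ k₂ g₂
            ≡⟨ trans (ℚₚ.*-assoc (product {m ℕ.+ n} (λ _ → - 1ℚ)) (product shifted) _)
                 (cong (λ x → product {m ℕ.+ n} (λ _ → - 1ℚ) * (x * reducedDet p r w k₁ g₁ k₂ g₂)) product-shifted) ⟩
          product {m ℕ.+ n} (λ _ → - 1ℚ) *
            (P ^ zeros e₁ * P′ ^ ones e₁ * (R ^ zeros e₂ * R′ ^ ones e₂) * reducedDet p r w k₁ g₁ k₂ g₂) ∎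
          where
          entries : ∀ i j → A i j ≡ diagonal (λ k → - shifted k) i j + lowRank i j
          entries i j with i ≟ j
          ... | yes refl = trans (Aᵢᵢ i) (trans (diagonal-entry i)
                  (cong (_+ lowRank i i) (sym (diagonal-at (λ k → - shifted k) i))))
          ... | no  i≢j  = trans (Aᵢⱼ i j i≢j) (trans (sym (ℚₚ.+-identityˡ (lowRank i j)))
                  (cong (_+ lowRank i j) (sym (diagonal-off (λ k → - shifted k) i j i≢j))))
          signs : product (λ k → - shifted k) ≡ product {m ℕ.+ n} (λ _ → - 1ℚ) * product shifted
          signs = trans (product-cong λ k → solve 1 (λ x → :- x := con (- 1ℚ) :* x) refl (shifted k))
            (product-distrib-* {m ℕ.+ n} (λ _ → - 1ℚ) shifted)

  -- Explicit polynomials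

  -- A sufficient syntactic test that computes on closed expressions: sums and products of variables
  -- and nonnegative constants pass. The signs of all explicit coefficients are settled by it, with
  -- `tt` as certificate.
  coefficientwise≥0 : ∀ {n} → Polynomial n → Bool
  coefficientwise≥0 (op [+] p q) = coefficientwise≥0 p ∧ coefficientwise≥0 q
  coefficientwise≥0 (op [*] p q) = coefficientwise≥0 p ∧ coefficientwise≥0 q
  coefficientwise≥0 (con c)      = isYes (0ℚ ≤? c)
  coefficientwise≥0 (var x)      = true
  coefficientwise≥0 (p :^ k)     = false
  coefficientwise≥0 (:- p)       = false

  +-nonNeg : ∀ {p q} → 0ℚ ≤ p → 0ℚ ≤ q → 0ℚ ≤ p + q
  +-nonNeg 0≤p 0≤q = ℚₚ.+-mono-≤ 0≤p 0≤q

  *-nonNeg : ∀ {p q} → 0ℚ ≤ p → 0ℚ ≤ q → 0ℚ ≤ p * q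
  *-nonNeg {p} {q} 0≤p 0≤q = subst (_≤ p * q) (ℚₚ.*-zeroˡ q)
    (ℚₚ.*-monoʳ-≤-nonNeg q {{nonNegative 0≤q}} 0≤p)

  evaluate≥0 : ∀ {n} (p : Polynomial n) {ρ : Vec ℚ n} → All (0ℚ ≤_) ρ → Bool.T (coefficientwise≥0 p) → 0ℚ ≤ ⟦ p ⟧ ρ
  evaluate≥0 (op [+] p q) 0≤ρ pos with Equivalence.to (T-∧ {coefficientwise≥0 p}) pos
  ... | p≥0 , q≥0 = +-nonNeg (evaluate≥0 p 0≤ρ p≥0) (evaluate≥0 q 0≤ρ q≥0)
  evaluate≥0 (op [*] p q) 0≤ρ pos with Equivalence.to (T-∧ {coefficientwise≥0 p}) pos
  ... | p≥0 , q≥0 = *-nonNeg (evaluate≥0 p 0≤ρ p≥0) (evaluate≥0 q 0≤ρ q≥0)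
  evaluate≥0 (con c) 0≤ρ pos = toWitness pos
  evaluate≥0 (var x) 0≤ρ pos = lookup⁺ 0≤ρ x

  -- The test looks for a constant as the outermost left summand; this is why some coefficients
  -- below are written with a separate `lit 1` in front.
  coefficientwise≥1 : ∀ {n} → Polynomial n → Bool
  coefficientwise≥1 (op [+] (con c) q) = isYes (1ℚ ≤? c) ∧ coefficientwise≥0 q
  coefficientwise≥1 _                  = false

  evaluate≥1 : ∀ {n} (p : Polynomial n) {ρ : Vec ℚ n} → All (0ℚ ≤_) ρ → Bool.T (coefficientwise≥1 p) → 1ℚ ≤ ⟦ p ⟧ ρ
  evaluate≥1 (op [+] (con c) q) 0≤ρ pos with Equivalence.to (T-∧ {isYes (1ℚ ≤? c)}) pos
  ... | 1≤c , q≥0 = ℚₚ.+-mono-≤ (toWitness 1≤c) (evaluate≥0 q 0≤ρ q≥0)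

  private
    lit : ∀ {n} → ℕ → Polynomial n
    lit k = con (ι k)

  infix 9 _at_,_
  -- Keeping the coefficients as expressions lets a single definition serve the ring solver, the
  -- sign test and, through this evaluation, the rational numbers.
  _at_,_ : (∀ {n} → Polynomial n → Polynomial n → Polynomial n) → ℚ → ℚ → ℚ
  f at a , b = ⟦ f {2} (var 0F) (var 1F) ⟧ (a ∷ b ∷ [])

  -- In a = m - 3 and b = n - 3 all coefficients below are nonnegative.  The quartic
  -- and the quadratic are the factors of the two characteristic polynomials that the
  -- vertex classes do not split; cofactor and excess are quotient and remainder of
  -- their division.
  pₚ rₚ wₚ E₃ₚ E₂ₚ E₁ₚ E₀ₚ Tₚ Dₚ A₁ₚ A₀ₚ C₁ₚ C₀ₚ Gapₚ : ∀ {n} → Polynomial n → Polynomial n → Polynomial n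
  pₚ a b = b :+ b :+ lit 5
  rₚ a b = a :+ a :+ lit 5
  wₚ a b = a :+ a :+ (b :+ b) :+ lit 7
  E₃ₚ a b = lit 8 :+ lit 7 :* b :+ (lit 7 :+ lit 4 :* b) :* a
  E₂ₚ a b = lit 478 :+ (lit 423 :+ (lit 118 :+ lit 12 :* b) :* b) :* b :+ (lit 427 :+ (lit 288 :+ (lit 54 :+ lit 4 :* b) :* b) :* b :+ (lit 118 :+ (lit 54 :+ lit 4 :* b) :* b :+ (lit 12 :+ lit 4 :* b) :* a) :* a) :* a
  E₁ₚ a b = lit 3704 :+ (lit 4201 :+ (lit 1756 :+ (lit 328 :+ lit 24 :* b) :* b) :* b) :* b :+ (lit 4361 :+ (lit 3920 :+ (lit 1228 :+ (lit 164 :+ lit 8 :* b) :* b) :* b) :* b :+ (lit 1864 :+ (lit 1244 :+ (lit 248 :+ lit 16 :* b) :* b) :* b :+ (lit 344 :+ (lit 164 :+ lit 16 :* b) :* b :+ (lit 24 :+ lit 8 :* b) :* a) :* a) :* a) :* a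
  E₀ₚ a b = lit 1 :+ (lit 7810 :+ (lit 10665 :+ (lit 5542 :+ (lit 1308 :+ lit 120 :* b) :* b) :* b) :* b :+ (lit 11541 :+ (lit 13220 :+ (lit 5670 :+ (lit 1104 :+ lit 88 :* b) :* b) :* b) :* b :+ (lit 6482 :+ (lit 6070 :+ (lit 2012 :+ (lit 280 :+ lit 16 :* b) :* b) :* b) :* b :+ (lit 1660 :+ (lit 1240 :+ (lit 280 :+ lit 16 :* b) :* b) :* b :+ (lit 168 :+ (lit 104 :+ lit 16 :* b) :* b) :* a) :* a) :* a) :* a)
  Tₚ a b = lit 1 :+ (lit 19 :+ lit 9 :* b :+ (lit 9 :+ lit 4 :* b) :* a)
  Dₚ a b = lit 1 :+ (lit 340 :+ (lit 309 :+ (lit 100 :+ lit 12 :* b) :* b) :* b :+ (lit 309 :+ (lit 208 :+ (lit 46 :+ lit 4 :* b) :* b) :* b :+ (lit 100 :+ (lit 46 :+ lit 4 :* b) :* b :+ (lit 12 :+ lit 4 :* b) :* a) :* a) :* a)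
  A₁ₚ a b = lit 12 :+ lit 2 :* b :+ lit 2 :* a
  A₀ₚ a b = lit 103 :+ lit 34 :* b :+ (lit 30 :+ lit 4 :* b) :* a
  C₁ₚ a b = lit 2448 :+ (lit 1796 :+ (lit 368 :+ lit 16 :* b) :* b) :* b :+ (lit 1556 :+ (lit 880 :+ lit 112 :* b) :* b :+ (lit 224 :+ lit 80 :* b) :* a) :* a
  C₀ₚ a b = lit 1 :+ (lit 27311 :+ (lit 32756 :+ (lit 15264 :+ (lit 3328 :+ lit 288 :* b) :* b) :* b) :* b :+ (lit 30516 :+ (lit 29344 :+ (lit 10376 :+ (lit 1632 :+ lit 96 :* b) :* b) :* b) :* b :+ (lit 13088 :+ (lit 9544 :+ (lit 2176 :+ lit 160 :* b) :* b) :* b :+ (lit 2576 :+ (lit 1360 :+ lit 160 :* b) :* b :+ (lit 192 :+ lit 64 :* b) :* a) :* a) :* a) :* a)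
  Gapₚ a b = lit 1 :+ (lit 29 :+ (lit 75 :+ lit 45 :* b) :* b :+ (lit 67 :+ (lit 122 :+ lit 52 :* b) :* b :+ (lit 45 :+ (lit 52 :+ lit 16 :* b) :* b) :* a) :* a)

  quarticₚ quadraticₚ cofactorₚ excessₚ : ∀ {n} → Polynomial n → Polynomial n → Polynomial n → Polynomial n
  quarticₚ   a b y = y :* y :* (y :* y :- E₃ₚ a b :* y :- E₂ₚ a b) :- E₁ₚ a b :* y :- E₀ₚ a b
  quadraticₚ a b y = y :* y :- Tₚ a b :* y :- Dₚ a b
  cofactorₚ  a b y = y :* y :+ A₁ₚ a b :* y :+ A₀ₚ a b
  excessₚ    a b y = C₁ₚ a b :* y :+ C₀ₚ a b

  quarticWith : (e₃ e₂ e₁ e₀ y : ℚ) → ℚ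
  quarticWith e₃ e₂ e₁ e₀ y = y * y * (y * y - e₃ * y - e₂) - e₁ * y - e₀

  quadraticWith cofactorWith : (t d y : ℚ) → ℚ
  quadraticWith t d y = y * y - t * y - d
  cofactorWith  t d y = y * y + t * y + d

  quartic quadratic cofactor excess : ℚ → ℚ → ℚ → ℚ
  quartic   a b = quarticWith (E₃ₚ at a , b) (E₂ₚ at a , b) (E₁ₚ at a , b) (E₀ₚ at a , b)
  quadratic a b = quadraticWith (Tₚ at a , b) (Dₚ at a , b)
  cofactor  a b = cofactorWith (A₁ₚ at a , b) (A₀ₚ at a , b)
  excess    a b y = C₁ₚ at a , b * y + C₀ₚ at a , b

  quartic-division : ∀ a b y → quartic a b y ≡ cofactor a b y * quadratic a b y + excess a b y
  quartic-division = solve 3 (λ a b y → quarticₚ a b y :=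
    cofactorₚ a b y :* quadraticₚ a b y :+ excessₚ a b y) refl

  quadratic-swap : ∀ a b y → quadratic b a y ≡ quadratic a b y
  quadratic-swap = solve 3 (λ a b y → quadraticₚ b a y := quadraticₚ a b y) refl

  -- This is the vanishing trace after the deletion: the right side is the sum of the explicit
  -- eigenvalues, and the roots of the quartic, in the variable `y`, sum to `E₃ₚ`.
  E₃-trace : ∀ a b → E₃ₚ at a , b ≡ a * pₚ at a , b + (1ℚ + b) * rₚ at a , b + (pₚ at a , b - 2ℚ)
  E₃-trace = solve 2 (λ a b → E₃ₚ a b := a :* pₚ a b :+ (con 1ℚ :+ b) :* rₚ a b :+ (pₚ a b :- con 2ℚ)) refl

  -- The explicit eigenvalues have square sum E₃² - Gap, and the roots of the quartic contribute E₃²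
  -- + 2 E₂. Hence `Gapₚ` is the margin by which the trace of the square stays below 2 (E₃² + E₂).
  E₃-square : ∀ a b → let p = pₚ at a , b ; r = rₚ at a , b ; e = E₃ₚ at a , b in
    e * e ≡ a * (p * p) + (1ℚ + b) * (r * r) + (p - 2ℚ) * (p - 2ℚ) + Gapₚ at a , b
  E₃-square = solve 2 (λ a b → E₃ₚ a b :* E₃ₚ a b :=
    a :* (pₚ a b :* pₚ a b) :+ (con 1ℚ :+ b) :* (rₚ a b :* rₚ a b) :+ (pₚ a b :- con 2ℚ) :* (pₚ a b :- con 2ℚ) :+ Gapₚ a b) refl

  T-trace : ∀ a b → Tₚ at a , b ≡ (1ℚ + (1ℚ + a)) * pₚ at a , b + (1ℚ + (1ℚ + b)) * rₚ at a , b
  T-trace = solve 2 (λ a b → Tₚ a b := (con 1ℚ :+ (con 1ℚ :+ a)) :* pₚ a b :+ (con 1ℚ :+ (con 1ℚ :+ b)) :* rₚ a b) refl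

  -- P P′ R R′ times the reduced determinant, once P k₁, P′ g₁, R k₂, R′ g₂ are
  -- named κ₁, γ₁, κ₂, γ₂; it is multi-affine because g₁², g₂² cancel.
  numeratorₚ : ∀ {n} (P P′ R R′ κ₁ γ₁ κ₂ γ₂ p r w : Polynomial n) → Polynomial n
  numeratorₚ P P′ R R′ κ₁ γ₁ κ₂ γ₂ p r w =
    P :* P′ :* R :* R′ :+ (con 2ℚ :- r) :* (γ₂ :* P :* P′ :* R) :- r :* (κ₂ :* P :* P′ :* R′)
    :- (r :+ r) :* (κ₂ :* γ₂ :* P :* P′) :+ (con 2ℚ :- p) :* (γ₁ :* P :* R :* R′)
    :+ (q :+ lit 4 :* w :- (p :+ p) :- (r :+ r)) :* (γ₁ :* γ₂ :* P :* R) :+ (q :- (r :+ r)) :* (γ₁ :* κ₂ :* P :* R′)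
    :+ (q :+ q) :* (γ₁ :* κ₂ :* γ₂ :* P) :- p :* (κ₁ :* P′ :* R :* R′)
    :+ (q :- (p :+ p)) :* (κ₁ :* γ₂ :* P′ :* R) :+ q :* (κ₁ :* κ₂ :* P′ :* R′)
    :+ (q :+ q) :* (κ₁ :* κ₂ :* γ₂ :* P′) :- (p :+ p) :* (κ₁ :* γ₁ :* R :* R′)
    :+ (q :+ q) :* (κ₁ :* γ₁ :* γ₂ :* R) :+ (q :+ q) :* (κ₁ :* γ₁ :* κ₂ :* R′)
    where q = p :* r :- w :* w

  reducedDetₚ : ∀ {n} (p r w k₁ g₁ k₂ g₂ : Polynomial n) → Polynomial n
  reducedDetₚ p r w k₁ g₁ k₂ g₂ =
    a₁₁ :* (a₂₂ :* a₃₃ :- a₂₃ :* a₃₂) :- a₁₂ :* (a₂₁ :* a₃₃ :- a₂₃ :* a₃₁) :+ a₁₃ :* (a₂₁ :* a₃₂ :- a₂₂ :* a₃₁)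
    where
    a₁₁ = con 1ℚ :- p :* (k₁ :+ g₁)
    a₁₂ = :- (w :* (k₂ :+ g₂))
    a₁₃ = :- (p :* g₁ :+ w :* g₂)
    a₂₁ = :- (w :* (k₁ :+ g₁))
    a₂₂ = con 1ℚ :- r :* (k₂ :+ g₂)
    a₂₃ = :- (w :* g₁ :+ r :* g₂)
    a₃₁ = g₁ :+ g₁
    a₃₂ = g₂ :+ g₂
    a₃₃ = con 1ℚ :+ (a₃₁ :+ a₃₂)

  numerator : (P P′ R R′ κ₁ γ₁ κ₂ γ₂ p r w : ℚ) → ℚ
  numerator P P′ R R′ κ₁ γ₁ κ₂ γ₂ p r w =
    ⟦ numeratorₚ (var 0F) (var 1F) (var 2F) (var 3F) (var 4F) (var 5F) (var 6F) (var 7F) (var 8F) (var 9F) (var (# 10)) ⟧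
      (P ∷ P′ ∷ R ∷ R′ ∷ κ₁ ∷ γ₁ ∷ κ₂ ∷ γ₂ ∷ p ∷ r ∷ w ∷ [])

  clear-denominators : ∀ P P′ R R′ k₁ g₁ k₂ g₂ p r w → P * P′ * R * R′ * reducedDet p r w k₁ g₁ k₂ g₂ ≡
    numerator P P′ R R′ (P * k₁) (P′ * g₁) (R * k₂) (R′ * g₂) p r w
  clear-denominators = solve 11 (λ P P′ R R′ k₁ g₁ k₂ g₂ p r w →
    P :* P′ :* R :* R′ :* reducedDetₚ p r w k₁ g₁ k₂ g₂ :=
    numeratorₚ P P′ R R′ (P :* k₁) (P′ :* g₁) (R :* k₂) (R′ :* g₂) p r w) refl

  clear-denominators₀ : ∀ P R k₁ k₂ p r w → P * R * reducedDet p r w k₁ 0ℚ k₂ 0ℚ ≡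
    (P - p * (P * k₁)) * (R - r * (R * k₂)) - w * w * (P * k₁ * (R * k₂))
  clear-denominators₀ = solve 7 (λ P R k₁ k₂ p r w →
    P :* R :* reducedDetₚ p r w k₁ (con 0ℚ) k₂ (con 0ℚ) :=
    (P :- p :* (P :* k₁)) :* (R :- r :* (R :* k₂)) :- w :* w :* (P :* k₁ :* (R :* k₂))) refl

  -- The four counts are those of an edge with two vertices in V₁: m - 2 and 2 in V₁, n - 1 and 1 in
  -- V₂.
  numerator-quartic : ∀ a b y → let p = pₚ at a , b ; r = rₚ at a , b ; w = wₚ at a , b in
    numerator (y + p) (y + p - 2ℚ) (y + r) (y + r - 2ℚ) (1ℚ + a) 2ℚ (1ℚ + (1ℚ + b)) 1ℚ p r w ≡ quartic a b y
  numerator-quartic = solve 3 (λ a b y → let p = pₚ a b ; r = rₚ a b ; w = wₚ a b in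
    numeratorₚ (y :+ p) (y :+ p :- con 2ℚ) (y :+ r) (y :+ r :- con 2ℚ)
      (con 1ℚ :+ a) (con 2ℚ) (con 1ℚ :+ (con 1ℚ :+ b)) (con 1ℚ) p r w := quarticₚ a b y) refl

  numerator-quartic-swapped : ∀ a b y → let p = pₚ at a , b ; r = rₚ at a , b ; w = wₚ at a , b in
    numerator (y + p) (y + p - 2ℚ) (y + r) (y + r - 2ℚ) (1ℚ + (1ℚ + a)) 1ℚ (1ℚ + b) 2ℚ p r w ≡ quartic b a y
  numerator-quartic-swapped = solve 3 (λ a b y → let p = pₚ a b ; r = rₚ a b ; w = wₚ a b in
    numeratorₚ (y :+ p) (y :+ p :- con 2ℚ) (y :+ r) (y :+ r :- con 2ℚ)
      (con 1ℚ :+ (con 1ℚ :+ a)) (con 1ℚ) (con 1ℚ :+ b) (con 2ℚ) p r w := quarticₚ b a y) refl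

  quadratic-numerator : ∀ a b y → let p = pₚ at a , b ; r = rₚ at a , b ; w = wₚ at a , b ; m = 1ℚ + (1ℚ + (1ℚ + a)) ; n = 1ℚ + (1ℚ + (1ℚ + b)) in
    (y + p - p * m) * (y + r - r * n) - w * w * (m * n) ≡ quadratic a b y
  quadratic-numerator = solve 3 (λ a b y → let p = pₚ a b ; r = rₚ a b ; w = wₚ a b
                                               m = con 1ℚ :+ (con 1ℚ :+ (con 1ℚ :+ a)) ; n = con 1ℚ :+ (con 1ℚ :+ (con 1ℚ :+ b)) in
    (y :+ p :- p :* m) :* (y :+ r :- r :* n) :- w :* w :* (m :* n) := quadraticₚ a b y) refl

  -- Power sums of approximate roots

  Null : (ℕ → ℚ) → Set
  Null f = ∀ ε → 0ℚ < ε → ∃[ K ] (∀ k → K ℕ.≤ k → ∣ f k ∣ < ε)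

  Null-cong : ∀ {f g} → (∀ k → f k ≡ g k) → Null f → Null g
  Null-cong f≗g f→0 ε 0<ε with f→0 ε 0<ε
  ... | K , small = K , λ k K≤k → subst (λ x → ∣ x ∣ < ε) (f≗g k) (small k K≤k)

  ½*ε+½*ε : ∀ ε → ½ * ε + ½ * ε ≡ ε
  ½*ε+½*ε = solve 1 (λ ε → con ½ :* ε :+ con ½ :* ε := ε) refl

  *-pos : ∀ {p q} → 0ℚ < p → 0ℚ < q → 0ℚ < p * q
  *-pos {p} {q} 0<p 0<q = subst (_< p * q) (ℚₚ.*-zeroˡ q) (ℚₚ.*-monoˡ-<-pos q {{positive 0<q}} 0<p)

  Null-+ : ∀ {f g} → Null f → Null g → Null (λ k → f k + g k)
  Null-+ {f} {g} f→0 g→0 ε 0<ε with f→0 (½ * ε) (*-pos (ℚₚ.positive⁻¹ ½) 0<ε) | g→0 (½ * ε) (*-pos (ℚₚ.positive⁻¹ ½) 0<ε)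
  ... | K , f-small | L , g-small = K ℕ.⊔ L , λ k K⊔L≤k → ℚₚ.≤-<-trans (ℚₚ.∣p+q∣≤∣p∣+∣q∣ (f k) (g k))
    (subst (∣ f k ∣ + ∣ g k ∣ <_) (½*ε+½*ε ε)
      (ℚₚ.+-mono-< (f-small k (ℕₚ.m⊔n≤o⇒m≤o K L K⊔L≤k)) (g-small k (ℕₚ.m⊔n≤o⇒n≤o K L K⊔L≤k))))

  Null-* : ∀ {f g} → Null f → Null g → Null (λ k → f k * g k)
  Null-* {f} {g} f→0 g→0 ε 0<ε with f→0 1ℚ (ℚₚ.positive⁻¹ 1ℚ) | g→0 ε 0<ε
  ... | K , f-small | L , g-small = K ℕ.⊔ L , λ k K⊔L≤k →
    ℚₚ.≤-<-trans
      (subst₂ _≤_ (sym (ℚₚ.∣p*q∣≡∣p∣*∣q∣ (f k) (g k))) (ℚₚ.*-identityˡ ∣ g k ∣)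
        (ℚₚ.*-monoʳ-≤-nonNeg ∣ g k ∣ {{ℚₚ.∣-∣-nonNeg (g k)}} (ℚₚ.<⇒≤ (f-small k (ℕₚ.m⊔n≤o⇒m≤o K L K⊔L≤k)))))
      (g-small k (ℕₚ.m⊔n≤o⇒n≤o K L K⊔L≤k))

  Null-scale : ∀ c {f} → Null f → Null (λ k → c * f k)
  Null-scale c {f} f→0 ε 0<ε = map₂ scaled (f→0 δ (*-pos (ℚₚ.positive⁻¹ (1/ b)) 0<ε))
    where
    b : ℚ
    b = 1ℚ + ∣ c ∣
    instance
      b-pos : Positive b
      b-pos = positive (ℚₚ.+-mono-<-≤ (ℚₚ.positive⁻¹ 1ℚ) (ℚₚ.0≤∣p∣ c))
      b-nonZero : NonZero b
      b-nonZero = ℚₚ.pos⇒nonZero b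
      1/b-pos : Positive (1/ b)
      1/b-pos = ℚₚ.1/pos⇒pos b
    δ : ℚ
    δ = 1/ b * ε
    c≤b : ∣ c ∣ ≤ b
    c≤b = subst (_≤ b) (ℚₚ.+-identityˡ ∣ c ∣) (ℚₚ.+-monoˡ-≤ ∣ c ∣ (ℚₚ.<⇒≤ (ℚₚ.positive⁻¹ 1ℚ)))
    bδ≡ε : b * δ ≡ ε
    bδ≡ε = trans (sym (ℚₚ.*-assoc b (1/ b) ε)) (trans (cong (_* ε) (ℚₚ.*-inverseʳ b)) (ℚₚ.*-identityˡ ε))
    scaled : ∀ {K} → (∀ k → K ℕ.≤ k → ∣ f k ∣ < δ) → ∀ k → K ℕ.≤ k → ∣ c * f k ∣ < ε
    scaled small k K≤k = ℚₚ.≤-<-trans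
      (subst (_≤ b * ∣ f k ∣) (sym (ℚₚ.∣p*q∣≡∣p∣*∣q∣ c (f k)))
        (ℚₚ.*-monoʳ-≤-nonNeg ∣ f k ∣ {{ℚₚ.∣-∣-nonNeg (f k)}} c≤b))
      (subst (b * ∣ f k ∣ <_) bδ≡ε (ℚₚ.*-monoʳ-<-pos b (small k K≤k)))

  Null-- : ∀ {f g} → Null f → Null g → Null (λ k → f k - g k)
  Null-- {f} {g} f→0 g→0 = Null-cong (λ k → solve 2 (λ x y → x :+ con (- 1ℚ) :* y := x :- y) refl (f k) (g k))
    (Null-+ f→0 (Null-scale (- 1ℚ) g→0))

  -- Polynomials are sequences of coefficients, leading one first: horner c x d is
  -- c 0 * x ^ d + c 1 * x ^ (d - 1) + ... + c d, and the partial values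
  -- horner c s 0, horner c s 1, ... are the coefficients of the quotient by x - s.
  horner : (ℕ → ℚ) → ℚ → ℕ → ℚ
  horner c x zero    = c zero
  horner c x (suc d) = horner c x d * x + c (suc d)

  horner-division : ∀ c x s d →
    horner c x (suc d) ≡ (x - s) * horner (horner c s) x d + horner c s (suc d)
  horner-division c x s zero =
    solve 4 (λ c₀ c₁ x s → c₀ :* x :+ c₁ := (x :- s) :* c₀ :+ (c₀ :* s :+ c₁)) refl (c 0) (c 1) x s
  horner-division c x s (suc d) = trans (cong (λ h → h * x + c (suc (suc d))) (horner-division c x s d))
    (solve 5 (λ h q c x s → ((x :- s) :* q :+ h) :* x :+ c := (x :- s) :* (q :* x :+ h) :+ (h :* s :+ c)) refl
      (horner c s (suc d)) (horner (horner c s) x d) (c (suc (suc d))) x s)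

  horner-- : ∀ c c′ x d → horner (λ j → c j - c′ j) x d ≡ horner c x d - horner c′ x d
  horner-- c c′ x zero    = refl
  horner-- c c′ x (suc d) = trans (cong (λ h → h * x + (c (suc d) - c′ (suc d))) (horner-- c c′ x d))
    (solve 5 (λ h h′ x e e′ → (h :- h′) :* x :+ (e :- e′) := h :* x :+ e :- (h′ :* x :+ e′)) refl
      (horner c x d) (horner c′ x d) x (c (suc d)) (c′ (suc d)))

  -- Induction on the degree: divide by x - s₀, whose quotient tends to zero at all
  -- the remaining points.
  coefficients-Null : ∀ d (c : ℕ → ℕ → ℚ) s₀ →
    (∀ t → Null (λ k → horner (c k) (ι (t ℕ.+ s₀)) d)) → ∀ j → j ℕ.≤ d → Null (λ k → c k j)
  coefficients-Null zero    c s₀ values zero    _ = values 0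
  coefficients-Null (suc d) c s₀ values j j≤1+d = coefficient j j≤1+d
    where
    s : ℚ
    s = ι s₀
    quotient-values : ∀ t → Null (λ k → horner (horner (c k) s) (ι (t ℕ.+ suc s₀)) d)
    -- The quotient at a later point is a divided difference of two null sequences, and the divisor
    -- `suc t` does not depend on `k`.
    quotient-values t = Null-cong recover (Null-scale inv (Null-- (values (suc t)) (values 0)))
      where
      0<step : 0ℚ < ι (suc t)
      0<step = ℚₚ.positive⁻¹ (ι (suc t)) {{ℚₚ.normalize-pos (suc t) 1}}
      nz : NonZero (ι (suc t))
      nz = ℚₚ.pos⇒nonZero (ι (suc t)) {{positive 0<step}}
      inv : ℚ
      inv = (1/ ι (suc t)) {{nz}}
      x : ℚ
      x = ι (suc t ℕ.+ s₀)
      recover : ∀ k → inv * (horner (c k) x (suc d) - horner (c k) s (suc d)) ≡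
        horner (horner (c k) s) (ι (t ℕ.+ suc s₀)) d
      recover k = begin
        inv * (horner (c k) x (suc d) - horner (c k) s (suc d))
          ≡⟨ cong (λ h → inv * (h - horner (c k) s (suc d))) (horner-division (c k) x s d) ⟩
        inv * ((x - s) * horner (horner (c k) s) x d + horner (c k) s (suc d) - horner (c k) s (suc d))
          ≡⟨ cong (λ z → inv * ((z - s) * horner (horner (c k) s) x d + horner (c k) s (suc d) - horner (c k) s (suc d)))
               (ι-+ (suc t) s₀) ⟩
        inv * ((ι (suc t) + s - s) * horner (horner (c k) s) x d + horner (c k) s (suc d) - horner (c k) s (suc d))
          ≡⟨ solve 5 (λ i t s q h → i :* ((t :+ s :- s) :* q :+ h :- h) := t :* i :* q) refl
               inv (ι (suc t)) s (horner (horner (c k) s) x d) (horner (c k) s (suc d)) ⟩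
        ι (suc t) * inv * horner (horner (c k) s) x d
          ≡⟨ cong (_* horner (horner (c k) s) x d) (ℚₚ.*-inverseʳ (ι (suc t)) {{nz}}) ⟩
        1ℚ * horner (horner (c k) s) x d
          ≡⟨ ℚₚ.*-identityˡ (horner (horner (c k) s) x d) ⟩
        horner (horner (c k) s) x d
          ≡⟨ cong (λ z → horner (horner (c k) s) (ι z) d) (sym (ℕₚ.+-suc t s₀)) ⟩
        horner (horner (c k) s) (ι (t ℕ.+ suc s₀)) d ∎
        where open ≡-Reasoning
    partial-Null : ∀ j → j ℕ.≤ suc d → Null (λ k → horner (c k) s j)
    partial-Null j j≤1+d with ℕₚ.m≤n⇒m<n∨m≡n j≤1+d
    ... | inj₁ (ℕ.s≤s j≤d) = coefficients-Null d (λ k → horner (c k) s) (suc s₀) quotient-values j j≤d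
    ... | inj₂ refl        = values 0
    -- Horner's recursion read backwards: a coefficient is a partial value minus `s` times the
    -- preceding one.
    coefficient : ∀ j → j ℕ.≤ suc d → Null (λ k → c k j)
    coefficient zero    _   = partial-Null 0 ℕ.z≤n
    coefficient (suc j) j<  = Null-cong
      (λ k → solve 3 (λ h s c → h :* s :+ c :- s :* h := c) refl (horner (c k) s j) s (c k (suc j)))
      (Null-- (partial-Null (suc j) j<) (Null-scale s (partial-Null j (ℕₚ.≤-trans (ℕₚ.n≤1+n j) j<))))

  timesLinear : ℚ → (ℕ → ℚ) → ℕ → ℚ
  timesLinear a c zero    = c zero
  timesLinear a c (suc j) = c (suc j) + a * c j

  -- Coefficient sequences are infinite, so the entry just beyond the degree survives as an error
  -- term; `Degree≤` makes it vanish.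
  horner-timesLinear : ∀ a c x d → horner (timesLinear a c) x (suc d) ≡ (x + a) * horner c x d + c (suc d)
  horner-timesLinear a c x zero =
    solve 4 (λ a c₀ c₁ x → c₀ :* x :+ (c₁ :+ a :* c₀) := (x :+ a) :* c₀ :+ c₁) refl a (c 0) (c 1) x
  horner-timesLinear a c x (suc d) =
    trans (cong (λ h → h * x + timesLinear a c (suc (suc d))) (horner-timesLinear a c x d))
      (solve 5 (λ a x h c₁ c₂ → ((x :+ a) :* h :+ c₁) :* x :+ (c₂ :+ a :* c₁) := (x :+ a) :* (h :* x :+ c₁) :+ c₂) refl
        a x (horner c x d) (c (suc d)) (c (suc (suc d))))

  -- The factors are x + a i: in the variable `y` = -x the numbers `a i` are the eigenvalues
  -- themselves, and their sum enters the second coefficient with a positive sign. `c` is the factor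
  -- left unsplit.
  expand : ∀ {N} → (Fin N → ℚ) → (ℕ → ℚ) → ℕ → ℚ
  expand {zero}  a c = c
  expand {suc N} a c = timesLinear (a zero) (expand (a ∘ suc) c)

  Degree≤ : ℕ → (ℕ → ℚ) → Set
  Degree≤ d c = ∀ j → d ℕ.< j → c j ≡ 0ℚ

  expand-degree : ∀ {N} (a : Fin N → ℚ) {c d} → Degree≤ d c → Degree≤ (N ℕ.+ d) (expand a c)
  expand-degree {zero}  a deg j       d<j           = deg j d<j
  expand-degree {suc N} a {c} deg (suc j) (ℕ.s≤s N+d<j) = trans
    (cong₂ (λ x y → x + a zero * y) (expand-degree (a ∘ suc) deg (suc j) (ℕₚ.m<n⇒m<1+n N+d<j)) (expand-degree (a ∘ suc) deg j N+d<j))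
    (trans (ℚₚ.+-identityˡ (a zero * 0ℚ)) (ℚₚ.*-zeroʳ (a zero)))

  horner-expand : ∀ {N} (a : Fin N → ℚ) {c d} → Degree≤ d c → ∀ x →
    horner (expand a c) x (N ℕ.+ d) ≡ product (λ i → x + a i) * horner c x d
  horner-expand {zero}  a {c} {d} deg x = sym (ℚₚ.*-identityˡ (horner c x d))
  horner-expand {suc N} a {c} {d} deg x = begin
    horner (expand a c) x (suc N ℕ.+ d)
      ≡⟨ horner-timesLinear (a zero) (expand (a ∘ suc) c) x (N ℕ.+ d) ⟩
    (x + a zero) * horner (expand (a ∘ suc) c) x (N ℕ.+ d) + expand (a ∘ suc) c (suc (N ℕ.+ d))
      ≡⟨ cong₂ (λ h e → (x + a zero) * h + e) (horner-expand (a ∘ suc) deg x)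
           (expand-degree (a ∘ suc) deg (suc (N ℕ.+ d)) (ℕₚ.n<1+n (N ℕ.+ d))) ⟩
    (x + a zero) * (product (λ i → x + a (suc i)) * horner c x d) + 0ℚ
      ≡⟨ trans (ℚₚ.+-identityʳ _) (sym (ℚₚ.*-assoc (x + a zero) (product λ i → x + a (suc i)) (horner c x d))) ⟩
    product (λ i → x + a i) * horner c x d ∎
    where open ≡-Reasoning

  expand-monic : ∀ {N} (a : Fin N → ℚ) {c} → c 0 ≡ 1ℚ → expand a c 0 ≡ 1ℚ
  expand-monic {zero}  a c₀ = c₀
  expand-monic {suc N} a c₀ = expand-monic (a ∘ suc) c₀

  expand-sum : ∀ {N} (a : Fin N → ℚ) {c} → c 0 ≡ 1ℚ → expand a c 1 ≡ sum a + c 1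
  expand-sum {zero}  a {c} c₀ = sym (ℚₚ.+-identityˡ (c 1))
  expand-sum {suc N} a {c} c₀ = trans
    (cong₂ (λ x y → x + a zero * y) (expand-sum (a ∘ suc) c₀) (expand-monic (a ∘ suc) c₀))
    (solve 3 (λ s c a → s :+ c :+ a :* con 1ℚ := a :+ s :+ c) refl (sum (a ∘ suc)) (c 1) (a zero))

  -- Newton's identity for the second power sum of the roots.
  squareSum : (ℕ → ℚ) → ℚ
  squareSum c = c 1 * c 1 - 2ℚ * c 2

  expand-squareSum : ∀ {N} (a : Fin N → ℚ) {c} → c 0 ≡ 1ℚ →
    squareSum (expand a c) ≡ sum (λ i → a i * a i) + squareSum c
  expand-squareSum {zero}  a {c} c₀ = sym (ℚₚ.+-identityˡ (squareSum c))
  expand-squareSum {suc N} a {c} c₀ = begin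
    (e 1 + a zero * e 0) * (e 1 + a zero * e 0) - 2ℚ * (e 2 + a zero * e 1)
      ≡⟨ cong (λ x → (e 1 + a zero * x) * (e 1 + a zero * x) - 2ℚ * (e 2 + a zero * e 1)) (expand-monic (a ∘ suc) c₀) ⟩
    (e 1 + a zero * 1ℚ) * (e 1 + a zero * 1ℚ) - 2ℚ * (e 2 + a zero * e 1)
      ≡⟨ solve 3 (λ e₁ e₂ a → (e₁ :+ a :* con 1ℚ) :* (e₁ :+ a :* con 1ℚ) :- con 2ℚ :* (e₂ :+ a :* e₁) :=
           a :* a :+ (e₁ :* e₁ :- con 2ℚ :* e₂)) refl (e 1) (e 2) (a zero) ⟩
    a zero * a zero + squareSum e
      ≡⟨ cong (a zero * a zero +_) (expand-squareSum (a ∘ suc) c₀) ⟩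
    a zero * a zero + (sum (λ i → a (suc i) * a (suc i)) + squareSum c)
      ≡⟨ sym (ℚₚ.+-assoc (a zero * a zero) (sum λ i → a (suc i) * a (suc i)) (squareSum c)) ⟩
    sum (λ i → a i * a i) + squareSum c ∎
    where
    open ≡-Reasoning
    e : ℕ → ℚ
    e = expand (a ∘ suc) c

  one : ℕ → ℚ
  one zero    = 1ℚ
  one (suc _) = 0ℚ

  one-degree : Degree≤ 0 one
  one-degree (suc j) _ = refl

  -- The values at the natural numbers fix the coefficients in the limit, and the coefficients give
  -- the power sums; the individual approximations never have to be matched with roots.
  module PowerSums {N : ℕ} (a : ℕ → Fin N → ℚ) (c : ℕ → ℚ) (c₀ : c 0 ≡ 1ℚ)
    (values : ∀ t → Null (λ k → product (λ i → ι t + a k i) - horner c (ι t) N)) where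

    private
      coefficient-Null : ∀ j → j ℕ.≤ N → Null (λ k → expand (a k) one j - c j)
      coefficient-Null = coefficients-Null N (λ k j → expand (a k) one j - c j) 0 λ t →
        Null-cong (λ k → sym (trans (horner-- (expand (a k) one) c (ι (t ℕ.+ 0)) N)
            (trans (cong (λ h → h - horner c (ι (t ℕ.+ 0)) N) (eval k (ι (t ℕ.+ 0))))
              (cong (λ z → product (λ i → ι z + a k i) - horner c (ι z) N) (ℕₚ.+-identityʳ t)))))
          (values t)
        where
        eval : ∀ k x → horner (expand (a k) one) x N ≡ product (λ i → x + a k i)
        eval k x = trans (cong (horner (expand (a k) one) x) (sym (ℕₚ.+-identityʳ N)))
          (trans (horner-expand (a k) one-degree x) (ℚₚ.*-identityʳ (product λ i → x + a k i)))

    sum-Null : 1 ℕ.≤ N → Null (λ k → sum (a k) - c 1)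
    sum-Null 1≤N = Null-cong (λ k → cong (_- c 1) (trans (expand-sum (a k) refl) (ℚₚ.+-identityʳ (sum (a k)))))
      (coefficient-Null 1 1≤N)

    -- With `c 1` zero, the square of the first elementary symmetric function is a product of two
    -- null sequences, so `Null-*` applies directly.
    squareSum-Null : 2 ℕ.≤ N → c 1 ≡ 0ℚ → Null (λ k → sum (λ i → a k i * a k i) - squareSum c)
    squareSum-Null 2≤N c₁≡0 = Null-cong combine
      (Null-- (Null-* first first) (Null-scale 2ℚ (coefficient-Null 2 2≤N)))
      where
      open ≡-Reasoning
      first : Null (λ k → expand (a k) one 1 - c 1)
      first = coefficient-Null 1 (ℕₚ.≤-trans (ℕ.s≤s ℕ.z≤n) 2≤N)
      combine : ∀ k → (expand (a k) one 1 - c 1) * (expand (a k) one 1 - c 1) - 2ℚ * (expand (a k) one 2 - c 2) ≡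
        sum (λ i → a k i * a k i) - squareSum c
      combine k = begin
        (e 1 - c 1) * (e 1 - c 1) - 2ℚ * (e 2 - c 2)
          ≡⟨ cong (λ x → (e 1 - x) * (e 1 - x) - 2ℚ * (e 2 - c 2)) c₁≡0 ⟩
        (e 1 - 0ℚ) * (e 1 - 0ℚ) - 2ℚ * (e 2 - c 2)
          ≡⟨ solve 3 (λ e₁ e₂ c₂ → (e₁ :- con 0ℚ) :* (e₁ :- con 0ℚ) :- con 2ℚ :* (e₂ :- c₂) :=
               (e₁ :* e₁ :- con 2ℚ :* e₂) :- (con 0ℚ :* con 0ℚ :- con 2ℚ :* c₂)) refl (e 1) (e 2) (c 2) ⟩
        squareSum e - (0ℚ * 0ℚ - 2ℚ * c 2)
          ≡⟨ cong (λ x → squareSum e - (x * x - 2ℚ * c 2)) (sym c₁≡0) ⟩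
        squareSum e - squareSum c
          ≡⟨ cong (_- squareSum c) (trans (expand-squareSum (a k) refl)
               (ℚₚ.+-identityʳ (sum λ i → a k i * a k i))) ⟩
        sum (λ i → a k i * a k i) - squareSum c ∎
        where
        e : ℕ → ℚ
        e = expand (a k) one

  -- Sign of the quadratic and of the quartic, sums of absolute values

  <⇒≱ : ∀ {p q} → p < q → ¬ q ≤ p
  <⇒≱ p<q q≤p = ℚₚ.<-irrefl refl (ℚₚ.<-≤-trans p<q q≤p)

  -- The form in which most inequalities below are proved: the difference `d` is displayed as a
  -- visibly nonnegative expression, and the equation is left to the ring solver.
  ≤-excess : ∀ {p q} d → 0ℚ ≤ d → p + d ≡ q → p ≤ q
  ≤-excess {p} {q} d 0≤d p+d≡q = subst₂ _≤_ (ℚₚ.+-identityʳ p) p+d≡q (ℚₚ.+-monoʳ-≤ p 0≤d)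

  0≤-difference : ∀ {p q} → p ≤ q → 0ℚ ≤ q - p
  0≤-difference {p} {q} p≤q = subst (_≤ q - p) (ℚₚ.+-inverseʳ p) (ℚₚ.+-monoˡ-≤ (- p) p≤q)

  0≤1 : 0ℚ ≤ 1ℚ
  0≤1 = ℚₚ.<⇒≤ (ℚₚ.positive⁻¹ 1ℚ)

  *-mono-≤-nonNeg : ∀ {p q r s} → 0ℚ ≤ p → 0ℚ ≤ s → p ≤ q → r ≤ s → p * r ≤ q * s
  *-mono-≤-nonNeg {p} {q} {r} {s} 0≤p 0≤s p≤q r≤s = ℚₚ.≤-trans
    (ℚₚ.*-monoˡ-≤-nonNeg p {{nonNegative 0≤p}} r≤s) (ℚₚ.*-monoʳ-≤-nonNeg s {{nonNegative 0≤s}} p≤q)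

  1≤-* : ∀ {p q} → 1ℚ ≤ p → 1ℚ ≤ q → 1ℚ ≤ p * q
  1≤-* 1≤p 1≤q = *-mono-≤-nonNeg 0≤1 (ℚₚ.≤-trans 0≤1 1≤q) 1≤p 1≤q

  1≤-^ : ∀ {p} n → 1ℚ ≤ p → 1ℚ ≤ p ^ n
  1≤-^ zero    1≤p = ℚₚ.≤-refl
  1≤-^ (suc n) 1≤p = 1≤-* 1≤p (1≤-^ n 1≤p)

  shift≥1 : ∀ {q} y → 0ℚ ≤ y → 1ℚ + 2ℚ ≤ q → 1ℚ ≤ y + q - 2ℚ
  shift≥1 {q} y 0≤y 3≤q = ≤-excess (y + (q - (1ℚ + 2ℚ))) (+-nonNeg 0≤y (0≤-difference 3≤q))
    (solve 2 (λ y q → con 1ℚ :+ (y :+ (q :- (con 1ℚ :+ con 2ℚ))) := y :+ q :- con 2ℚ) refl y q)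

  shift≥1′ : ∀ {q} y → 0ℚ ≤ y → 1ℚ + 2ℚ ≤ q → 1ℚ ≤ y + q
  shift≥1′ {q} y 0≤y 3≤q = ℚₚ.≤-trans (shift≥1 y 0≤y 3≤q) (≤-excess 2ℚ (ℚₚ.<⇒≤ (ℚₚ.positive⁻¹ 2ℚ))
    (solve 2 (λ y q → y :+ q :- con 2ℚ :+ con 2ℚ := y :+ q) refl y q))

  ι-nonNeg : ∀ n → 0ℚ ≤ ι n
  ι-nonNeg n = ℚₚ.nonNegative⁻¹ (ι n) {{ℚₚ.normalize-nonNeg n 1}}

  archimedean : ∀ q → ∃[ n ] q ≤ ι n
  archimedean q@record{} = n , ℚₚ.toℚᵘ-cancel-≤ (ℚᵘₚ.≤-respʳ-≃ (ℚᵘₚ.≃-sym (ℚₚ.toℚᵘ-fromℚᵘ (ℚᵘ.mkℚᵘ (ℤ.+ n) 0)))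
    (ℚᵘ.*≤* (ℤₚ.≤-trans (ℤₚ.≤-reflexive (ℤₚ.*-identityʳ (↥ q)))
      (ℤₚ.≤-trans (bound (↥ q)) (subst (ℤ.+ n ℤ.≤_) (ℤₚ.pos-* n (↧ₙ q)) (ℤ.+≤+ (ℕₚ.m≤m*n n (↧ₙ q))))))))
    where
    n : ℕ
    n = ℤ.∣ ↥ q ∣
    bound : ∀ i → i ℤ.≤ ℤ.+ ℤ.∣ i ∣
    bound (ℤ.+ i)      = ℤₚ.≤-refl
    bound (ℤ.-[1+ i ]) = ℤ.-≤+

  -- A discrete intermediate value theorem; applied on a grid, it locates the positive root of the
  -- quadratic up to one mesh width.
  crossing : (f : ℕ → ℚ) → f 0 < 0ℚ → ∀ J → 0ℚ ≤ f J → ∃[ j ] (f j < 0ℚ × 0ℚ ≤ f (suc j))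
  crossing f f₀<0 zero    0≤fJ = contradiction 0≤fJ (<⇒≱ f₀<0)
  crossing f f₀<0 (suc J) 0≤fJ with f J <? 0ℚ
  ... | yes fJ<0 = J , fJ<0 , 0≤fJ
  ... | no  fJ≮0 = crossing f f₀<0 J (ℚₚ.≮⇒≥ fJ≮0)

  square-nonNeg : ∀ x → 0ℚ ≤ x * x
  square-nonNeg x with ℚₚ.≤-total 0ℚ x
  ... | inj₁ 0≤x = *-nonNeg 0≤x 0≤x
  ... | inj₂ x≤0 = subst (0ℚ ≤_) (solve 1 (λ x → (:- x) :* (:- x) := x :* x) refl x)
    (*-nonNeg (ℚₚ.neg-antimono-≤ x≤0) (ℚₚ.neg-antimono-≤ x≤0))

  squares : ∀ {N} → (Fin N → ℚ) → ℚ
  squares x = sum λ i → x i * x i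

  squares-nonNeg : ∀ {N} (x : Fin N → ℚ) → 0ℚ ≤ squares x
  squares-nonNeg {zero}  x = ℚₚ.≤-refl
  squares-nonNeg {suc N} x = +-nonNeg (square-nonNeg (x zero)) (squares-nonNeg (x ∘ suc))

  absSum : ∀ {N} → (Fin N → ℚ) → ℚ
  absSum x = sum λ i → ∣ x i ∣

  -- `B` limits what a nonpositive entry can add to the absolute sum, while `X` makes it expensive
  -- in the sum of squares and so limits how many such entries there are.
  BoundedBelow : ∀ {N} → ℚ → ℚ → (Fin N → ℚ) → Set
  BoundedBelow B X x = ∀ i → 0ℚ ≤ x i ⊎ (x i ≤ 0ℚ × - x i ≤ B × X < x i * x i)

  absSum-nonNeg : ∀ {N} {B X} (x : Fin N → ℚ) → BoundedBelow B X x → squares x < X → absSum x ≡ sum x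
  absSum-nonNeg {zero}  x low small = refl
  absSum-nonNeg {suc N} x low small with low zero
  ... | inj₁ 0≤x₀ = cong₂ _+_ (ℚₚ.0≤p⇒∣p∣≡p 0≤x₀) (absSum-nonNeg (x ∘ suc) (low ∘ suc)
        (ℚₚ.≤-<-trans (≤-excess (x zero * x zero) (square-nonNeg (x zero)) (ℚₚ.+-comm (squares (x ∘ suc)) _)) small))
  ... | inj₂ (_ , _ , X<x₀²) = contradiction
        (ℚₚ.<-≤-trans X<x₀² (≤-excess (squares (x ∘ suc)) (squares-nonNeg (x ∘ suc)) refl)) (ℚₚ.<-asym small)

  -- Two entries below zero would already contribute more than X + X to the squares.
  absSum-upper : ∀ {N} {B X} (x : Fin N → ℚ) → 0ℚ ≤ B → BoundedBelow B X x → squares x < X + X →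
    absSum x ≤ sum x + (B + B)
  absSum-upper {zero} {B} x 0≤B low small = ≤-excess (B + B) (+-nonNeg 0≤B 0≤B) refl
  absSum-upper {suc N} {B} {X} x 0≤B low small with low zero
  ... | inj₁ 0≤x₀ = subst₂ _≤_ (cong (_+ absSum (x ∘ suc)) (sym (ℚₚ.0≤p⇒∣p∣≡p 0≤x₀)))
        (sym (ℚₚ.+-assoc (x zero) (sum (x ∘ suc)) (B + B)))
        (ℚₚ.+-monoʳ-≤ (x zero) (absSum-upper (x ∘ suc) 0≤B (low ∘ suc)
          (ℚₚ.≤-<-trans (≤-excess (x zero * x zero) (square-nonNeg (x zero)) (ℚₚ.+-comm (squares (x ∘ suc)) _)) small)))
  ... | inj₂ (x₀≤0 , -x₀≤B , X<x₀²) = ≤-excess (B + B - (- x zero + - x zero))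
        (0≤-difference (ℚₚ.+-mono-≤ -x₀≤B -x₀≤B))
        (trans (cong₂ (λ u v → u + v + (B + B - (- x zero + - x zero))) ∣x₀∣ rest)
          (solve 3 (λ x s b → :- x :+ s :+ (b :+ b :- (:- x :+ :- x)) := x :+ s :+ (b :+ b)) refl (x zero) (sum (x ∘ suc)) B))
    where
    ∣x₀∣ : ∣ x zero ∣ ≡ - x zero
    ∣x₀∣ = trans (sym (ℚₚ.∣-p∣≡∣p∣ (x zero))) (ℚₚ.0≤p⇒∣p∣≡p (ℚₚ.neg-antimono-≤ x₀≤0))
    rest : absSum (x ∘ suc) ≡ sum (x ∘ suc)
    rest = absSum-nonNeg (x ∘ suc) (low ∘ suc) (ℚₚ.≰⇒> λ X≤rest →
      <⇒≱ small (ℚₚ.+-mono-≤ (ℚₚ.<⇒≤ X<x₀²) X≤rest))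

  p≤∣p∣ : ∀ p → p ≤ ∣ p ∣
  p≤∣p∣ p with ℚₚ.≤-total 0ℚ p
  ... | inj₁ 0≤p = ℚₚ.≤-reflexive (sym (ℚₚ.0≤p⇒∣p∣≡p 0≤p))
  ... | inj₂ p≤0 = ℚₚ.≤-trans p≤0 (ℚₚ.0≤∣p∣ p)

  -p≤∣p∣ : ∀ p → - p ≤ ∣ p ∣
  -p≤∣p∣ p = subst (- p ≤_) (ℚₚ.∣-p∣≡∣p∣ p) (p≤∣p∣ (- p))

  sum≤absSum : ∀ {N} (x : Fin N → ℚ) → sum x ≤ absSum x
  sum≤absSum {zero}  x = ℚₚ.≤-refl
  sum≤absSum {suc N} x = ℚₚ.+-mono-≤ (p≤∣p∣ (x zero)) (sum≤absSum (x ∘ suc))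

  -- The difference between absolute sum and sum is twice the total negative part, and entry `i`
  -- alone accounts for at least 2 R of it.
  absSum-lower : ∀ {N} (x : Fin N → ℚ) i R → R ≤ - x i → sum x + (R + R) ≤ absSum x
  absSum-lower x zero R R≤-x₀ = ℚₚ.≤-trans
    (≤-excess (- x zero + - x zero - (R + R)) (0≤-difference (ℚₚ.+-mono-≤ R≤-x₀ R≤-x₀))
      (solve 3 (λ x s r → x :+ s :+ (r :+ r) :+ (:- x :+ :- x :- (r :+ r)) := :- x :+ s) refl (x zero) (sum (x ∘ suc)) R))
    (ℚₚ.+-mono-≤ (-p≤∣p∣ (x zero)) (sum≤absSum (x ∘ suc)))
  absSum-lower x (suc i) R R≤-xᵢ = subst (_≤ absSum x) (sym (ℚₚ.+-assoc (x zero) (sum (x ∘ suc)) (R + R)))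
    (ℚₚ.+-mono-≤ (p≤∣p∣ (x zero)) (absSum-lower (x ∘ suc) i R R≤-xᵢ))

  negative-factor : ∀ {N} (f : Fin N → ℚ) → product f < 0ℚ → ∃[ i ] f i < 0ℚ
  negative-factor {zero}  f 1<0 = contradiction 0≤1 (<⇒≱ 1<0)
  negative-factor {suc N} f neg with f zero <? 0ℚ | product (f ∘ suc) <? 0ℚ
  ... | yes f₀<0 | _       = zero , f₀<0
  ... | no  _    | yes r<0 with negative-factor (f ∘ suc) r<0
  ...   | i , fᵢ<0 = suc i , fᵢ<0
  negative-factor {suc N} f neg | no f₀≮0 | no r≮0 =
    contradiction (*-nonNeg (ℚₚ.≮⇒≥ f₀≮0) (ℚₚ.≮⇒≥ r≮0)) (<⇒≱ neg)

  ½<1 : ½ < 1ℚ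
  ½<1 = toWitness {a? = ½ <? 1ℚ} tt

  -- The coefficients are abstract numbers here: their signs and the division identity carry the
  -- argument, and the expressions handed to the solver stay small.
  module Estimates (e₃ e₂ e₁ e₀ T D A₁ A₀ C₁ C₀ : ℚ)
    (0≤e₃ : 0ℚ ≤ e₃) (0≤e₂ : 0ℚ ≤ e₂) (0≤e₁ : 0ℚ ≤ e₁) (1≤e₀ : 1ℚ ≤ e₀) (1≤T : 1ℚ ≤ T) (1≤D : 1ℚ ≤ D)
    (0≤A₁ : 0ℚ ≤ A₁) (0≤A₀ : 0ℚ ≤ A₀) (0≤C₁ : 0ℚ ≤ C₁) (1≤C₀ : 1ℚ ≤ C₀)
    (division : ∀ y → quarticWith e₃ e₂ e₁ e₀ y ≡ cofactorWith A₁ A₀ y * quadraticWith T D y + (C₁ * y + C₀)) where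

    -- The threshold is chosen to make e₂ + e₃ y - y² nonnegative: below e₃ because y (e₃ - y) is,
    -- above e₃ because e₃ y is at least e₃². Hence every positive root has square greater than e₃²
    -- + e₂, the number to which `gap` is calibrated.
    quartic-low : ∀ y → 0ℚ ≤ y → y * y ≤ e₃ * e₃ + e₂ → quarticWith e₃ e₂ e₁ e₀ y ≤ - 1ℚ
    quartic-low y 0≤y y²≤X₀ = ≤-excess (y * y * z + e₁ * y + (e₀ - 1ℚ))
      (+-nonNeg (+-nonNeg (*-nonNeg (*-nonNeg 0≤y 0≤y) 0≤z) (*-nonNeg 0≤e₁ 0≤y)) (0≤-difference 1≤e₀))
      (solve 5 (λ y e₀ e₁ e₂ e₃ → y :* y :* (y :* y :- e₃ :* y :- e₂) :- e₁ :* y :- e₀ :+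
          (y :* y :* (e₂ :+ e₃ :* y :- y :* y) :+ e₁ :* y :+ (e₀ :- con 1ℚ)) := con (- 1ℚ)) refl y e₀ e₁ e₂ e₃)
      where
      z : ℚ
      z = e₂ + e₃ * y - y * y
      0≤z : 0ℚ ≤ z
      0≤z with ℚₚ.≤-total y e₃
      ... | inj₁ y≤e₃ = subst (0ℚ ≤_) (solve 3 (λ y e₂ e₃ → e₂ :+ y :* (e₃ :- y) := e₂ :+ e₃ :* y :- y :* y) refl y e₂ e₃)
            (+-nonNeg 0≤e₂ (*-nonNeg 0≤y (0≤-difference y≤e₃)))
      ... | inj₂ e₃≤y = subst (0ℚ ≤_)
            (solve 3 (λ y e₂ e₃ → (e₃ :* e₃ :+ e₂ :- y :* y) :+ e₃ :* (y :- e₃) := e₂ :+ e₃ :* y :- y :* y) refl y e₂ e₃)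
            (+-nonNeg (0≤-difference y²≤X₀) (*-nonNeg 0≤e₃ (0≤-difference e₃≤y)))

    excess≥1 : ∀ y → 0ℚ ≤ y → 1ℚ ≤ C₁ * y + C₀
    excess≥1 y 0≤y = subst (_≤ C₁ * y + C₀) (ℚₚ.+-identityˡ 1ℚ) (ℚₚ.+-mono-≤ (*-nonNeg 0≤C₁ 0≤y) 1≤C₀)

    0≤cofactor : ∀ y → 0ℚ ≤ y → 0ℚ ≤ cofactorWith A₁ A₀ y
    0≤cofactor y 0≤y = +-nonNeg (+-nonNeg (*-nonNeg 0≤y 0≤y) (*-nonNeg 0≤A₁ 0≤y)) 0≤A₀

    cofactor-mono : ∀ y z → 0ℚ ≤ y → y ≤ z → cofactorWith A₁ A₀ y ≤ cofactorWith A₁ A₀ z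
    cofactor-mono y z 0≤y y≤z = ℚₚ.+-monoˡ-≤ (A₀) (ℚₚ.+-mono-≤
      (*-mono-≤-nonNeg 0≤y (ℚₚ.≤-trans 0≤y y≤z) y≤z y≤z)
      (ℚₚ.*-monoˡ-≤-nonNeg (A₁) {{nonNegative 0≤A₁}} y≤z))

    0≤T : 0ℚ ≤ T
    0≤T = ℚₚ.≤-trans 0≤1 1≤T
    0≤D : 0ℚ ≤ D
    0≤D = ℚₚ.≤-trans 0≤1 1≤D

    quadratic-increasing : ∀ y z → T ≤ y → y ≤ z → quadraticWith T D y ≤ quadraticWith T D z
    quadratic-increasing y z T≤y y≤z = ≤-excess ((z - y) * (y - T + z))
      (*-nonNeg (0≤-difference y≤z) (+-nonNeg (0≤-difference T≤y) (ℚₚ.≤-trans (ℚₚ.≤-trans 0≤T T≤y) y≤z)))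
      (solve 4 (λ y z t d → y :* y :- t :* y :- d :+ (z :- y) :* (y :- t :+ z) := z :* z :- t :* z :- d) refl y z T D)

    quadratic≥0⇒T< : ∀ y → 0ℚ ≤ y → 0ℚ ≤ quadraticWith T D y → T < y
    quadratic≥0⇒T< y 0≤y 0≤q = ℚₚ.≰⇒> λ y≤T → <⇒≱ (ℚₚ.<-≤-trans (ℚₚ.positive⁻¹ 1ℚ) 1≤D)
      (≤-excess (quadraticWith T D y + y * (T - y)) (+-nonNeg 0≤q (*-nonNeg 0≤y (0≤-difference y≤T)))
        (solve 3 (λ y t d → d :+ (y :* y :- t :* y :- d :+ y :* (t :- y)) := con 0ℚ) refl y T D))

    -- An explicit upper bound for the positive root of the quadratic, whose value at T + D is D (T
    -- - 1 + D).
    B : ℚ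
    B = T + D

    0≤B : 0ℚ ≤ B
    0≤B = +-nonNeg 0≤T 0≤D

    quadratic-B : 0ℚ ≤ quadraticWith T D B
    quadratic-B = subst (0ℚ ≤_)
      (solve 2 (λ t d → d :* (t :- con 1ℚ :+ d) := (t :+ d) :* (t :+ d) :- t :* (t :+ d) :- d) refl T D)
      (*-nonNeg 0≤D (+-nonNeg (0≤-difference 1≤T) 0≤D))

    -- Here `B + 1ℚ` dominates R + δ. Within 2 δ below R + δ the quadratic drops by at most 2 δ
    -- times 2 (B + 1), so cofactor times drop is at most 4 δ `bound`; the 8 in `fine` makes this at
    -- most 1/2.
    bound : ℚ
    bound = (B + 1ℚ) * cofactorWith A₁ A₀ (B + 1ℚ)

    -- A mesh δ so fine that over an interval of length 2δ the product of the
    -- cofactor and the quadratic changes by at most 1/2.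
    module Mesh (δ : ℚ) (0≤δ : 0ℚ ≤ δ) (δ≤½ : δ ≤ ½) (fine : ι 8 * δ * bound ≤ 1ℚ) (R : ℚ) (0≤R : 0ℚ ≤ R)
      (below : quadraticWith T D R < 0ℚ) (above : 0ℚ ≤ quadraticWith T D (R + δ)) where

      private
        R⁺ : ℚ
        R⁺ = R + δ
        0≤R⁺ : 0ℚ ≤ R⁺
        0≤R⁺ = +-nonNeg 0≤R 0≤δ
        T<R⁺ : T < R⁺
        T<R⁺ = quadratic≥0⇒T< R⁺ 0≤R⁺ above
        R<B : R < B
        R<B = ℚₚ.≰⇒> λ B≤R → <⇒≱ below (ℚₚ.≤-trans quadratic-B
          (quadratic-increasing B R (≤-excess D 0≤D refl) B≤R))
        R⁺≤B+1 : R⁺ ≤ B + 1ℚ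
        R⁺≤B+1 = ℚₚ.+-mono-≤ (ℚₚ.<⇒≤ R<B) (ℚₚ.≤-trans δ≤½ (ℚₚ.<⇒≤ ½<1))

      -- R + δ exceeds T ≥ 1 while δ is at most 1/2. It keeps R - δ nonnegative, as a bound on
      -- absolute values must be.
      δ≤R : δ ≤ R
      δ≤R = ≤-excess (R⁺ - T + (T - 1ℚ) + ((½ - δ) + (½ - δ)))
        (+-nonNeg (+-nonNeg (0≤-difference (ℚₚ.<⇒≤ T<R⁺)) (0≤-difference 1≤T)) (+-nonNeg (0≤-difference δ≤½) (0≤-difference δ≤½)))
        (solve 3 (λ r δ t → δ :+ (r :+ δ :- t :+ (t :- con 1ℚ) :+ ((con ½ :- δ) :+ (con ½ :- δ))) := r) refl R δ T)

      -- Above R + δ both factors are nonnegative. Below it the drop of the quadratic from R⁺ = R +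
      -- δ to y factors as (R⁺ - y) (R⁺ - T + y), with first factor at most 2 δ. The loss of 1/2 is
      -- affordable because the remainder of the division is at least 1.
      product-lower : ∀ y → 0ℚ ≤ y → R - δ ≤ y → - ½ ≤ cofactorWith A₁ A₀ y * quadraticWith T D y
      product-lower y 0≤y R-δ≤y with ℚₚ.≤-total R⁺ y
      ... | inj₁ R⁺≤y = ℚₚ.≤-trans (ℚₚ.<⇒≤ (ℚₚ.negative⁻¹ (- ½)))
            (*-nonNeg (0≤cofactor y 0≤y) (ℚₚ.≤-trans above (quadratic-increasing R⁺ y (ℚₚ.<⇒≤ T<R⁺) R⁺≤y)))
      ... | inj₂ y≤R⁺ = ≤-excess (k * (q + w) + (½ - k * w))
            (+-nonNeg (*-nonNeg (0≤cofactor y 0≤y) 0≤q+w) (0≤-difference kw≤½))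
            (solve 3 (λ k q w → con (- ½) :+ (k :* (q :+ w) :+ (con ½ :- k :* w)) := k :* q) refl k q w)
        where
        M k k⁺ q w : ℚ
        M  = B + 1ℚ
        k  = cofactorWith A₁ A₀ y
        k⁺ = cofactorWith A₁ A₀ M
        q  = quadraticWith T D y
        w  = (δ + δ) * (M + M)
        0≤M : 0ℚ ≤ M
        0≤M = +-nonNeg 0≤B 0≤1
        0≤w : 0ℚ ≤ w
        0≤w = *-nonNeg (+-nonNeg 0≤δ 0≤δ) (+-nonNeg 0≤M 0≤M)
        ts≤w : (R⁺ - y) * (R⁺ - T + y) ≤ w
        ts≤w = *-mono-≤-nonNeg (0≤-difference y≤R⁺) (+-nonNeg 0≤M 0≤M)
          (≤-excess (y - (R - δ)) (0≤-difference R-δ≤y)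
            (solve 3 (λ r δ y → r :+ δ :- y :+ (y :- (r :- δ)) := δ :+ δ) refl R δ y))
          (ℚₚ.+-mono-≤ (ℚₚ.≤-trans (≤-excess {R⁺ - T} {R⁺} T 0≤T (solve 2 (λ r t → r :- t :+ t := r) refl R⁺ T)) R⁺≤B+1)
                       (ℚₚ.≤-trans y≤R⁺ R⁺≤B+1))
        0≤q+w : 0ℚ ≤ q + w
        0≤q+w = subst (0ℚ ≤_)
          (solve 5 (λ r y t d w → (r :* r :- t :* r :- d) :+ (w :- (r :- y) :* (r :- t :+ y)) := y :* y :- t :* y :- d :+ w)
            refl R⁺ y T D w)
          (+-nonNeg above (0≤-difference ts≤w))
        kw≤½ : k * w ≤ ½
        kw≤½ = ℚₚ.≤-trans
          (ℚₚ.*-monoʳ-≤-nonNeg w {{nonNegative 0≤w}} (cofactor-mono y M 0≤y (ℚₚ.≤-trans y≤R⁺ R⁺≤B+1)))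
          (≤-excess (½ * (1ℚ - ι 8 * δ * bound)) (*-nonNeg (ℚₚ.<⇒≤ (ℚₚ.positive⁻¹ ½)) (0≤-difference fine))
            (solve 3 (λ k m δ → k :* ((δ :+ δ) :* (m :+ m)) :+ con ½ :* (con 1ℚ :- con (ι 8) :* δ :* (m :* k)) := con ½)
              refl k⁺ M δ))

      quartic-high : ∀ y → 0ℚ ≤ y → R - δ ≤ y → ½ ≤ quarticWith e₃ e₂ e₁ e₀ y
      quartic-high y 0≤y R-δ≤y = subst (½ ≤_) (sym (division y))
        (ℚₚ.+-mono-≤ (product-lower y 0≤y R-δ≤y) (excess≥1 y 0≤y))

    -- `below` forces an eigenvalue of the complete hypergraph under -R, while `high` keeps every
    -- eigenvalue after the deletion above -(R - δ). The width δ left between the two becomes the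
    -- energy gap.
    record Separator : Set where
      field
        δ R       : ℚ
        0<δ       : 0ℚ < δ
        0≤R       : 0ℚ ≤ R
        δ≤R       : δ ≤ R
        below     : quadraticWith T D R < 0ℚ
        high      : ∀ y → 0ℚ ≤ y → R - δ ≤ y → ½ ≤ quarticWith e₃ e₂ e₁ e₀ y

    0≤bound : 0ℚ ≤ bound
    0≤bound = *-nonNeg (+-nonNeg 0≤B 0≤1) (0≤cofactor (B + 1ℚ) (+-nonNeg 0≤B 0≤1))

    module _ (K : ℕ) (δ : ℚ) (0<δ : 0ℚ < δ) (δK : δ * ι K ≡ 1ℚ) (2≤K : 2ℚ ≤ ι K) (8bound≤K : ι 8 * bound ≤ ι K) where
      private
        0≤δ : 0ℚ ≤ δ
        0≤δ = ℚₚ.<⇒≤ 0<δ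

        δ≤½ : δ ≤ ½
        δ≤½ = subst₂ _≤_ (solve 1 (λ δ → con ½ :* (δ :* con 2ℚ) := δ) refl δ)
          (trans (cong (½ *_) δK) (ℚₚ.*-identityʳ ½))
          (ℚₚ.*-monoˡ-≤-nonNeg ½ (ℚₚ.*-monoˡ-≤-nonNeg δ {{nonNegative 0≤δ}} 2≤K))

        fine : ι 8 * δ * bound ≤ 1ℚ
        fine = subst₂ _≤_ (solve 3 (λ e δ x → δ :* (e :* x) := e :* δ :* x) refl (ι 8) δ bound) δK
          (ℚₚ.*-monoˡ-≤-nonNeg δ {{nonNegative 0≤δ}} 8bound≤K)

        f : ℕ → ℚ
        f j = quadraticWith T D (ι j * δ)

        f₀<0 : f 0 < 0ℚ
        f₀<0 = subst (λ z → quadraticWith T D z < 0ℚ) (sym (ℚₚ.*-zeroˡ δ))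
          (subst (_< 0ℚ) (solve 2 (λ t d → :- d := con 0ℚ :* con 0ℚ :- t :* con 0ℚ :- d) refl T D)
            (ℚₚ.neg-antimono-< (ℚₚ.<-≤-trans (ℚₚ.positive⁻¹ 1ℚ) 1≤D)))

        B≤Jδ : ∀ J → B * ι K ≤ ι J → B ≤ ι J * δ
        B≤Jδ J BK≤J = ℚₚ.≤-trans (ℚₚ.≤-reflexive (trans (sym (ℚₚ.*-identityʳ B))
            (trans (cong (B *_) (trans (sym δK) (ℚₚ.*-comm δ (ι K)))) (sym (ℚₚ.*-assoc B (ι K) δ)))))
          (ℚₚ.*-monoʳ-≤-nonNeg δ {{nonNegative 0≤δ}} BK≤J)

        fromCrossing : ∃[ j ] (f j < 0ℚ × 0ℚ ≤ f (suc j)) → Separator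
        fromCrossing (j , below , above) = record
          { δ = δ ; R = ι j * δ ; 0<δ = 0<δ ; 0≤R = 0≤R ; δ≤R = δ≤R ; below = below ; high = quartic-high }
          where
          0≤R : 0ℚ ≤ ι j * δ
          0≤R = *-nonNeg (ι-nonNeg j) 0≤δ
          next : ι (suc j) * δ ≡ ι j * δ + δ
          next = trans (cong (_* δ) (ι-suc j)) (solve 2 (λ j δ → (con 1ℚ :+ j) :* δ := j :* δ :+ δ) refl (ι j) δ)
          open Mesh δ 0≤δ δ≤½ fine (ι j * δ) 0≤R below (subst (λ z → 0ℚ ≤ quadraticWith T D z) next above)

        f-nonNeg : ∀ J → B * ι K ≤ ι J → 0ℚ ≤ f J
        f-nonNeg J BK≤J = ℚₚ.≤-trans quadratic-B
          (quadratic-increasing B (ι J * δ) (≤-excess {T} {B} D 0≤D refl) (B≤Jδ J BK≤J))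

        fromBound : ∃[ J ] B * ι K ≤ ι J → Separator
        fromBound (J , BK≤J) = fromCrossing (crossing f f₀<0 J (f-nonNeg J BK≤J))

      separatorOfMesh : Separator
      separatorOfMesh = fromBound (archimedean (B * ι K))

    private
      -- A single integer `K` above 8 `bound` + 2 meets both demands on the mesh 1/K: at most 1/2
      -- wide, and `fine`.
      fromMesh : ∃[ K ] ι 8 * bound + 2ℚ ≤ ι K → Separator
      fromMesh (K , large) = separatorOfMesh K (1/ ι K) (ℚₚ.positive⁻¹ (1/ ι K) {{ℚₚ.1/pos⇒pos (ι K)}})
        (ℚₚ.*-inverseˡ (ι K)) 2≤K
        (ℚₚ.≤-trans (≤-excess {ι 8 * bound} {ι 8 * bound + 2ℚ} 2ℚ (ℚₚ.<⇒≤ (ℚₚ.positive⁻¹ 2ℚ)) refl) large)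
        where
        2≤K : 2ℚ ≤ ι K
        2≤K = ℚₚ.≤-trans (≤-excess {2ℚ} {ι 8 * bound + 2ℚ} (ι 8 * bound) (*-nonNeg (ι-nonNeg 8) 0≤bound)
          (ℚₚ.+-comm 2ℚ (ι 8 * bound))) large
        instance
          K-pos : Positive (ι K)
          K-pos = positive (ℚₚ.<-≤-trans (ℚₚ.positive⁻¹ 2ℚ) 2≤K)
          K-nonZero : NonZero (ι K)
          K-nonZero = ℚₚ.pos⇒nonZero (ι K)

    separator : Separator
    separator = fromMesh (archimedean (ι 8 * bound + 2ℚ))

  -- The numbers attached to m = 3 + a and n = 3 + b: p = 2n - 1 and r = 2m - 1 are
  -- eigenvalues with multiplicities 2 + a and 2 + b of the Seidel matrix of the
  -- complete hypergraph and y ↦ y² - T y - D carries the remaining two.  Deleting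
  -- an edge with two vertices in V₁ leaves a copies of p, 1 + b copies of r, one
  -- p - 2 and the quartic; with two vertices in V₂ the roles of a and b swap.
  record Profile (a b : ℕ) : Set where
    field
      p r e₃ e₂ e₁ e₀ T D A₁ A₀ C₁ C₀ gap : ℚ
      3≤p    : 1ℚ + 2ℚ ≤ p
      3≤r    : 1ℚ + 2ℚ ≤ r
      0≤e₃   : 0ℚ ≤ e₃
      0≤e₂   : 0ℚ ≤ e₂
      0≤e₁   : 0ℚ ≤ e₁
      1≤e₀   : 1ℚ ≤ e₀
      1≤T    : 1ℚ ≤ T
      1≤D    : 1ℚ ≤ D
      0≤A₁   : 0ℚ ≤ A₁
      0≤A₀   : 0ℚ ≤ A₀
      0≤C₁   : 0ℚ ≤ C₁
      1≤C₀   : 1ℚ ≤ C₀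
      1≤gap  : 1ℚ ≤ gap
      e₃-sum : e₃ ≡ ι a * p + (ι (suc b) * r + (p - 2ℚ))
      T-sum  : T ≡ ι (suc (suc a)) * p + ι (suc (suc b)) * r
      e₃-square : e₃ * e₃ ≡ ι a * (p * p) + (ι (suc b) * (r * r) + (p - 2ℚ) * (p - 2ℚ)) + gap
      division  : ∀ y → quarticWith e₃ e₂ e₁ e₀ y ≡ cofactorWith A₁ A₀ y * quadraticWith T D y + (C₁ * y + C₀)

  module Deleted {a b} (π : Profile a b) where
    open Profile π
    weight value : ℚ → ℚ
    weight y = (y + p) ^ a * (y + p - 2ℚ) * (y + r) ^ suc b
    value y = weight y * quarticWith e₃ e₂ e₁ e₀ y

  module Complete {a b} (π : Profile a b) where
    open Profile π
    weight value : ℚ → ℚ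
    weight y = (y + p) ^ suc (suc a) * (y + r) ^ suc (suc b)
    value y = weight y * quadraticWith T D y

  -- Coefficients of the two characteristic polynomials and the gap between the absolute sums.

  product-const : ∀ n z → product {n} (λ _ → z) ≡ z ^ n
  product-const zero    z = refl
  product-const (suc n) z = cong (z *_) (product-const n z)

  sum-const : ∀ n z → sum {n} (λ _ → z) ≡ ι n * z
  sum-const zero    z = sym (ℚₚ.*-zeroˡ z)
  sum-const (suc n) z = trans (cong (z +_) (sum-const n z))
    (trans (solve 2 (λ z k → z :+ k :* z := (con 1ℚ :+ k) :* z) refl z (ι n)) (cong (_* z) (sym (ι-suc n))))

  quarticCoefficients : (e₃ e₂ e₁ e₀ : ℚ) → ℕ → ℚ
  quarticCoefficients e₃ e₂ e₁ e₀ 0 = 1ℚ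
  quarticCoefficients e₃ e₂ e₁ e₀ 1 = - e₃
  quarticCoefficients e₃ e₂ e₁ e₀ 2 = - e₂
  quarticCoefficients e₃ e₂ e₁ e₀ 3 = - e₁
  quarticCoefficients e₃ e₂ e₁ e₀ 4 = - e₀
  quarticCoefficients e₃ e₂ e₁ e₀ (suc (suc (suc (suc (suc _))))) = 0ℚ

  quarticCoefficients-degree : ∀ e₃ e₂ e₁ e₀ → Degree≤ 4 (quarticCoefficients e₃ e₂ e₁ e₀)
  quarticCoefficients-degree e₃ e₂ e₁ e₀ (suc (suc (suc (suc (suc _))))) _ = refl
  quarticCoefficients-degree e₃ e₂ e₁ e₀ (suc (suc (suc (suc zero)))) (ℕ.s≤s (ℕ.s≤s (ℕ.s≤s (ℕ.s≤s ()))))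
  quarticCoefficients-degree e₃ e₂ e₁ e₀ (suc (suc (suc zero))) (ℕ.s≤s (ℕ.s≤s (ℕ.s≤s ())))
  quarticCoefficients-degree e₃ e₂ e₁ e₀ (suc (suc zero)) (ℕ.s≤s (ℕ.s≤s ()))
  quarticCoefficients-degree e₃ e₂ e₁ e₀ (suc zero) (ℕ.s≤s ())

  horner-quartic : ∀ e₃ e₂ e₁ e₀ y → horner (quarticCoefficients e₃ e₂ e₁ e₀) y 4 ≡ quarticWith e₃ e₂ e₁ e₀ y
  horner-quartic = solve 5 (λ e₃ e₂ e₁ e₀ y → (((con 1ℚ :* y :+ :- e₃) :* y :+ :- e₂) :* y :+ :- e₁) :* y :+ :- e₀ :=
    y :* y :* (y :* y :- e₃ :* y :- e₂) :- e₁ :* y :- e₀) refl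

  quadraticCoefficients : (t d : ℚ) → ℕ → ℚ
  quadraticCoefficients t d 0 = 1ℚ
  quadraticCoefficients t d 1 = - t
  quadraticCoefficients t d 2 = - d
  quadraticCoefficients t d (suc (suc (suc _))) = 0ℚ

  quadraticCoefficients-degree : ∀ t d → Degree≤ 2 (quadraticCoefficients t d)
  quadraticCoefficients-degree t d (suc (suc (suc _))) _ = refl
  quadraticCoefficients-degree t d (suc (suc zero)) (ℕ.s≤s (ℕ.s≤s ()))
  quadraticCoefficients-degree t d (suc zero) (ℕ.s≤s ())

  horner-quadratic : ∀ t d y → horner (quadraticCoefficients t d) y 2 ≡ quadraticWith t d y
  horner-quadratic = solve 3 (λ t d y → (con 1ℚ :* y :+ :- t) :* y :+ :- d := y :* y :- t :* y :- d) refl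

  eventually-all : ∀ {N} {Q : Fin N → ℕ → Set} → (∀ i → ∃[ K ] (∀ k → K ℕ.≤ k → Q i k)) →
    ∃[ K ] (∀ k → K ℕ.≤ k → ∀ i → Q i k)
  eventually-all {zero}  each = 0 , λ _ _ ()
  eventually-all {suc N} {Q} each with each zero | eventually-all {Q = Q ∘ suc} (each ∘ suc)
  ... | K , head | L , tail = K ℕ.⊔ L , λ
    { k K⊔L≤k zero    → head k (ℕₚ.m⊔n≤o⇒m≤o K L K⊔L≤k)
    ; k K⊔L≤k (suc i) → tail k (ℕₚ.m⊔n≤o⇒n≤o K L K⊔L≤k) i }

  ∣p∣<q⇒p<q : ∀ {p q} → ∣ p ∣ < q → p < q
  ∣p∣<q⇒p<q {p} = ℚₚ.≤-<-trans (p≤∣p∣ p)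

  ∣p∣<q⇒-q<p : ∀ {p q} → ∣ p ∣ < q → - q < p
  ∣p∣<q⇒-q<p {p} {q} ∣p∣<q = subst (- q <_) (solve 1 (λ p → :- (:- p) := p) refl p)
    (ℚₚ.neg-antimono-< (ℚₚ.≤-<-trans (-p≤∣p∣ p) ∣p∣<q))

  -- `x` approximates the eigenvalues after the deletion, `z` those of the complete hypergraph.
  -- `x-roots` speaks of nonpositive approximations, because the closed form of the characteristic
  -- polynomial is established for `y` ≥ 0.
  module Gap {a b : ℕ} (π : Profile a b) {N : ℕ} (N≡ : a ℕ.+ (suc b ℕ.+ (1 ℕ.+ 4)) ≡ N)
    (x z : ℕ → Fin N → ℚ)
    (x-values : ∀ y → 0ℚ ≤ y → Null (λ k → product (λ i → y + x k i) - Deleted.value π y))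
    (x-roots : ∀ i ε → 0ℚ < ε → ∃[ K ] (∀ k → K ℕ.≤ k → x k i ≤ 0ℚ → ∣ Deleted.value π (- x k i) ∣ < ε))
    (z-values : ∀ y → 0ℚ ≤ y → Null (λ k → product (λ i → y + z k i) - Complete.value π y)) where

    open Profile π
    private
      module E = Estimates e₃ e₂ e₁ e₀ T D A₁ A₀ C₁ C₀ 0≤e₃ 0≤e₂ 0≤e₁ 1≤e₀ 1≤T 1≤D 0≤A₁ 0≤A₀ 0≤C₁ 1≤C₀ division
      X₀ : ℚ
      X₀ = e₃ * e₃ + e₂

      1≤weight : ∀ y → 0ℚ ≤ y → 1ℚ ≤ Deleted.weight π y
      1≤weight y 0≤y = 1≤-* (1≤-* (1≤-^ a (shift≥1′ y 0≤y 3≤p)) (shift≥1 y 0≤y 3≤p)) (1≤-^ (suc b) (shift≥1′ y 0≤y 3≤r))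

      1≤weight′ : ∀ y → 0ℚ ≤ y → 1ℚ ≤ Complete.weight π y
      1≤weight′ y 0≤y = 1≤-* (1≤-^ (suc (suc a)) (shift≥1′ y 0≤y 3≤p)) (1≤-^ (suc (suc b)) (shift≥1′ y 0≤y 3≤r))

      -- The weight is at least 1, so a small value of the whole polynomial can only come from a
      -- small value of the quartic.
      value-far : ∀ y → 0ℚ ≤ y → ½ ≤ ∣ quarticWith e₃ e₂ e₁ e₀ y ∣ → ¬ ∣ Deleted.value π y ∣ < ½
      value-far y 0≤y ½≤∣q∣ small = <⇒≱ small (subst (½ ≤_)
        (sym (ℚₚ.∣p*q∣≡∣p∣*∣q∣ (Deleted.weight π y) (quarticWith e₃ e₂ e₁ e₀ y)))
        (*-mono-≤-nonNeg 0≤1 (ℚₚ.0≤∣p∣ (quarticWith e₃ e₂ e₁ e₀ y))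
          (ℚₚ.≤-trans (1≤weight y 0≤y) (p≤∣p∣ (Deleted.weight π y))) ½≤∣q∣))

      quarticₙ quadraticₙ deletedₙ deletedₙ₁ deletedₙ₂ completeₙ completeₙ₁ : ℕ → ℚ
      quarticₙ   = quarticCoefficients e₃ e₂ e₁ e₀
      quadraticₙ = quadraticCoefficients T D
      deletedₙ₁  = expand {1} (λ _ → p - 2ℚ) quarticₙ
      deletedₙ₂  = expand {suc b} (λ _ → r) deletedₙ₁
      deletedₙ   = expand {a} (λ _ → p) deletedₙ₂
      completeₙ₁ = expand {suc (suc b)} (λ _ → r) quadraticₙ
      completeₙ  = expand {suc (suc a)} (λ _ → p) completeₙ₁

      degree₁ : Degree≤ (1 ℕ.+ 4) deletedₙ₁
      degree₁ = expand-degree {1} (λ _ → p - 2ℚ) (quarticCoefficients-degree e₃ e₂ e₁ e₀)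
      degree₂ : Degree≤ (suc b ℕ.+ (1 ℕ.+ 4)) deletedₙ₂
      degree₂ = expand-degree {suc b} (λ _ → r) degree₁
      degree₃ : Degree≤ (suc (suc b) ℕ.+ 2) completeₙ₁
      degree₃ = expand-degree {suc (suc b)} (λ _ → r) (quadraticCoefficients-degree T D)

      monic₁ : deletedₙ₁ 0 ≡ 1ℚ
      monic₁ = expand-monic {1} (λ _ → p - 2ℚ) {quarticₙ} refl
      monic₂ : deletedₙ₂ 0 ≡ 1ℚ
      monic₂ = expand-monic {suc b} (λ _ → r) monic₁
      monic₃ : completeₙ₁ 0 ≡ 1ℚ
      monic₃ = expand-monic {suc (suc b)} (λ _ → r) {quadraticₙ} refl

      horner-deleted : ∀ y → horner deletedₙ y N ≡ Deleted.value π y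
      horner-deleted y = begin
        horner deletedₙ y N
          ≡⟨ cong (horner deletedₙ y) (sym N≡) ⟩
        horner deletedₙ y (a ℕ.+ (suc b ℕ.+ (1 ℕ.+ 4)))
          ≡⟨ horner-expand {a} (λ _ → p) degree₂ y ⟩
        product {a} (λ _ → y + p) * horner deletedₙ₂ y (suc b ℕ.+ (1 ℕ.+ 4))
          ≡⟨ cong₂ _*_ (product-const a (y + p)) (horner-expand {suc b} (λ _ → r) degree₁ y) ⟩
        (y + p) ^ a * (product {suc b} (λ _ → y + r) * horner deletedₙ₁ y (1 ℕ.+ 4))
          ≡⟨ cong (λ h → (y + p) ^ a * h) (cong₂ _*_ (product-const (suc b) (y + r))
               (trans (horner-expand {1} (λ _ → p - 2ℚ) (quarticCoefficients-degree e₃ e₂ e₁ e₀) y)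
                 (cong ((y + (p - 2ℚ)) * 1ℚ *_) (horner-quartic e₃ e₂ e₁ e₀ y)))) ⟩
        (y + p) ^ a * ((y + r) ^ suc b * ((y + (p - 2ℚ)) * 1ℚ * quarticWith e₃ e₂ e₁ e₀ y))
          ≡⟨ solve 5 (λ u v y p h → u :* (v :* ((y :+ (p :- con 2ℚ)) :* con 1ℚ :* h)) := u :* (y :+ p :- con 2ℚ) :* v :* h)
               refl ((y + p) ^ a) ((y + r) ^ suc b) y p (quarticWith e₃ e₂ e₁ e₀ y) ⟩
        Deleted.value π y ∎
        where open ≡-Reasoning

      N≡′ : suc (suc a) ℕ.+ (suc (suc b) ℕ.+ 2) ≡ N
      N≡′ = trans (ℕ-solve 2 (λ a b → conℕ 2 :+ℕ a :+ℕ (conℕ 2 :+ℕ b :+ℕ conℕ 2) :=ℕ a :+ℕ (conℕ 1 :+ℕ b :+ℕ conℕ 5)) refl a b) N≡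

      horner-complete : ∀ y → horner completeₙ y N ≡ Complete.value π y
      horner-complete y = begin
        horner completeₙ y N
          ≡⟨ cong (horner completeₙ y) (sym N≡′) ⟩
        horner completeₙ y (suc (suc a) ℕ.+ (suc (suc b) ℕ.+ 2))
          ≡⟨ horner-expand {suc (suc a)} (λ _ → p) degree₃ y ⟩
        product {suc (suc a)} (λ _ → y + p) * horner completeₙ₁ y (suc (suc b) ℕ.+ 2)
          ≡⟨ cong₂ _*_ (product-const (suc (suc a)) (y + p))
               (trans (horner-expand {suc (suc b)} (λ _ → r) (quadraticCoefficients-degree T D) y)
                 (cong₂ _*_ (product-const (suc (suc b)) (y + r)) (horner-quadratic T D y))) ⟩
        (y + p) ^ suc (suc a) * ((y + r) ^ suc (suc b) * quadraticWith T D y)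
          ≡⟨ sym (ℚₚ.*-assoc ((y + p) ^ suc (suc a)) ((y + r) ^ suc (suc b)) (quadraticWith T D y)) ⟩
        Complete.value π y ∎
        where open ≡-Reasoning

      deleted-trace : deletedₙ 1 ≡ 0ℚ
      deleted-trace = begin
        deletedₙ 1
          ≡⟨ expand-sum {a} (λ _ → p) monic₂ ⟩
        sum {a} (λ _ → p) + deletedₙ₂ 1
          ≡⟨ cong₂ _+_ (sum-const a p) (trans (expand-sum {suc b} (λ _ → r) monic₁)
               (cong₂ _+_ (sum-const (suc b) r) (expand-sum {1} (λ _ → p - 2ℚ) {quarticₙ} refl))) ⟩
        ι a * p + (ι (suc b) * r + (p - 2ℚ + 0ℚ + - e₃))
          ≡⟨ solve 4 (λ x y q e → x :+ (y :+ (q :+ con 0ℚ :+ :- e)) := x :+ (y :+ q) :- e) refl (ι a * p) (ι (suc b) * r) (p - 2ℚ) e₃ ⟩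
        ι a * p + (ι (suc b) * r + (p - 2ℚ)) - e₃
          ≡⟨ cong (_- e₃) (sym e₃-sum) ⟩
        e₃ - e₃
          ≡⟨ ℚₚ.+-inverseʳ e₃ ⟩
        0ℚ ∎
        where open ≡-Reasoning

      complete-trace : completeₙ 1 ≡ 0ℚ
      complete-trace = begin
        completeₙ 1
          ≡⟨ expand-sum {suc (suc a)} (λ _ → p) monic₃ ⟩
        sum {suc (suc a)} (λ _ → p) + completeₙ₁ 1
          ≡⟨ cong₂ _+_ (sum-const (suc (suc a)) p) (trans (expand-sum {suc (suc b)} (λ _ → r) {quadraticₙ} refl)
               (cong (_+ - T) (sum-const (suc (suc b)) r))) ⟩
        ι (suc (suc a)) * p + (ι (suc (suc b)) * r + - T)
          ≡⟨ sym (ℚₚ.+-assoc (ι (suc (suc a)) * p) (ι (suc (suc b)) * r) (- T)) ⟩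
        ι (suc (suc a)) * p + ι (suc (suc b)) * r - T
          ≡⟨ cong (_- T) (sym T-sum) ⟩
        T - T
          ≡⟨ ℚₚ.+-inverseʳ T ⟩
        0ℚ ∎
        where open ≡-Reasoning

      deleted-squares : squareSum deletedₙ + gap ≡ X₀ + X₀
      deleted-squares = begin
        squareSum deletedₙ + gap
          ≡⟨ cong (_+ gap) (trans (expand-squareSum {a} (λ _ → p) monic₂) (cong₂ _+_ (sum-const a (p * p))
               (trans (expand-squareSum {suc b} (λ _ → r) monic₁) (cong₂ _+_ (sum-const (suc b) (r * r))
                 (expand-squareSum {1} (λ _ → p - 2ℚ) {quarticₙ} refl))))) ⟩
        ι a * (p * p) + (ι (suc b) * (r * r) + ((p - 2ℚ) * (p - 2ℚ) + 0ℚ + (- e₃ * - e₃ - 2ℚ * - e₂))) + gap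
          ≡⟨ solve 6 (λ x y q e₃ e₂ g → x :+ (y :+ (q :+ con 0ℚ :+ ((:- e₃) :* (:- e₃) :- con 2ℚ :* (:- e₂)))) :+ g :=
               x :+ (y :+ q) :+ g :+ (e₃ :* e₃ :+ (e₂ :+ e₂))) refl
               (ι a * (p * p)) (ι (suc b) * (r * r)) ((p - 2ℚ) * (p - 2ℚ)) e₃ e₂ gap ⟩
        ι a * (p * p) + (ι (suc b) * (r * r) + (p - 2ℚ) * (p - 2ℚ)) + gap + (e₃ * e₃ + (e₂ + e₂))
          ≡⟨ cong (_+ (e₃ * e₃ + (e₂ + e₂))) (sym e₃-square) ⟩
        e₃ * e₃ + (e₃ * e₃ + (e₂ + e₂))
          ≡⟨ solve 2 (λ s e → s :+ (s :+ (e :+ e)) := s :+ e :+ (s :+ e)) refl (e₃ * e₃) e₂ ⟩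
        X₀ + X₀ ∎
        where open ≡-Reasoning

      module X = PowerSums x deletedₙ (expand-monic {a} (λ _ → p) monic₂) (λ t →
        Null-cong (λ k → cong (λ h → product (λ i → ι t + x k i) - h) (sym (horner-deleted (ι t)))) (x-values (ι t) (ι-nonNeg t)))
      module Z = PowerSums z completeₙ (expand-monic {suc (suc a)} (λ _ → p) monic₃) (λ t →
        Null-cong (λ k → cong (λ h → product (λ i → ι t + z k i) - h) (sym (horner-complete (ι t)))) (z-values (ι t) (ι-nonNeg t)))

      2≤N : 2 ℕ.≤ N
      2≤N = subst (2 ℕ.≤_) N≡′ (ℕ.s≤s (ℕ.s≤s ℕ.z≤n))
      1≤N : 1 ℕ.≤ N
      1≤N = ℕₚ.≤-trans (ℕ.s≤s ℕ.z≤n) 2≤N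

      x-sum : Null (λ k → sum (x k))
      x-sum = Null-cong (λ k → trans (cong (λ c → sum (x k) - c) deleted-trace) (ℚₚ.+-identityʳ (sum (x k)))) (X.sum-Null 1≤N)

      z-sum : Null (λ k → sum (z k))
      z-sum = Null-cong (λ k → trans (cong (λ c → sum (z k) - c) complete-trace) (ℚₚ.+-identityʳ (sum (z k)))) (Z.sum-Null 1≤N)

    module Separated (s : E.Separator) where
      open E.Separator s using (δ; R; 0<δ; 0≤R; δ≤R; below; high)

      -- A nonpositive approximate root u can lie neither where the quartic at -u is at least 1/2
      -- nor where it is at most -1. `high` and `quartic-low` describe these two regions, and what
      -- remains between them is the claim.
      located : ∀ u → (u ≤ 0ℚ → ∣ Deleted.value π (- u) ∣ < ½) → 0ℚ ≤ u ⊎ (u ≤ 0ℚ × - u ≤ R - δ × X₀ < u * u)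
      located u small with ℚₚ.≤-total 0ℚ u
      ... | inj₁ 0≤u = inj₁ 0≤u
      ... | inj₂ u≤0 = inj₂ (u≤0 , ℚₚ.<⇒≤ (ℚₚ.≰⇒> not-high) , ℚₚ.≰⇒> not-low)
        where
        0≤-u : 0ℚ ≤ - u
        0≤-u = ℚₚ.neg-antimono-≤ u≤0
        not-high : ¬ R - δ ≤ - u
        not-high R-δ≤-u = value-far (- u) 0≤-u (ℚₚ.≤-trans (high (- u) 0≤-u R-δ≤-u) (p≤∣p∣ _)) (small u≤0)
        not-low : ¬ u * u ≤ X₀
        not-low u²≤X₀ = value-far (- u) 0≤-u
          (ℚₚ.≤-trans (ℚₚ.<⇒≤ ½<1) (ℚₚ.≤-trans
            (ℚₚ.neg-antimono-≤ (E.quartic-low (- u) 0≤-u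
              (subst (_≤ X₀) (solve 1 (λ u → u :* u := (:- u) :* (:- u)) refl u) u²≤X₀)))
            (-p≤∣p∣ (quarticWith e₃ e₂ e₁ e₀ (- u)))))
          (small u≤0)

      -- Between 2 (R - δ) and 2 R lie 2 δ. The two traces, zero only in the limit, may consume η
      -- each, which leaves δ.
      η : ℚ
      η = ½ * δ
      0<η : 0ℚ < η
      0<η = *-pos (ℚₚ.positive⁻¹ ½) 0<δ

      x-upper : ∃[ K ] (∀ k → K ℕ.≤ k → absSum (x k) ≤ η + (R - δ + (R - δ)))
      x-upper =
        let K₁ , roots  = eventually-all (λ i → x-roots i ½ (ℚₚ.positive⁻¹ ½))
            K₂ , traces = x-sum η 0<η
            -- Tolerance 1 suffices since the limit stays below X₀ + X₀ by `gap`, which is at least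
            -- 1.
            K₃ , small  = X.squareSum-Null 2≤N deleted-trace 1ℚ (ℚₚ.positive⁻¹ 1ℚ)
        in K₁ ℕ.⊔ (K₂ ℕ.⊔ K₃) , λ k K≤k →
          let K₂⊔K₃≤k = ℕₚ.m⊔n≤o⇒n≤o K₁ (K₂ ℕ.⊔ K₃) K≤k
              roots-k = roots k (ℕₚ.m⊔n≤o⇒m≤o K₁ (K₂ ℕ.⊔ K₃) K≤k)
              sum<η   = ∣p∣<q⇒p<q (traces k (ℕₚ.m⊔n≤o⇒m≤o K₂ K₃ K₂⊔K₃≤k))
              small-k = ∣p∣<q⇒p<q (small k (ℕₚ.m⊔n≤o⇒n≤o K₂ K₃ K₂⊔K₃≤k))
          in ℚₚ.≤-trans
               (absSum-upper (x k) (0≤-difference δ≤R) (λ i → located (x k i) (roots-k i)) (squares-small (x k) small-k))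
               (ℚₚ.+-monoˡ-≤ (R - δ + (R - δ)) (ℚₚ.<⇒≤ sum<η))
        where
        squares-small : ∀ u → squares u - squareSum deletedₙ < 1ℚ → squares u < X₀ + X₀
        squares-small u small = subst₂ _<_
          (solve 2 (λ s c → s :- c :+ c := s) refl (squares u) (squareSum deletedₙ))
          (trans (ℚₚ.+-comm gap (squareSum deletedₙ)) deleted-squares)
          (ℚₚ.+-monoˡ-< (squareSum deletedₙ) (ℚₚ.<-≤-trans small 1≤gap))

      -- The polynomial is negative at R because the quadratic is. At late stages the product of the
      -- R + z k i is therefore negative and has a negative factor, whose index may depend on `k`.
      z-lower : ∃[ K ] (∀ k → K ℕ.≤ k → - η + (R + R) ≤ absSum (z k))
      z-lower =
        let K₁ , close  = z-values R 0≤R (- Complete.value π R) 0<-value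
            K₂ , traces = z-sum η 0<η
        in K₁ ℕ.⊔ K₂ , λ k K≤k →
          let sum>-η = ∣p∣<q⇒-q<p (traces k (ℕₚ.m⊔n≤o⇒n≤o K₁ K₂ K≤k))
              i , factor<0 = negative-factor (λ i → R + z k i)
                (below-zero (product λ i → R + z k i) (Complete.value π R)
                  (∣p∣<q⇒p<q (close k (ℕₚ.m⊔n≤o⇒m≤o K₁ K₂ K≤k))))
          in ℚₚ.≤-trans (ℚₚ.+-monoˡ-≤ (R + R) (ℚₚ.<⇒≤ sum>-η)) (absSum-lower (z k) i R (below-root (z k i) factor<0))
        where
        0<-value : 0ℚ < - Complete.value π R
        0<-value = subst (0ℚ <_) (sym (ℚₚ.neg-distribʳ-* (Complete.weight π R) (quadraticWith T D R)))
          (*-pos (ℚₚ.<-≤-trans (ℚₚ.positive⁻¹ 1ℚ) (1≤weight′ R 0≤R)) (ℚₚ.neg-antimono-< below))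
        below-zero : ∀ u v → u - v < - v → u < 0ℚ
        below-zero u v u-v<-v = subst₂ _<_ (solve 2 (λ u v → u :- v :+ v := u) refl u v) (ℚₚ.+-inverseˡ v) (ℚₚ.+-monoˡ-< v u-v<-v)
        below-root : ∀ u → R + u < 0ℚ → R ≤ - u
        below-root u R+u<0 = ≤-excess (- (R + u)) (ℚₚ.<⇒≤ (ℚₚ.neg-antimono-< R+u<0))
          (solve 2 (λ r u → r :+ :- (r :+ u) := :- u) refl R u)

      separated : ∃[ ε ] (0ℚ < ε × (∃[ K ] (∀ k → K ℕ.≤ k → absSum (x k) + ε ≤ absSum (z k))))
      separated =
        let K , upper = x-upper
            L , lower = z-lower
        in δ , 0<δ , K ℕ.⊔ L , λ k K≤k → ℚₚ.≤-trans
          (ℚₚ.+-monoˡ-≤ δ (upper k (ℕₚ.m⊔n≤o⇒m≤o K L K≤k)))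
          (ℚₚ.≤-trans (ℚₚ.≤-reflexive
            (solve 2 (λ δ r → con ½ :* δ :+ (r :- δ :+ (r :- δ)) :+ δ := :- (con ½ :* δ) :+ (r :+ r)) refl δ R))
            (lower k (ℕₚ.m⊔n≤o⇒n≤o K L K≤k)))

    gap-between-energies : ∃[ ε ] (0ℚ < ε × (∃[ K ] (∀ k → K ℕ.≤ k → absSum (x k) + ε ≤ absSum (z k))))
    gap-between-energies = Separated.separated E.separator

  -- Seidel matrices

  seq-∑ : ∀ {n} (f : Vector ℝ n) k → seq (∑ f) k ≡ sum λ i → seq (f i) k
  seq-∑ {zero}  f k = refl
  seq-∑ {suc n} f k = cong (seq (f zero) k +_) (seq-∑ (f ∘ suc) k)

  seq-∏ : ∀ {n} (f : Vector ℝ n) k → seq (∏ f) k ≡ product λ i → seq (f i) k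
  seq-∏ {zero}  f k = refl
  seq-∏ {suc n} f k = cong (seq (f zero) k *_) (seq-∏ (f ∘ suc) k)

  seq-sign : ∀ j k → seq (sign j) k ≡ signℚ j
  seq-sign zero    k = refl
  seq-sign (suc j) k = cong -_ (seq-sign j k)

  -- Operations on `ℝ` act stage by stage; a statement about a real characteristic polynomial thus
  -- becomes one about exact rational determinants.
  seq-det : ∀ {n} (A : Matrix n) k → seq (det A) k ≡ detℚ λ i j → seq (A i j) k
  seq-det {zero}  A k = refl
  seq-det {suc n} A k = trans (seq-∑ (λ j → sign (toℕ j) Defs.* (A zero j Defs.* det (λ i l → A (suc i) (punchIn j l)))) k)
    (sum-cong-≗ λ j → cong₂ (λ s d → s * (seq (A zero j) k * d)) (seq-sign (toℕ j) k)
      (seq-det (λ i l → A (suc i) (punchIn j l)) k))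

  entryℚ : ∀ {N} → Hypergraph N → Matrixℚ N
  entryℚ H i j = seidelEntry H i j / 1

  charMatrix : ∀ {N} → Hypergraph N → ℚ → Matrixℚ N
  charMatrix H x i j = diagonal (λ _ → x) i j - entryℚ H i j

  seq-charPoly : ∀ {N} (H : Hypergraph N) x k → seq (charPoly (seidel H) x) k ≡ detℚ (charMatrix H (seq x k))
  seq-charPoly H x k = trans (seq-det (λ i j → scalar x i j Defs.- seidel H i j) k)
    (detℚ-cong λ i j → cong (_- entryℚ H i j) (seq-scalar i j))
    where
    seq-scalar : ∀ i j → seq (scalar x i j) k ≡ diagonal (λ _ → seq x k) i j
    seq-scalar i j with i ≟ j
    ... | yes refl = sym (diagonal-at (λ _ → seq x k) i)
    ... | no  i≢j  = sym (diagonal-off (λ _ → seq x k) i j i≢j)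

  σ : ℕ → ℚ
  σ N = product {N} λ _ → - 1ℚ

  σ-square : ∀ N → σ N * σ N ≡ 1ℚ
  σ-square zero    = refl
  σ-square (suc N) = trans (solve 1 (λ s → con (- 1ℚ) :* s :* (con (- 1ℚ) :* s) := s :* s) refl (σ N)) (σ-square N)

  ∣σ∣ : ∀ N → ∣ σ N ∣ ≡ 1ℚ
  ∣σ∣ zero    = refl
  ∣σ∣ (suc N) = trans (ℚₚ.∣p*q∣≡∣p∣*∣q∣ (- 1ℚ) (σ N)) (trans (ℚₚ.*-identityˡ ∣ σ N ∣) (∣σ∣ N))

  product-negate : ∀ {N} y (x : Fin N → ℚ) → product (λ i → - y - x i) ≡ σ N * product (λ i → y + x i)
  product-negate {N} y x = trans
    (product-cong λ i → solve 2 (λ y x → :- y :- x := con (- 1ℚ) :* (y :+ x)) refl y (x i))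
    (product-distrib-* {N} (λ _ → - 1ℚ) (λ i → y + x i))

  product-zero : ∀ {N} (f : Fin N → ℚ) i → f i ≡ 0ℚ → product f ≡ 0ℚ
  product-zero f zero    f₀≡0 = trans (cong (_* product (f ∘ suc)) f₀≡0) (ℚₚ.*-zeroˡ (product (f ∘ suc)))
  product-zero f (suc i) fᵢ≡0 = trans (cong (f zero *_) (product-zero (f ∘ suc) i fᵢ≡0)) (ℚₚ.*-zeroʳ (f zero))

  module Spectrum {N : ℕ} (H : Hypergraph N) (F : ℚ → ℚ)
    (detF : ∀ y → 0ℚ ≤ y → detℚ (charMatrix H (- y)) ≡ σ N * F y)
    (ev : Vector ℝ N) (eigenvalues : Eigenvalues (seidel H) ev) where

    x : ℕ → Fin N → ℚ
    x k i = seq (ev i) k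

    private
      charPoly-Null : ∀ w → Null (λ k → detℚ (charMatrix H (seq w k)) - product (λ i → seq w k - x k i))
      charPoly-Null w = Null-cong
        (λ k → cong₂ _-_ (seq-charPoly H w k) (seq-∏ (λ i → w Defs.- ev i) k)) (eigenvalues w)

    -- The eigenvalue condition is used at the constant real -y, where the determinant is the same
    -- rational at every stage. The factor - σ N removes the common sign and restores the order of
    -- the difference.
    values : ∀ y → 0ℚ ≤ y → Null (λ k → product (λ i → y + x k i) - F y)
    values y 0≤y = Null-cong recover (Null-scale (- σ N) (charPoly-Null (fromℚ (- y))))
      where
      open ≡-Reasoning
      recover : ∀ k → - σ N * (detℚ (charMatrix H (- y)) - product (λ i → - y - x k i)) ≡ product (λ i → y + x k i) - F y
      recover k = begin
        - σ N * (detℚ (charMatrix H (- y)) - product (λ i → - y - x k i))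
          ≡⟨ cong₂ (λ u v → - σ N * (u - v)) (detF y 0≤y) (product-negate y (x k)) ⟩
        - σ N * (σ N * F y - σ N * product (λ i → y + x k i))
          ≡⟨ solve 3 (λ s f q → (:- s) :* (s :* f :- s :* q) := s :* s :* (q :- f)) refl (σ N) (F y) (product λ i → y + x k i) ⟩
        σ N * σ N * (product (λ i → y + x k i) - F y)
          ≡⟨ cong (_* (product (λ i → y + x k i) - F y)) (σ-square N) ⟩
        1ℚ * (product (λ i → y + x k i) - F y)
          ≡⟨ ℚₚ.*-identityˡ (product (λ i → y + x k i) - F y) ⟩
        product (λ i → y + x k i) - F y ∎

    -- Here the condition is used at the real `ev i` itself: at every stage the product contains the
    -- factor x k i - x k i, which is exactly zero, so the determinant alone has to tend to zero.
    roots : ∀ i ε → 0ℚ < ε → ∃[ K ] (∀ k → K ℕ.≤ k → x k i ≤ 0ℚ → ∣ F (- x k i) ∣ < ε)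
    roots i ε 0<ε with charPoly-Null (ev i) ε 0<ε
    ... | K , small = K , λ k K≤k x≤0 → subst (_< ε) (absolute k x≤0) (small k K≤k)
      where
      open ≡-Reasoning
      absolute : ∀ k → x k i ≤ 0ℚ →
        ∣ detℚ (charMatrix H (x k i)) - product (λ j → x k i - x k j) ∣ ≡ ∣ F (- x k i) ∣
      absolute k x≤0 = begin
        ∣ detℚ (charMatrix H (x k i)) - product (λ j → x k i - x k j) ∣
          ≡⟨ cong₂ (λ u v → ∣ detℚ (charMatrix H u) - v ∣) (solve 1 (λ u → u := :- (:- u)) refl (x k i))
               (product-zero (λ j → x k i - x k j) i (ℚₚ.+-inverseʳ (x k i))) ⟩
        ∣ detℚ (charMatrix H (- (- x k i))) - 0ℚ ∣
          ≡⟨ cong ∣_∣ (trans (ℚₚ.+-identityʳ _) (detF (- x k i) (ℚₚ.neg-antimono-≤ x≤0))) ⟩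
        ∣ σ N * F (- x k i) ∣
          ≡⟨ trans (ℚₚ.∣p*q∣≡∣p∣*∣q∣ (σ N) (F (- x k i))) (cong (_* ∣ F (- x k i) ∣) (∣σ∣ N)) ⟩
        1ℚ * ∣ F (- x k i) ∣
          ≡⟨ ℚₚ.*-identityˡ ∣ F (- x k i) ∣ ⟩
        ∣ F (- x k i) ∣ ∎

  entryℚ-diagonal : ∀ {N} (H : Hypergraph N) i → entryℚ H i i ≡ 0ℚ
  entryℚ-diagonal H i with i ≟ i
  ... | yes _   = refl
  ... | no  i≢i = contradiction refl i≢i

  entryℚ-off : ∀ {N} (H : Hypergraph N) i j → i ≢ j → entryℚ H i j ≡ 1ℚ + - 2ℚ * ι (codegree H i j)
  entryℚ-off H i j i≢j with i ≟ j
  ... | yes i≡j = contradiction i≡j i≢j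
  ... | no  _   = begin
    (ℤ.+ 1 ℤ.- ℤ.+ 2 ℤ.* ℤ.+ c) / 1
      ≡⟨ cong (λ z → (ℤ.+ 1 ℤ.+ z) / 1) (ℤₚ.neg-distribˡ-* (ℤ.+ 2) (ℤ.+ c)) ⟩
    (ℤ.+ 1 ℤ.+ ℤ.-[1+ 1 ] ℤ.* ℤ.+ c) / 1
      ≡⟨ /1-+ (ℤ.+ 1) (ℤ.-[1+ 1 ] ℤ.* ℤ.+ c) ⟩
    1ℚ + (ℤ.-[1+ 1 ] ℤ.* ℤ.+ c) / 1
      ≡⟨ cong (1ℚ +_) (/1-* ℤ.-[1+ 1 ] (ℤ.+ c)) ⟩
    1ℚ + - 2ℚ * ι c ∎
    where
    open ≡-Reasoning
    c = codegree H i j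

  charMatrix-diagonal : ∀ {N} (H : Hypergraph N) y i → charMatrix H (- y) i i ≡ - y
  charMatrix-diagonal H y i = trans (cong₂ _-_ (diagonal-at (λ _ → - y) i) (entryℚ-diagonal H i)) (ℚₚ.+-identityʳ (- y))

  charMatrix-off : ∀ {N} (H : Hypergraph N) y i j → i ≢ j → charMatrix H (- y) i j ≡ 2ℚ * ι (codegree H i j) - 1ℚ
  charMatrix-off H y i j i≢j = trans (cong₂ _-_ (diagonal-off (λ _ → - y) i j i≢j) (entryℚ-off H i j i≢j))
    (solve 1 (λ c → con 0ℚ :- (con 1ℚ :+ con (- 2ℚ) :* c) := con 2ℚ :* c :- con 1ℚ) refl (ι (codegree H i j)))

  ι-2+ : ∀ m n {c} → 2 ℕ.+ c ≡ m ℕ.+ n → ι c ≡ ι m + ι n - 2ℚ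
  ι-2+ m n {c} eq = trans
    (trans (solve 1 (λ c → c := con 2ℚ :+ c :- con 2ℚ) refl (ι c)) (cong (_- 2ℚ) (sym (ι-+ 2 c))))
    (cong (_- 2ℚ) (trans (cong ι eq) (ι-+ m n)))

  -- Off the diagonal the negated Seidel matrix has entries 2c - 1; the three equations give these
  -- for the co-degrees n, m and m + n - 2 of pairs inside V₁, inside V₂ and across.
  module Entries (m n : ℕ) (e : Subset (m ℕ.+ n)) (p r w : ℚ)
    (p≡ : p ≡ 2ℚ * ι n - 1ℚ) (r≡ : r ≡ 2ℚ * ι m - 1ℚ) (w≡ : w ≡ 2ℚ * (ι m + ι n - 2ℚ) - 1ℚ) where
    open TypedMatrix m n e p r w

    private C = completeBipartite³ m n

    private
      combine : (x₁ x₂ y₁ y₂ : ℚ) → ℚ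
      combine x₁ x₂ y₁ y₂ = x₁ * (p * y₁ + w * y₂) + x₂ * (w * y₁ + r * y₂)

      combine-cong : ∀ {x₁ x₂ y₁ y₂ x₁′ x₂′ y₁′ y₂′} → x₁ ≡ x₁′ → x₂ ≡ x₂′ → y₁ ≡ y₁′ → y₂ ≡ y₂′ →
        combine x₁ x₂ y₁ y₂ ≡ combine x₁′ x₂′ y₁′ y₂′
      combine-cong refl refl refl refl = refl

      l₁-left : ∀ i → l₁ (i ↑ˡ n) ≡ 1ℚ
      l₁-left i = cong [ const 1ℚ , const 0ℚ ]′ (splitAt-↑ˡ m i n)
      l₂-left : ∀ i → l₂ (i ↑ˡ n) ≡ 0ℚ
      l₂-left i = cong [ const 0ℚ , const 1ℚ ]′ (splitAt-↑ˡ m i n)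
      l₁-right : ∀ j → l₁ (m ↑ʳ j) ≡ 0ℚ
      l₁-right j = cong [ const 1ℚ , const 0ℚ ]′ (splitAt-↑ʳ m n j)
      l₂-right : ∀ j → l₂ (m ↑ʳ j) ≡ 1ℚ
      l₂-right j = cong [ const 0ℚ , const 1ℚ ]′ (splitAt-↑ʳ m n j)

    undistinguished : Matrixℚ (m ℕ.+ n)
    undistinguished i j = combine (l₁ i) (l₂ i) (l₁ j) (l₂ j)

    private
      by-sides : ∀ {i j} → Side m n i → Side m n j → i ≢ j → 2ℚ * ι (codegree C i j) - 1ℚ ≡ undistinguished i j
      by-sides (left i) (left j) i≢j = trans (cong (λ c → 2ℚ * ι c - 1ℚ) (codegree-left m n i≢j)) (trans (sym p≡) (trans
        (solve 3 (λ p w r → p := con 1ℚ :* (p :* con 1ℚ :+ w :* con 0ℚ) :+ con 0ℚ :* (w :* con 1ℚ :+ r :* con 0ℚ)) refl p w r)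
        (sym (combine-cong (l₁-left i) (l₂-left i) (l₁-left j) (l₂-left j)))))
      by-sides (left i) (right j) i≢j = trans (cong (λ c → 2ℚ * c - 1ℚ) (ι-2+ m n (codegree-leftRight m n i≢j))) (trans (sym w≡) (trans
        (solve 3 (λ p w r → w := con 1ℚ :* (p :* con 0ℚ :+ w :* con 1ℚ) :+ con 0ℚ :* (w :* con 0ℚ :+ r :* con 1ℚ)) refl p w r)
        (sym (combine-cong (l₁-left i) (l₂-left i) (l₁-right j) (l₂-right j)))))
      by-sides (right i) (left j) i≢j = trans (cong (λ c → 2ℚ * c - 1ℚ) (ι-2+ m n (codegree-rightLeft m n i≢j))) (trans (sym w≡) (trans
        (solve 3 (λ p w r → w := con 0ℚ :* (p :* con 1ℚ :+ w :* con 0ℚ) :+ con 1ℚ :* (w :* con 1ℚ :+ r :* con 0ℚ)) refl p w r)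
        (sym (combine-cong (l₁-right i) (l₂-right i) (l₁-left j) (l₂-left j)))))
      by-sides (right i) (right j) i≢j = trans (cong (λ c → 2ℚ * ι c - 1ℚ) (codegree-right m n i≢j)) (trans (sym r≡) (trans
        (solve 3 (λ p w r → r := con 0ℚ :* (p :* con 0ℚ :+ w :* con 1ℚ) :+ con 1ℚ :* (w :* con 0ℚ :+ r :* con 1ℚ)) refl p w r)
        (sym (combine-cong (l₁-right i) (l₂-right i) (l₁-right j) (l₂-right j)))))

    codegree-undistinguished : ∀ i j → i ≢ j → 2ℚ * ι (codegree C i j) - 1ℚ ≡ undistinguished i j
    codegree-undistinguished i j = by-sides (side m n i) (side m n j)

    lowRank-undistinguished : ∀ i j → lowRank i j ≡ undistinguished i j - 2ℚ * (ε i * ε j)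
    lowRank-undistinguished i j = solve 4 (λ u v s t → u :+ (v :+ (s :* (:- (con 2ℚ :* t)) :+ con 0ℚ)) := u :+ v :- con 2ℚ :* (s :* t))
      refl (l₁ i * (p * l₁ j + w * l₂ j)) (l₂ i * (w * l₁ j + r * l₂ j)) (ε i) (ε j)

    charMatrix-complete : (∀ i → ε i ≡ 0ℚ) → ∀ y i j → i ≢ j → charMatrix C (- y) i j ≡ lowRank i j
    charMatrix-complete ε≡0 y i j i≢j = trans (charMatrix-off C y i j i≢j) (trans (codegree-undistinguished i j i≢j)
      (sym (trans (lowRank-undistinguished i j) (trans (cong (λ s → undistinguished i j - 2ℚ * (s * ε j)) (ε≡0 i))
        (solve 2 (λ u t → u :- con 2ℚ :* (con 0ℚ :* t) := u) refl (undistinguished i j) (ε j))))))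

    charMatrix-deleteEdge : Edge C e → ∀ y i j → i ≢ j → charMatrix (deleteEdge C e) (- y) i j ≡ lowRank i j
    charMatrix-deleteEdge edge y i j i≢j = trans (charMatrix-off (deleteEdge C e) y i j i≢j) (begin
      2ℚ * ι c′ - 1ℚ
        ≡⟨ solve 2 (λ c b → con 2ℚ :* c :- con 1ℚ := con 2ℚ :* (b :+ c) :- con 1ℚ :- con 2ℚ :* b) refl (ι c′) (ε i * ε j) ⟩
      2ℚ * (ε i * ε j + ι c′) - 1ℚ - 2ℚ * (ε i * ε j)
        ≡⟨ cong (λ c → 2ℚ * c - 1ℚ - 2ℚ * (ε i * ε j)) (sym ι-codegree) ⟩
      2ℚ * ι (codegree C i j) - 1ℚ - 2ℚ * (ε i * ε j)
        ≡⟨ cong (_- 2ℚ * (ε i * ε j)) (codegree-undistinguished i j i≢j) ⟩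
      undistinguished i j - 2ℚ * (ε i * ε j)
        ≡⟨ sym (lowRank-undistinguished i j) ⟩
      lowRank i j ∎)
      where
      open ≡-Reasoning
      c′ : ℕ
      c′ = codegree (deleteEdge C e) i j
      ι-memberBit : ∀ i → ι (memberBit e i) ≡ ε i
      ι-memberBit i with lookup e i
      ... | true  = refl
      ... | false = refl
      ι-codegree : ι (codegree C i j) ≡ ε i * ε j + ι c′
      ι-codegree = trans (cong ι (codegree-deleteEdge C e edge i j))
        (trans (ι-+ (memberBit e i ℕ.* memberBit e j) c′) (cong (_+ ι c′)
          (trans (ι-* (memberBit e i) (memberBit e j)) (cong₂ _*_ (ι-memberBit i) (ι-memberBit j)))))

  ones-lookup : ∀ {n} (e : Subset n) → ones (lookup e) ≡ Subset.∣ e ∣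
  ones-lookup []          = refl
  ones-lookup (true  ∷ e) = cong suc (ones-lookup e)
  ones-lookup (false ∷ e) = ones-lookup e

  ones-↑ : ∀ m {n} (e : Subset (m ℕ.+ n)) →
    ones (λ (i : Fin m) → lookup e (i ↑ˡ n)) ℕ.+ ones (λ j → lookup e (m ↑ʳ j)) ≡ Subset.∣ e ∣
  ones-↑ zero    e           = ones-lookup e
  ones-↑ (suc m) (true  ∷ e) = cong suc (ones-↑ m e)
  ones-↑ (suc m) (false ∷ e) = ones-↑ m e

  ones-positive : ∀ {n} (b : Fin n → Bool) i → b i ≡ true → 1 ℕ.≤ ones b
  ones-positive b zero    b₀≡true rewrite b₀≡true = ℕ.s≤s ℕ.z≤n
  ones-positive b (suc i) bᵢ≡true = ℕₚ.≤-trans (ones-positive (b ∘ suc) i bᵢ≡true) (ℕₚ.m≤n+m _ _)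

  ones-none : ∀ {n} (b : Fin n → Bool) → (∀ i → b i ≡ false) → ones b ≡ 0
  ones-none {zero}  b none = refl
  ones-none {suc n} b none rewrite none zero = ones-none (b ∘ suc) (none ∘ suc)

  zeros-from : ∀ {m k j} (b : Fin m → Bool) → ones b ≡ k → j ℕ.+ k ≡ m → zeros b ≡ j
  zeros-from {m} {k} {j} b ones≡k j+k≡m = ℕₚ.+-cancelʳ-≡ k (zeros b) j
    (trans (cong (zeros b ℕ.+_) (sym ones≡k)) (trans (zeros+ones b) (sym j+k≡m)))

  profile : ∀ a b → Profile a b
  profile a b = record
    { p  = pₚ at ι a , ι b
    ; r  = rₚ at ι a , ι b
    ; e₃ = E₃ₚ at ι a , ι b
    ; e₂ = E₂ₚ at ι a , ι b
    ; e₁ = E₁ₚ at ι a , ι b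
    ; e₀ = E₀ₚ at ι a , ι b
    ; T  = Tₚ at ι a , ι b
    ; D  = Dₚ at ι a , ι b
    ; A₁ = A₁ₚ at ι a , ι b
    ; A₀ = A₀ₚ at ι a , ι b
    ; C₁ = C₁ₚ at ι a , ι b
    ; C₀ = C₀ₚ at ι a , ι b
    ; gap = Gapₚ at ι a , ι b
    ; 3≤p  = ≤-excess (ι b + ι b + 2ℚ) (+-nonNeg (+-nonNeg 0≤b 0≤b) (ℚₚ.<⇒≤ (ℚₚ.positive⁻¹ 2ℚ)))
        (solve 1 (λ b → con (1ℚ + 2ℚ) :+ (b :+ b :+ con 2ℚ) := b :+ b :+ con (ι 5)) refl (ι b))
    ; 3≤r  = ≤-excess (ι a + ι a + 2ℚ) (+-nonNeg (+-nonNeg 0≤a 0≤a) (ℚₚ.<⇒≤ (ℚₚ.positive⁻¹ 2ℚ)))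
        (solve 1 (λ a → con (1ℚ + 2ℚ) :+ (a :+ a :+ con 2ℚ) := a :+ a :+ con (ι 5)) refl (ι a))
    ; 0≤e₃ = evaluate≥0 (E₃ₚ (var 0F) (var 1F)) 0≤ρ tt
    ; 0≤e₂ = evaluate≥0 (E₂ₚ (var 0F) (var 1F)) 0≤ρ tt
    ; 0≤e₁ = evaluate≥0 (E₁ₚ (var 0F) (var 1F)) 0≤ρ tt
    ; 1≤e₀ = evaluate≥1 (E₀ₚ (var 0F) (var 1F)) 0≤ρ tt
    ; 1≤T  = evaluate≥1 (Tₚ (var 0F) (var 1F)) 0≤ρ tt
    ; 1≤D  = evaluate≥1 (Dₚ (var 0F) (var 1F)) 0≤ρ tt
    ; 0≤A₁ = evaluate≥0 (A₁ₚ (var 0F) (var 1F)) 0≤ρ tt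
    ; 0≤A₀ = evaluate≥0 (A₀ₚ (var 0F) (var 1F)) 0≤ρ tt
    ; 0≤C₁ = evaluate≥0 (C₁ₚ (var 0F) (var 1F)) 0≤ρ tt
    ; 1≤C₀ = evaluate≥1 (C₀ₚ (var 0F) (var 1F)) 0≤ρ tt
    ; 1≤gap = evaluate≥1 (Gapₚ (var 0F) (var 1F)) 0≤ρ tt
    ; e₃-sum = trans (E₃-trace (ι a) (ι b)) (trans (ℚₚ.+-assoc (ι a * P) ((1ℚ + ι b) * R) (P - 2ℚ))
        (cong (λ z → ι a * P + (z * R + (P - 2ℚ))) (sym (ι-suc b))))
    ; T-sum = trans (T-trace (ι a) (ι b)) (cong₂ (λ y z → y * P + z * R) (ι-2+suc a) (ι-2+suc b))
    ; e₃-square = trans (E₃-square (ι a) (ι b)) (cong (_+ Gapₚ at ι a , ι b)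
        (trans (ℚₚ.+-assoc (ι a * (P * P)) ((1ℚ + ι b) * (R * R)) ((P - 2ℚ) * (P - 2ℚ)))
          (cong (λ z → ι a * (P * P) + (z * (R * R) + (P - 2ℚ) * (P - 2ℚ))) (sym (ι-suc b)))))
    ; division = quartic-division (ι a) (ι b)
    }
    where
    P R : ℚ
    P = pₚ at ι a , ι b
    R = rₚ at ι a , ι b
    0≤a : 0ℚ ≤ ι a
    0≤a = ι-nonNeg a
    0≤b : 0ℚ ≤ ι b
    0≤b = ι-nonNeg b
    0≤ρ : All (0ℚ ≤_) (ι a ∷ ι b ∷ [])
    0≤ρ = 0≤a ∷ 0≤b ∷ []
    ι-2+suc : ∀ c → 1ℚ + (1ℚ + ι c) ≡ ι (suc (suc c))
    ι-2+suc c = trans (cong (1ℚ +_) (sym (ι-suc c))) (sym (ι-suc (suc c)))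

  inverse : ∀ z → 1ℚ ≤ z → ∃[ u ] z * u ≡ 1ℚ
  inverse z 1≤z = 1/ z , ℚₚ.*-inverseʳ z
    where
    instance
      z-nonZero : NonZero z
      z-nonZero = ℚₚ.pos⇒nonZero z {{positive (ℚₚ.<-≤-trans (ℚₚ.positive⁻¹ 1ℚ) 1≤z)}}

  cancel-inverse : ∀ z k u → z * u ≡ 1ℚ → z * (k * u) ≡ k
  cancel-inverse z k u zu≡1 = trans (solve 3 (λ z k u → z :* (k :* u) := k :* (z :* u)) refl z k u)
    (trans (cong (k *_) zu≡1) (ℚₚ.*-identityʳ k))

  numerator-cong : ∀ P P′ R R′ p r w {κ₁ γ₁ κ₂ γ₂ κ₁′ γ₁′ κ₂′ γ₂′} → κ₁ ≡ κ₁′ → γ₁ ≡ γ₁′ → κ₂ ≡ κ₂′ → γ₂ ≡ γ₂′ →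
    numerator P P′ R R′ κ₁ γ₁ κ₂ γ₂ p r w ≡ numerator P P′ R R′ κ₁′ γ₁′ κ₂′ γ₂′ p r w
  numerator-cong P P′ R R′ p r w refl refl refl refl = refl

  -- The characteristic polynomials of both hypergraphs at `y` ≥ 0.

  module CharacteristicPolynomials (m n a b : ℕ) (m≡ : 3 ℕ.+ a ≡ m) (n≡ : 3 ℕ.+ b ≡ n) where
    private
      N : ℕ
      N = m ℕ.+ n

    p r w : ℚ
    p = pₚ at ι a , ι b
    r = rₚ at ι a , ι b
    w = wₚ at ι a , ι b

    private
      C = completeBipartite³ m n

    ι-3+ : ∀ c → ι (suc (suc (suc c))) ≡ 1ℚ + (1ℚ + (1ℚ + ι c))
    ι-3+ c = trans (ι-suc (suc (suc c))) (cong (1ℚ +_) (trans (ι-suc (suc c)) (cong (1ℚ +_) (ι-suc c))))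

    ι-m : ι m ≡ 1ℚ + (1ℚ + (1ℚ + ι a))
    ι-m = trans (cong ι (sym m≡)) (ι-3+ a)

    ι-n : ι n ≡ 1ℚ + (1ℚ + (1ℚ + ι b))
    ι-n = trans (cong ι (sym n≡)) (ι-3+ b)

    p≡ : p ≡ 2ℚ * ι n - 1ℚ
    p≡ = trans (solve 1 (λ b → b :+ b :+ con (ι 5) := con 2ℚ :* (con 1ℚ :+ (con 1ℚ :+ (con 1ℚ :+ b))) :- con 1ℚ) refl (ι b))
      (cong (λ z → 2ℚ * z - 1ℚ) (sym ι-n))

    r≡ : r ≡ 2ℚ * ι m - 1ℚ
    r≡ = trans (solve 1 (λ a → a :+ a :+ con (ι 5) := con 2ℚ :* (con 1ℚ :+ (con 1ℚ :+ (con 1ℚ :+ a))) :- con 1ℚ) refl (ι a))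
      (cong (λ z → 2ℚ * z - 1ℚ) (sym ι-m))

    w≡ : w ≡ 2ℚ * (ι m + ι n - 2ℚ) - 1ℚ
    w≡ = trans (solve 2 (λ a b → a :+ a :+ (b :+ b) :+ con (ι 7) :=
        con 2ℚ :* (con 1ℚ :+ (con 1ℚ :+ (con 1ℚ :+ a)) :+ (con 1ℚ :+ (con 1ℚ :+ (con 1ℚ :+ b))) :- con 2ℚ) :- con 1ℚ) refl (ι a) (ι b))
      (cong₂ (λ y z → 2ℚ * (y + z - 2ℚ) - 1ℚ) (sym ι-m) (sym ι-n))

    module At (y : ℚ) (0≤y : 0ℚ ≤ y) where
      P P′ R R′ : ℚ
      P  = y + p
      P′ = y + p - 2ℚ
      R  = y + r
      R′ = y + r - 2ℚ

      module Inverses (u u′ v v′ : ℚ) (Pu : P * u ≡ 1ℚ) (P′u′ : P′ * u′ ≡ 1ℚ) (Rv : R * v ≡ 1ℚ) (R′v′ : R′ * v′ ≡ 1ℚ) where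

        -- The determinant depends on the distinguished set only through these four counts, so the
        -- actual position of the edge disappears here.
        shiftedValue : (z₁ o₁ z₂ o₂ : ℕ) → ℚ
        shiftedValue z₁ o₁ z₂ o₂ = P ^ z₁ * P′ ^ o₁ * (R ^ z₂ * R′ ^ o₂) *
          reducedDet p r w (ι z₁ * u) (ι o₁ * u′) (ι z₂ * v) (ι o₂ * v′)

        shiftedValue-cong : ∀ {z₁ o₁ z₂ o₂ z₁′ o₁′ z₂′ o₂′} → z₁ ≡ z₁′ → o₁ ≡ o₁′ → z₂ ≡ z₂′ → o₂ ≡ o₂′ →
          shiftedValue z₁ o₁ z₂ o₂ ≡ shiftedValue z₁′ o₁′ z₂′ o₂′
        shiftedValue-cong refl refl refl refl = refl

        numerator-value : ∀ z₁ o₁ z₂ o₂ →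
          P * P′ * R * R′ * reducedDet p r w (ι z₁ * u) (ι o₁ * u′) (ι z₂ * v) (ι o₂ * v′) ≡
          numerator P P′ R R′ (ι z₁) (ι o₁) (ι z₂) (ι o₂) p r w
        numerator-value z₁ o₁ z₂ o₂ = trans
          (clear-denominators P P′ R R′ (ι z₁ * u) (ι o₁ * u′) (ι z₂ * v) (ι o₂ * v′) p r w)
          (numerator-cong P P′ R R′ p r w (cancel-inverse P (ι z₁) u Pu) (cancel-inverse P′ (ι o₁) u′ P′u′)
            (cancel-inverse R (ι z₂) v Rv) (cancel-inverse R′ (ι o₂) v′ R′v′))

        -- One factor each of P, P′, R and R′ clears the denominators of the reduced determinant and
        -- produces the quartic; the powers left over form the weight.
        value-left : shiftedValue (suc a) 2 (suc (suc b)) 1 ≡ Deleted.value (profile a b) y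
        value-left = begin
          shiftedValue (suc a) 2 (suc (suc b)) 1
            ≡⟨ solve 7 (λ P P′ R R′ A B Z → P :* A :* (P′ :* (P′ :* con 1ℚ)) :* (R :* (R :* B) :* (R′ :* con 1ℚ)) :* Z :=
                 A :* P′ :* (R :* B) :* (P :* P′ :* R :* R′ :* Z)) refl P P′ R R′ (P ^ a) (R ^ b) Z ⟩
          P ^ a * P′ * R ^ suc b * (P * P′ * R * R′ * Z)
            ≡⟨ cong (P ^ a * P′ * R ^ suc b *_) (trans (numerator-value (suc a) 2 (suc (suc b)) 1) (trans
                 (numerator-cong P P′ R R′ p r w (ι-suc a) refl (trans (ι-suc (suc b)) (cong (1ℚ +_) (ι-suc b))) refl)
                 (numerator-quartic (ι a) (ι b) y))) ⟩
          P ^ a * P′ * R ^ suc b * quartic (ι a) (ι b) y ∎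
          where
          open ≡-Reasoning
          Z : ℚ
          Z = reducedDet p r w (ι (suc a) * u) (ι 2 * u′) (ι (suc (suc b)) * v) (ι 1 * v′)

        value-right : shiftedValue (suc (suc a)) 1 (suc b) 2 ≡ Deleted.value (profile b a) y
        value-right = begin
          shiftedValue (suc (suc a)) 1 (suc b) 2
            ≡⟨ solve 7 (λ P P′ R R′ A B Z → P :* (P :* A) :* (P′ :* con 1ℚ) :* (R :* B :* (R′ :* (R′ :* con 1ℚ))) :* Z :=
                 B :* R′ :* (P :* A) :* (P :* P′ :* R :* R′ :* Z)) refl P P′ R R′ (P ^ a) (R ^ b) Z ⟩
          R ^ b * R′ * P ^ suc a * (P * P′ * R * R′ * Z)
            ≡⟨ cong (R ^ b * R′ * P ^ suc a *_) (trans (numerator-value (suc (suc a)) 1 (suc b) 2) (trans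
                 (numerator-cong P P′ R R′ p r w (trans (ι-suc (suc a)) (cong (1ℚ +_) (ι-suc a))) refl (ι-suc b) refl)
                 (numerator-quartic-swapped (ι a) (ι b) y))) ⟩
          R ^ b * R′ * P ^ suc a * quartic (ι b) (ι a) y ∎
          where
          open ≡-Reasoning
          Z : ℚ
          Z = reducedDet p r w (ι (suc (suc a)) * u) (ι 1 * u′) (ι (suc b) * v) (ι 2 * v′)

        value-complete : shiftedValue m 0 n 0 ≡ Complete.value (profile a b) y
        value-complete = begin
          shiftedValue m 0 n 0
            ≡⟨ cong₂ (λ s t → shiftedValue s 0 t 0) (sym m≡) (sym n≡) ⟩
          shiftedValue (3 ℕ.+ a) 0 (3 ℕ.+ b) 0
            ≡⟨ cong₂ (λ x z → P ^ (3 ℕ.+ a) * 1ℚ * (R ^ (3 ℕ.+ b) * 1ℚ) * reducedDet p r w (ι (3 ℕ.+ a) * u) x (ι (3 ℕ.+ b) * v) z) (ℚₚ.*-zeroˡ u′) (ℚₚ.*-zeroˡ v′) ⟩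
          P ^ (3 ℕ.+ a) * 1ℚ * (R ^ (3 ℕ.+ b) * 1ℚ) * Z
            ≡⟨ solve 5 (λ P R A B Z → P :* A :* con 1ℚ :* (R :* B :* con 1ℚ) :* Z := A :* B :* (P :* R :* Z)) refl
                 P R (P ^ suc (suc a)) (R ^ suc (suc b)) Z ⟩
          P ^ suc (suc a) * R ^ suc (suc b) * (P * R * Z)
            ≡⟨ cong (P ^ suc (suc a) * R ^ suc (suc b) *_) (trans (clear-denominators₀ P R (ι (3 ℕ.+ a) * u) (ι (3 ℕ.+ b) * v) p r w) (trans
                 (cong₂ (λ s t → (P - p * s) * (R - r * t) - w * w * (s * t))
                   (trans (cancel-inverse P (ι (3 ℕ.+ a)) u Pu) (ι-3+ a)) (trans (cancel-inverse R (ι (3 ℕ.+ b)) v Rv) (ι-3+ b)))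
                 (quadratic-numerator (ι a) (ι b) y))) ⟩
          P ^ suc (suc a) * R ^ suc (suc b) * quadratic (ι a) (ι b) y ∎
          where
          open ≡-Reasoning
          Z : ℚ
          Z = reducedDet p r w (ι (3 ℕ.+ a) * u) 0ℚ (ι (3 ℕ.+ b) * v) 0ℚ

        detℚ-value : (e : Subset N) (H : Hypergraph N) →
          (∀ i j → i ≢ j → charMatrix H (- y) i j ≡ TypedMatrix.lowRank m n e p r w i j) →
          detℚ (charMatrix H (- y)) ≡ σ N * shiftedValue
            (zeros (TypedMatrix.e₁ m n e p r w)) (ones (TypedMatrix.e₁ m n e p r w))
            (zeros (TypedMatrix.e₂ m n e p r w)) (ones (TypedMatrix.e₂ m n e p r w))
        detℚ-value e H off = TypedMatrix.detℚ-shifted m n e p r w y u u′ v v′ Pu P′u′ Rv R′v′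
          (charMatrix H (- y)) (charMatrix-diagonal H y) off

        detℚ-complete : detℚ (charMatrix C (- y)) ≡ σ N * Complete.value (profile a b) y
        detℚ-complete = trans
          (detℚ-value ⊥ C (Entries.charMatrix-complete m n ⊥ p r w p≡ r≡ w≡ (λ i → cong bit (lookup-replicate i false)) y))
          (cong (σ N *_) (trans
            (shiftedValue-cong (zeros-from e₁ none₁ (ℕₚ.+-identityʳ m)) none₁ (zeros-from e₂ none₂ (ℕₚ.+-identityʳ n)) none₂)
            value-complete))
          where
          open TypedMatrix m n ⊥ p r w using (e₁; e₂)
          none₁ : ones e₁ ≡ 0
          none₁ = ones-none e₁ λ i → lookup-replicate (i ↑ˡ n) false
          none₂ : ones e₂ ≡ 0
          none₂ = ones-none e₂ λ j → lookup-replicate (m ↑ʳ j) false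

        module _ (e : Subset N) (edge : Edge C e) where
          open TypedMatrix m n e p r w using (e₁; e₂)

          detℚ-deleteEdge : ∀ {z₁ o₁ z₂ o₂} → ones e₁ ≡ o₁ → ones e₂ ≡ o₂ → z₁ ℕ.+ o₁ ≡ m → z₂ ℕ.+ o₂ ≡ n →
            detℚ (charMatrix (deleteEdge C e) (- y)) ≡ σ N * shiftedValue z₁ o₁ z₂ o₂
          detℚ-deleteEdge ones₁ ones₂ size₁ size₂ = trans
            (detℚ-value e (deleteEdge C e) (Entries.charMatrix-deleteEdge m n e p r w p≡ r≡ w≡ edge y))
            (cong (σ N *_) (shiftedValue-cong (zeros-from e₁ ones₁ size₁) ones₁ (zeros-from e₂ ones₂ size₂) ones₂))

      3≤p : 1ℚ + 2ℚ ≤ p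
      3≤p = Profile.3≤p (profile a b)
      3≤r : 1ℚ + 2ℚ ≤ r
      3≤r = Profile.3≤r (profile a b)

      -- As `y` ≥ 0 and `p`, `r` are at least 3, all four shifts are at least 1, hence invertible
      -- even after the subtraction of 2.
      withInverses : {A : Set} → ((u u′ v v′ : ℚ) → P * u ≡ 1ℚ → P′ * u′ ≡ 1ℚ → R * v ≡ 1ℚ → R′ * v′ ≡ 1ℚ → A) → A
      withInverses f =
        let u , Pu = inverse P (shift≥1′ y 0≤y 3≤p)
            u′ , P′u′ = inverse P′ (shift≥1 y 0≤y 3≤p)
            v , Rv = inverse R (shift≥1′ y 0≤y 3≤r)
            v′ , R′v′ = inverse R′ (shift≥1 y 0≤y 3≤r)
        in f u u′ v v′ Pu P′u′ Rv R′v′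

    complete-value : ∀ y → 0ℚ ≤ y → detℚ (charMatrix C (- y)) ≡ σ N * Complete.value (profile a b) y
    complete-value y 0≤y = withInverses λ u u′ v v′ Pu P′u′ Rv R′v′ →
      Inverses.detℚ-complete u u′ v v′ Pu P′u′ Rv R′v′
      where open At y 0≤y

    module _ (e : Subset N) (edge : Edge C e) where
      open TypedMatrix m n e p r w using (e₁; e₂)

      deleted-value-left : ones e₁ ≡ 2 → ones e₂ ≡ 1 → ∀ y → 0ℚ ≤ y →
        detℚ (charMatrix (deleteEdge C e) (- y)) ≡ σ N * Deleted.value (profile a b) y
      deleted-value-left ones₁ ones₂ y 0≤y = withInverses λ u u′ v v′ Pu P′u′ Rv R′v′ →
        trans (Inverses.detℚ-deleteEdge u u′ v v′ Pu P′u′ Rv R′v′ e edge {suc a} {2} {suc (suc b)} {1} ones₁ ones₂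
                (trans (cong suc (ℕₚ.+-comm a 2)) m≡) (trans (cong (λ k → suc (suc k)) (ℕₚ.+-comm b 1)) n≡))
          (cong (σ N *_) (Inverses.value-left u u′ v v′ Pu P′u′ Rv R′v′))
        where open At y 0≤y

      deleted-value-right : ones e₁ ≡ 1 → ones e₂ ≡ 2 → ∀ y → 0ℚ ≤ y →
        detℚ (charMatrix (deleteEdge C e) (- y)) ≡ σ N * Deleted.value (profile b a) y
      deleted-value-right ones₁ ones₂ y 0≤y = withInverses λ u u′ v v′ Pu P′u′ Rv R′v′ →
        trans (Inverses.detℚ-deleteEdge u u′ v v′ Pu P′u′ Rv R′v′ e edge {suc (suc a)} {1} {suc b} {2} ones₁ ones₂
                (trans (cong (λ k → suc (suc k)) (ℕₚ.+-comm a 1)) m≡) (trans (cong suc (ℕₚ.+-comm b 2)) n≡))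
          (cong (σ N *_) (Inverses.value-right u u′ v v′ Pu P′u′ Rv R′v′))
        where open At y 0≤y

    complete-value-swap : ∀ y → Complete.value (profile b a) y ≡ Complete.value (profile a b) y
    complete-value-swap y = cong₂ _*_ (ℚₚ.*-comm ((y + r) ^ suc (suc b)) ((y + p) ^ suc (suc a))) (quadratic-swap (ι a) (ι b) y)

    -- An edge with two vertices in V₂ leads to `profile b a` after the deletion. The complete
    -- hypergraph must be described by the same profile, which its symmetry in the two classes
    -- allows.
    complete-value′ : ∀ y → 0ℚ ≤ y → detℚ (charMatrix C (- y)) ≡ σ N * Complete.value (profile b a) y
    complete-value′ y 0≤y = trans (complete-value y 0≤y) (cong (σ N *_) (sym (complete-value-swap y)))

    size≡ : a ℕ.+ (suc b ℕ.+ (1 ℕ.+ 4)) ≡ N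
    size≡ = trans (ℕ-solve 2 (λ a b → a :+ℕ (conℕ 1 :+ℕ b :+ℕ conℕ 5) :=ℕ conℕ 3 :+ℕ a :+ℕ (conℕ 3 :+ℕ b)) refl a b)
      (cong₂ ℕ._+_ m≡ n≡)

    size≡′ : b ℕ.+ (suc a ℕ.+ (1 ℕ.+ 4)) ≡ N
    size≡′ = trans (ℕ-solve 2 (λ a b → b :+ℕ (conℕ 1 :+ℕ a :+ℕ conℕ 5) :=ℕ conℕ 3 :+ℕ a :+ℕ (conℕ 3 :+ℕ b)) refl a b)
      (cong₂ ℕ._+_ m≡ n≡)

  -- Comparison of the two energies.

  two-or-one : ∀ k l → 1 ℕ.≤ k → 1 ℕ.≤ l → k ℕ.+ l ≡ 3 → (k ≡ 2 × l ≡ 1) ⊎ (k ≡ 1 × l ≡ 2)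
  two-or-one 1 l       _ _ eq = inj₂ (refl , ℕₚ.suc-injective eq)
  two-or-one 2 l       _ _ eq = inj₁ (refl , ℕₚ.suc-injective (ℕₚ.suc-injective eq))
  two-or-one (suc (suc (suc k))) (suc l) _ _ eq
    with () ← trans (sym (ℕₚ.+-suc k l)) (ℕₚ.suc-injective (ℕₚ.suc-injective (ℕₚ.suc-injective eq)))

  -- An energy is given only up to `_≃_`, so its sequence need not be the sequence of absolute sums;
  -- this carries a uniform gap across the two null differences.
  limits-separated : (f g s t : ℕ → ℚ) → Null (λ k → f k - s k) → Null (λ k → g k - t k) →
    ∃[ ε ] (0ℚ < ε × (∃[ K ] (∀ k → K ℕ.≤ k → s k + ε ≤ t k))) →
    ∃[ ε ] (0ℚ < ε × (∃[ K ] (∀ k → K ℕ.≤ k → f k + ε ≤ g k)))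
  limits-separated f g s t f-s g-t (ε , 0<ε , K , apart) =
    let K₁ , near₁ = f-s η 0<η
        K₂ , near₂ = g-t η 0<η
    in η + η , ℚₚ.+-mono-< 0<η 0<η , K ℕ.⊔ (K₁ ℕ.⊔ K₂) , λ k K≤k →
      let K₁⊔K₂≤k = ℕₚ.m⊔n≤o⇒n≤o K (K₁ ℕ.⊔ K₂) K≤k
      in compare (f k) (g k) (s k) (t k) (apart k (ℕₚ.m⊔n≤o⇒m≤o K (K₁ ℕ.⊔ K₂) K≤k))
           (ℚₚ.<⇒≤ (∣p∣<q⇒p<q (near₁ k (ℕₚ.m⊔n≤o⇒m≤o K₁ K₂ K₁⊔K₂≤k))))
           (ℚₚ.<⇒≤ (∣p∣<q⇒-q<p (near₂ k (ℕₚ.m⊔n≤o⇒n≤o K₁ K₂ K₁⊔K₂≤k))))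
    where
    -- A quarter of `ε`: two errors of this size leave a gap of half of `ε`.
    η : ℚ
    η = ½ * (½ * ε)
    0<η : 0ℚ < η
    0<η = *-pos (ℚₚ.positive⁻¹ ½) (*-pos (ℚₚ.positive⁻¹ ½) 0<ε)
    compare : ∀ f g s t → s + ε ≤ t → f - s ≤ η → - η ≤ g - t → f + (η + η) ≤ g
    compare f g s t s+ε≤t f-s≤η -η≤g-t = ≤-excess (η - (f - s) + (g - t - - η) + (t - (s + ε)))
      (+-nonNeg (+-nonNeg (0≤-difference f-s≤η) (0≤-difference -η≤g-t)) (0≤-difference s+ε≤t))
      (solve 5 (λ f g s t ε → let η = con ½ :* (con ½ :* ε) in
        f :+ (η :+ η) :+ (η :- (f :- s) :+ (g :- t :- :- η) :+ (t :- (s :+ ε))) := g) refl f g s t ε)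

  seidelEnergy-Null : ∀ {N} (E : ℝ) (ev : Vector ℝ N) → E Defs.≃ ∑ (λ i → Defs.∣ ev i ∣) →
    Null (λ k → seq E k - absSum λ i → seq (ev i) k)
  seidelEnergy-Null E ev E≃ = Null-cong (λ k → cong (λ z → seq E k - z) (seq-∑ (λ i → Defs.∣ ev i ∣) k)) E≃

  energy-decreases : ∀ {a b N} (π : Profile a b) → a ℕ.+ (suc b ℕ.+ (1 ℕ.+ 4)) ≡ N → (H H′ : Hypergraph N) →
    (∀ y → 0ℚ ≤ y → detℚ (charMatrix H (- y)) ≡ σ N * Complete.value π y) →
    (∀ y → 0ℚ ≤ y → detℚ (charMatrix H′ (- y)) ≡ σ N * Deleted.value π y) →
    ∀ E E′ → IsSeidelEnergy H E → IsSeidelEnergy H′ E′ → E′ Defs.< E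
  energy-decreases π size≡ H H′ complete deleted E E′ (ev , eigenvalues , E≃) (ev′ , eigenvalues′ , E′≃) =
    limits-separated (seq E′) (seq E) (λ k → absSum (S′.x k)) (λ k → absSum (S.x k))
      (seidelEnergy-Null E′ ev′ E′≃) (seidelEnergy-Null E ev E≃)
      (Gap.gap-between-energies π size≡ S′.x S.x S′.values S′.roots S.values)
    where
    module S  = Spectrum H (Complete.value π) complete ev eigenvalues
    module S′ = Spectrum H′ (Deleted.value π) deleted ev′ eigenvalues′

open import Defs
open import Data.Nat using (_≤_)
open import Data.Fin.Subset using (Subset)

open Spectra using (ones; ones-positive; ones-↑; two-or-one; profile; energy-decreases; module CharacteristicPolynomials)

theorem2p12 : (m n : ℕ) → 3 ≤ m → 3 ≤ n →
    (e : Subset (m ℕ.+ n)) → Edge (completeBipartite³ m n) e →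
    (E E′ : ℝ) →
    IsSeidelEnergy (completeBipartite³ m n) E →
    IsSeidelEnergy (deleteEdge (completeBipartite³ m n) e) E′ →
    E′ < E
theorem2p12 m n 3≤m 3≤n e edge@(size , (i , i∈e) , (j , j∈e)) E E′ =
  cases (ℕₚ.m≤n⇒∃[o]m+o≡n 3≤m) (ℕₚ.m≤n⇒∃[o]m+o≡n 3≤n)
    (two-or-one (ones e₁) (ones e₂)
      (ones-positive e₁ i ([]=⇒lookup i∈e)) (ones-positive e₂ j ([]=⇒lookup j∈e)) (trans (ones-↑ m e) size))
  where
  e₁ : Fin m → Bool
  e₁ i = lookup e (i ↑ˡ n)
  e₂ : Fin n → Bool
  e₂ j = lookup e (m ↑ʳ j)
  C : Hypergraph (m ℕ.+ n)
  C = completeBipartite³ m n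

  cases : ∃[ a ] 3 ℕ.+ a ≡ m → ∃[ b ] 3 ℕ.+ b ≡ n → (ones e₁ ≡ 2 × ones e₂ ≡ 1) ⊎ (ones e₁ ≡ 1 × ones e₂ ≡ 2) →
    IsSeidelEnergy C E → IsSeidelEnergy (deleteEdge C e) E′ → E′ < E
  cases (a , m≡) (b , n≡) (inj₁ (ones₁ , ones₂)) = energy-decreases (profile a b) size≡ C (deleteEdge C e)
    complete-value (deleted-value-left e edge ones₁ ones₂) E E′
    where open CharacteristicPolynomials m n a b m≡ n≡
  cases (a , m≡) (b , n≡) (inj₂ (ones₁ , ones₂)) = energy-decreases (profile b a) size≡′ C (deleteEdge C e)
    complete-value′ (deleted-value-right e edge ones₁ ones₂) E E′
    where open CharacteristicPolynomials m n a b m≡ n≡
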